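{- Let $r\ge 2$ and $d\ge 3$ be fixed integers. Let $G$ be a $d$-regular $n$-vertex graph with $\lambda(G)\le d-2$. Then $\mathcal{D}_r(G,\mathcal{T}_n)=\Theta_d(n)$; that is, there are constants $c_1,c_2>0$ and $n_0$, depending only on $d$ and $r$, such that every such $G$ with $n\ge n_0$ satisfies $c_1 n\le \mathcal{D}_r(G,\mathcal{T}_n)\le c_2 n$.
   Context: Graphs are finite and simple. $\lambda(G)$ denotes the second largest eigenvalue (counted with multiplicity) of the adjacency matrix of $G$. Spanning-tree discrepancy: for a connected $n$-vertex graph $G$, an $r$-colouring $f:E(G)\to[r]$ of its edges, and a spanning tree $T$ of $G$ (which has $n-1$ edges), put $D_f(T) := r\cdot\left(\max_{1\le i\le r}|f^{ -1}(i)\cap E(T)| - \frac{n-1}{r}\right)$. The $r$-colour spanning-tree discrepancy of $G$ is $\mathcal{D}_r(G,\mathcal{T}_n) := \min_{f:E(G)\to[r]}\ \max_{T} D_f(T)$, where the maximum is over all spanning trees $T$ of $G$. -}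

module Defs where

open import Algebra.Bundles.Raw using (RawMonoid)
import Algebra.Definitions.RawMonoid as RawMonoidDefs
open import Data.Bool.Base using (Bool; false; T; if_then_else_)
open import Data.Bool.Properties using (T?)
open import Data.Fin.Base as Fin using (Fin; toℕ)
import Data.Fin.Properties as Fin
open import Data.Integer.Base as ℤ using (+_)
open import Data.List.Base
  using (List; []; _∷_; _++_; allFin; cartesianProduct; filter; filterᵇ; length; map; mapMaybe)
open import Data.List.Extrema.Nat using (max)
open import Data.List.Relation.Unary.Linked using (Linked)
open import Data.List.Relation.Unary.Unique.Propositional using (Unique)
open import Data.Maybe.Base using (Maybe; just; nothing)
open import Data.Nat.Base as ℕ using (ℕ; NonZero)
import Data.Nat.Properties as ℕ
open import Data.Product.Base using (Σ-syntax; ∃-syntax; _×_; _,_)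
open import Data.Rational.Base as ℚ using (ℚ; 0ℚ; 1ℚ; ½)
import Data.Rational.Properties as ℚ
open import Data.Rational.Solver using (module +-*-Solver)
open import Level using (0ℓ)
open import Relation.Binary.Construct.Closure.ReflexiveTransitive using (Star)
open import Relation.Binary.PropositionalEquality
  using (_≡_; refl; sym; trans; cong; cong₂; subst)
open import Relation.Nullary.Decidable.Core using (yes; no)
open import Relation.Nullary.Negation.Core using (¬_)

------------------------------------------------------------------------
-- Real numbers: rational Cauchy sequences, compared up to the setoid
-- equality _≃_. All operations act termwise.

IsCauchy : (ℕ → ℚ) → Set
IsCauchy s = ∀ ε → 0ℚ ℚ.< ε →
             ∃[ N ] ∀ m n → N ℕ.≤ m → N ℕ.≤ n → ℚ.∣ s m ℚ.- s n ∣ ℚ.< ε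

record ℝ : Set where
  constructor mkℝ
  field
    seq    : ℕ → ℚ
    cauchy : IsCauchy seq

open ℝ public

infix 4 _≃_ _≤ᵣ_

_≃_ : ℝ → ℝ → Set
x ≃ y = ∀ ε → 0ℚ ℚ.< ε → ∃[ N ] ∀ n → N ℕ.≤ n → ℚ.∣ seq x n ℚ.- seq y n ∣ ℚ.< ε

_≤ᵣ_ : ℝ → ℝ → Set
x ≤ᵣ y = ∀ ε → 0ℚ ℚ.< ε → ∃[ N ] ∀ n → N ℕ.≤ n → seq x n ℚ.< seq y n ℚ.+ ε

fromℚ : ℚ → ℝ
fromℚ q = mkℝ (λ _ → q) λ ε 0<ε →
  0 , λ _ _ _ _ → subst (λ z → ℚ.∣ z ∣ ℚ.< ε) (sym (ℚ.+-inverseʳ q)) 0<ε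

0ᵣ 1ᵣ : ℝ
0ᵣ = fromℚ 0ℚ
1ᵣ = fromℚ 1ℚ

private
  half-pos : ∀ {ε} → 0ℚ ℚ.< ε → 0ℚ ℚ.< ε ℚ.* ½
  half-pos {ε} 0<ε =
    subst (ℚ._< ε ℚ.* ½) (ℚ.*-zeroˡ ½) (ℚ.*-monoˡ-<-pos ½ 0<ε)

  half+half : ∀ ε → ε ℚ.* ½ ℚ.+ ε ℚ.* ½ ≡ ε
  half+half ε = trans (sym (ℚ.*-distribˡ-+ ε ½ ½)) (ℚ.*-identityʳ ε)

  +-swap : ∀ a b c d → (a ℚ.+ b) ℚ.- (c ℚ.+ d) ≡ (a ℚ.- c) ℚ.+ (b ℚ.- d)
  +-swap = solve 4 (λ a b c d → (a :+ b) :- (c :+ d) := (a :- c) :+ (b :- d)) refl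
    where open +-*-Solver

  *-split : ∀ a b c d →
            a ℚ.* b ℚ.- c ℚ.* d ≡ a ℚ.* (b ℚ.- d) ℚ.+ d ℚ.* (a ℚ.- c)
  *-split = solve 4 (λ a b c d → a :* b :- c :* d := a :* (b :- d) :+ d :* (a :- c)) refl
    where open +-*-Solver

  cancel-sub : ∀ a b → (a ℚ.- b) ℚ.+ b ≡ a
  cancel-sub = solve 2 (λ a b → (a :- b) :+ b := a) refl
    where open +-*-Solver

  eventually-bounded : ∀ x → Σ[ B ∈ ℚ ] 0ℚ ℚ.< B ×
                       (∃[ N ] ∀ n → N ℕ.≤ n → ℚ.∣ seq x n ∣ ℚ.≤ B)
  eventually-bounded x =
    let (N , close) = cauchy x 1ℚ (ℚ.positive⁻¹ 1ℚ)
    in 1ℚ ℚ.+ ℚ.∣ seq x N ∣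
     , ℚ.+-mono-<-≤ (ℚ.positive⁻¹ 1ℚ) (ℚ.0≤∣p∣ (seq x N))
     , N , λ n N≤n → begin
      ℚ.∣ seq x n ∣
        ≡⟨ cong ℚ.∣_∣ (cancel-sub (seq x n) (seq x N)) ⟨
      ℚ.∣ (seq x n ℚ.- seq x N) ℚ.+ seq x N ∣
        ≤⟨ ℚ.∣p+q∣≤∣p∣+∣q∣ (seq x n ℚ.- seq x N) (seq x N) ⟩
      ℚ.∣ seq x n ℚ.- seq x N ∣ ℚ.+ ℚ.∣ seq x N ∣
        ≤⟨ ℚ.+-monoˡ-≤ ℚ.∣ seq x N ∣ (ℚ.<⇒≤ (close n N N≤n ℕ.≤-refl)) ⟩
      1ℚ ℚ.+ ℚ.∣ seq x N ∣ ∎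
    where open ℚ.≤-Reasoning

  ∣+∣-bound : ∀ {α β} a b c d → ℚ.∣ a ℚ.- c ∣ ℚ.< α → ℚ.∣ b ℚ.- d ∣ ℚ.< β →
              ℚ.∣ (a ℚ.+ b) ℚ.- (c ℚ.+ d) ∣ ℚ.< α ℚ.+ β
  ∣+∣-bound {α} {β} a b c d p q = begin-strict
      ℚ.∣ (a ℚ.+ b) ℚ.- (c ℚ.+ d) ∣        ≡⟨ cong ℚ.∣_∣ (+-swap a b c d) ⟩
      ℚ.∣ (a ℚ.- c) ℚ.+ (b ℚ.- d) ∣        ≤⟨ ℚ.∣p+q∣≤∣p∣+∣q∣ (a ℚ.- c) (b ℚ.- d) ⟩
      ℚ.∣ a ℚ.- c ∣ ℚ.+ ℚ.∣ b ℚ.- d ∣      <⟨ ℚ.+-mono-< p q ⟩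
      α ℚ.+ β                              ∎
    where open ℚ.≤-Reasoning

  ∣*∣-bound : ∀ {B δ} a b → 0ℚ ℚ.< B → ℚ.∣ a ∣ ℚ.≤ B → ℚ.∣ b ∣ ℚ.< δ →
              ℚ.∣ a ℚ.* b ∣ ℚ.< B ℚ.* δ
  ∣*∣-bound {B} {δ} a b 0<B a≤B b<δ = begin-strict
      ℚ.∣ a ℚ.* b ∣        ≡⟨ ℚ.∣p*q∣≡∣p∣*∣q∣ a b ⟩
      ℚ.∣ a ∣ ℚ.* ℚ.∣ b ∣
        ≤⟨ ℚ.*-monoʳ-≤-nonNeg ℚ.∣ b ∣ {{ℚ.nonNegative (ℚ.0≤∣p∣ b)}} a≤B ⟩
      B ℚ.* ℚ.∣ b ∣        <⟨ ℚ.*-monoʳ-<-pos B {{ℚ.positive 0<B}} b<δ ⟩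
      B ℚ.* δ              ∎
    where open ℚ.≤-Reasoning

  ∣**∣-bound : ∀ {B C δ η} a b c d → 0ℚ ℚ.< B → 0ℚ ℚ.< C →
               ℚ.∣ a ∣ ℚ.≤ B → ℚ.∣ d ∣ ℚ.≤ C →
               ℚ.∣ b ℚ.- d ∣ ℚ.< δ → ℚ.∣ a ℚ.- c ∣ ℚ.< η →
               ℚ.∣ a ℚ.* b ℚ.- c ℚ.* d ∣ ℚ.< B ℚ.* δ ℚ.+ C ℚ.* η
  ∣**∣-bound {B} {C} {δ} {η} a b c d 0<B 0<C a≤B d≤C p q = begin-strict
      ℚ.∣ a ℚ.* b ℚ.- c ℚ.* d ∣
        ≡⟨ cong ℚ.∣_∣ (*-split a b c d) ⟩
      ℚ.∣ a ℚ.* (b ℚ.- d) ℚ.+ d ℚ.* (a ℚ.- c) ∣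
        ≤⟨ ℚ.∣p+q∣≤∣p∣+∣q∣ (a ℚ.* (b ℚ.- d)) (d ℚ.* (a ℚ.- c)) ⟩
      ℚ.∣ a ℚ.* (b ℚ.- d) ∣ ℚ.+ ℚ.∣ d ℚ.* (a ℚ.- c) ∣
        <⟨ ℚ.+-mono-< (∣*∣-bound a (b ℚ.- d) 0<B a≤B p)
                      (∣*∣-bound d (a ℚ.- c) 0<C d≤C q) ⟩
      B ℚ.* δ ℚ.+ C ℚ.* η ∎
    where open ℚ.≤-Reasoning

  shrink : ∀ {B γ} → 0ℚ ℚ.< B → 0ℚ ℚ.< γ → Σ[ δ ∈ ℚ ] 0ℚ ℚ.< δ × B ℚ.* δ ≡ γ
  shrink {B} {γ} 0<B 0<γ = δ , 0<δ , Bδ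
    where
    instance
      B-pos : ℚ.Positive B
      B-pos = ℚ.positive 0<B
      B-nz : ℚ.NonZero B
      B-nz = ℚ.pos⇒nonZero B
      1/B-pos : ℚ.Positive (ℚ.1/ B)
      1/B-pos = ℚ.1/pos⇒pos B
    δ : ℚ
    δ = (ℚ.1/ B) ℚ.* γ
    0<δ : 0ℚ ℚ.< δ
    0<δ = subst (ℚ._< δ) (ℚ.*-zeroʳ (ℚ.1/ B)) (ℚ.*-monoʳ-<-pos (ℚ.1/ B) 0<γ)
    Bδ : B ℚ.* δ ≡ γ
    Bδ = trans (sym (ℚ.*-assoc B (ℚ.1/ B) γ))
          (trans (cong (ℚ._* γ) (ℚ.*-inverseʳ B)) (ℚ.*-identityˡ γ))

-- Abstract so that normalising a real expression leaves the Cauchy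
-- proofs alone; only the terms of a sequence are ever computed with.
abstract
  +ᵣ-cauchy : ∀ x y → IsCauchy (λ n → seq x n ℚ.+ seq y n)
  +ᵣ-cauchy x y ε 0<ε =
    let (M , p) = cauchy x (ε ℚ.* ½) (half-pos 0<ε)
        (N , q) = cauchy y (ε ℚ.* ½) (half-pos 0<ε)
    in M ℕ.⊔ N , λ m n l k →
       subst (ℚ._<_ _) (half+half ε)
         (∣+∣-bound (seq x m) (seq y m) (seq x n) (seq y n)
           (p m n (ℕ.m⊔n≤o⇒m≤o M N l) (ℕ.m⊔n≤o⇒m≤o M N k))
           (q m n (ℕ.m⊔n≤o⇒n≤o M N l) (ℕ.m⊔n≤o⇒n≤o M N k)))

  *ᵣ-cauchy : ∀ x y → IsCauchy (λ n → seq x n ℚ.* seq y n)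
  *ᵣ-cauchy x y ε 0<ε =
    let (B , 0<B , M₁ , x≤B) = eventually-bounded x
        (C , 0<C , M₂ , y≤C) = eventually-bounded y
        (δ , 0<δ , Bδ)       = shrink 0<B (half-pos 0<ε)
        (η , 0<η , Cη)       = shrink 0<C (half-pos 0<ε)
        (N₁ , p)             = cauchy y δ 0<δ
        (N₂ , q)             = cauchy x η 0<η
        M = M₁ ℕ.⊔ M₂
        N = N₁ ℕ.⊔ N₂
    in M ℕ.⊔ N , λ m n l k →
       let lM = ℕ.m⊔n≤o⇒m≤o M N l
           lN = ℕ.m⊔n≤o⇒n≤o M N l
           kM = ℕ.m⊔n≤o⇒m≤o M N k
           kN = ℕ.m⊔n≤o⇒n≤o M N k
       in subst (ℚ._<_ _) (trans (cong₂ ℚ._+_ Bδ Cη) (half+half ε))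
            (∣**∣-bound (seq x m) (seq y m) (seq x n) (seq y n) 0<B 0<C
              (x≤B m (ℕ.m⊔n≤o⇒m≤o M₁ M₂ lM))
              (y≤C n (ℕ.m⊔n≤o⇒n≤o M₁ M₂ kM))
              (p m n (ℕ.m⊔n≤o⇒m≤o N₁ N₂ lN) (ℕ.m⊔n≤o⇒m≤o N₁ N₂ kN))
              (q m n (ℕ.m⊔n≤o⇒n≤o N₁ N₂ lN) (ℕ.m⊔n≤o⇒n≤o N₁ N₂ kN)))

infixl 6 _+ᵣ_
infixl 7 _*ᵣ_

_+ᵣ_ : ℝ → ℝ → ℝ
x +ᵣ y = mkℝ (λ n → seq x n ℚ.+ seq y n) (+ᵣ-cauchy x y)

_*ᵣ_ : ℝ → ℝ → ℝ
x *ᵣ y = mkℝ (λ n → seq x n ℚ.* seq y n) (*ᵣ-cauchy x y)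

+ᵣ-rawMonoid : RawMonoid 0ℓ 0ℓ
+ᵣ-rawMonoid = record { Carrier = ℝ ; _≈_ = _≃_ ; _∙_ = _+ᵣ_ ; ε = 0ᵣ }

open RawMonoidDefs +ᵣ-rawMonoid public using (sum)

------------------------------------------------------------------------
-- Real matrices and their eigenvalues

Vecᵣ : ℕ → Set
Vecᵣ n = Fin n → ℝ

Matrix : ℕ → Set
Matrix n = Fin n → Fin n → ℝ

infix 4 _≋_

_≋_ : ∀ {n} → Vecᵣ n → Vecᵣ n → Set
u ≋ v = ∀ i → u i ≃ v i

_·_ : ∀ {n} → Matrix n → Vecᵣ n → Vecᵣ n
(A · v) i = sum λ j → A i j *ᵣ v j

combination : ∀ {k n} → (Fin k → ℝ) → (Fin k → Vecᵣ n) → Vecᵣ n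
combination c v j = sum λ i → c i *ᵣ v i j

record IsBasis {k n} (v : Fin k → Vecᵣ n) : Set where
  field
    independent : ∀ c → combination c v ≋ (λ _ → 0ᵣ) → ∀ i → c i ≃ 0ᵣ
    spanning    : ∀ w → ∃[ c ] combination c v ≋ w

-- The eigenvalues of a real symmetric n × n matrix, counted with
-- multiplicity and listed in non-increasing order. Since the
-- eigenvectors form a basis of ℝⁿ, none of them is zero and each
-- eigenvalue occurs as often as the dimension of its eigenspace. (For a non-symmetric
-- matrix such a list need not exist.)
record IsSpectrum {n} (A : Matrix n) (μ : Fin n → ℝ) : Set where
  field
    decreasing    : ∀ i j → i Fin.≤ j → μ j ≤ᵣ μ i
    eigenvector   : Fin n → Vecᵣ n
    eigenbasis    : IsBasis eigenvector
    eigenequation : ∀ i → A · eigenvector i ≋ λ j → μ i *ᵣ eigenvector i j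

-- Indices start at 0, so the second largest eigenvalue has index 1.
IsSecondLargestEigenvalue : ∀ {n} → Matrix n → ℝ → Set
IsSecondLargestEigenvalue {n} A x =
  Σ[ μ ∈ (Fin n → ℝ) ] IsSpectrum A μ × (Σ[ i ∈ Fin n ] toℕ i ≡ 1 × μ i ≃ x)

------------------------------------------------------------------------
-- Finite simple graphs

record Graph (n : ℕ) : Set where
  field
    adj       : Fin n → Fin n → Bool
    symmetric : ∀ u v → adj u v ≡ adj v u
    loopless  : ∀ u → adj u u ≡ false

open Graph public

Adj : ∀ {n} → Graph n → Fin n → Fin n → Set
Adj G u v = T (adj G u v)

degree : ∀ {n} → Graph n → Fin n → ℕ
degree {n} G u = length (filterᵇ (adj G u) (allFin n))

Regular : ∀ {n} → ℕ → Graph n → Set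
Regular d G = ∀ u → degree G u ≡ d

adjacencyMatrix : ∀ {n} → Graph n → Matrix n
adjacencyMatrix G u v = if adj G u v then 1ᵣ else 0ᵣ

Connected : ∀ {n} → Graph n → Set
Connected G = ∀ u v → Star (Adj G) u v

-- A cycle v₀ v₁ … v_k v₀ with v₀, …, v_k distinct and k ≥ 2.
record Cycle {n} (G : Graph n) : Set where
  field
    start    : Fin n
    rest     : List (Fin n)
    long     : 2 ℕ.≤ length rest
    distinct : Unique (start ∷ rest)
    closed   : Linked (Adj G) (start ∷ rest ++ start ∷ [])

record IsTree {n} (G : Graph n) : Set where
  field
    connected : Connected G
    acyclic   : ¬ Cycle G

-- An unordered edge {u , v} is stored once, with u < v. The proofs are
-- irrelevant, so an edge is determined by its endpoints.
record Edge {n} (G : Graph n) : Set where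
  constructor edge
  field
    u v        : Fin n
    .ordered   : u Fin.< v
    .adjacent  : Adj G u v

edges : ∀ {n} (G : Graph n) → List (Edge G)
edges {n} G = mapMaybe toEdge (cartesianProduct (allFin n) (allFin n))
  where
  toEdge : Fin n × Fin n → Maybe (Edge G)
  toEdge (u , v) with u Fin.<? v | T? (adj G u v)
  ... | yes u<v | yes u~v = just (edge u v u<v u~v)
  ... | _       | _       = nothing

record SpanningTree {n} (G : Graph n) : Set where
  field
    tree     : Graph n
    isTree   : IsTree tree
    subgraph : ∀ u v → Adj tree u v → Adj G u v

  inclusion : Edge tree → Edge G
  inclusion (edge u v u<v u~v) = edge u v u<v (subgraph u v u~v)

------------------------------------------------------------------------
-- Spanning-tree discrepancy

Colouring : ∀ {n} → Graph n → ℕ → Set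
Colouring G r = Edge G → Fin r

fromℕ : ℕ → ℚ
fromℕ k = + k ℚ./ 1

module _ {n r : ℕ} {G : Graph n} (f : Colouring G r) (S : SpanningTree G) where
  open SpanningTree S

  colourCount : Fin r → ℕ
  colourCount i = length (filter (λ e → f (inclusion e) Fin.≟ i) (edges tree))

  -- The default value 0 of max is harmless: counts are non-negative.
  maxColourCount : ℕ
  maxColourCount = max 0 (map colourCount (allFin r))

  treeDiscrepancy : .{{NonZero r}} → ℚ
  treeDiscrepancy = fromℕ r ℚ.* (fromℕ maxColourCount ℚ.- (+ n ℤ.- + 1) ℚ./ r)

IsMaximum IsMinimum : {A : Set} → (A → ℚ) → ℚ → Set
IsMaximum F m = (∃[ a ] F a ≡ m) × (∀ a → F a ℚ.≤ m)
IsMinimum F m = (∃[ a ] F a ≡ m) × (∀ a → m ℚ.≤ F a)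

-- D is the minimum over all colourings f of the maximum M f, over all
-- spanning trees, of the tree discrepancy. There is at most one such D,
-- and there is one exactly when G has a spanning tree.
IsDiscrepancy : ∀ {n} (G : Graph n) (r : ℕ) .{{_ : NonZero r}} → ℚ → Set
IsDiscrepancy G r D =
  Σ[ M ∈ (Colouring G r → ℚ) ]
    (∀ f → IsMaximum (λ S → treeDiscrepancy f S) (M f)) × IsMinimum M D

{-# OPTIONS --safe #-}
-- Expansion.  For x ⊥ 1 and τ slightly above d − 2, the operator T = 1 + s (A − τ) with s small has all eigenvalues
-- but the one of 1 in [0 , 1], so the moments m k = ⟪ x , T ^ k x ⟫ are bounded.  Since 0 ≤ ∥ T ^ k x − x ∥² gives
-- m (2 k) − m 0 ≥ 2 (m k − m 0), this forces m 1 ≤ m 0, that is ⟪ x , A x ⟫ ≤ τ ⟪ x , x ⟫; no orthogonality of the given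
-- eigenvectors is needed.  Hence a set of s vertices has at least 2 s (n − s) / n boundary edges.
--
-- Lower bound.  For each colour i grow a spanning tree that prefers edges of colour i; the blocks between two uses of
-- another colour are closed under colour i, so it has n − (number of blocks) edges of colour i.  Give a vertex with k
-- edges of colour i the weight 6, 3, 2 or 0 according to k = 0, k = 1, 1 < k < d or k = d.  By expansion a closed set of
-- at most 3n/4 vertices weighs at least 6, whereas the weights at one vertex sum over all colours to at most 6 (r − 1),
-- and to less if the vertex meets several colours.  A positive fraction of the vertices meet several colours, again
-- by expansion, unless one colour already dominates; so the r trees together use at least (1 + ε) n edges of their
-- own colours.

module Submission where

open import Defs
open import Data.Integer.Base as ℤ using (+_)
open import Data.Nat.Base using (ℕ; NonZero; _≤_)
open import Data.Product.Base using (Σ-syntax; _×_)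
open import Data.Rational.Base as ℚ using (ℚ; 0ℚ)

open import Algebra.Bundles using (CommutativeRing; CommutativeSemiring)
import Algebra.Properties.Semiring.Sum as SemiringSum
open import Algebra.Structures.Biased using (isCommutativeSemiringˡ)
open import Data.Bool.Base using (Bool; true; false; not; if_then_else_; T; _∧_; _∨_)
import Data.Bool.Properties as Bool
open import Data.Empty using (⊥; ⊥-elim)
import Data.Empty.Irrelevant
open import Data.Fin.Base as Fin using (Fin; zero; suc; toℕ; finToFun; funToFin)
import Data.Fin.Properties as Fin
open import Data.Integer.Base using (ℤ)
import Data.Integer.Properties as ℤ
open import Data.List.Base
  using (List; []; _∷_; _++_; allFin; cartesianProduct; filter; filterᵇ; length; map; mapMaybe; tabulate)
open import Data.List.Extrema.Nat using (max; xs≤max; max≤v⁺)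
import Data.List.Membership.DecPropositional as DecMembership
open import Data.List.Membership.Propositional using (_∈_)
open import Data.List.Membership.Propositional.Properties using (∈-map⁺; ∈-allFin)
import Data.List.Properties as List
open import Data.List.Relation.Unary.All as All using (All; []; _∷_)
import Data.List.Relation.Unary.All.Properties as All
open import Data.List.Relation.Unary.AllPairs using ([]; _∷_)
open import Data.List.Relation.Unary.Any using (here; there)
open import Data.List.Relation.Unary.Linked as Linked using (Linked; [-]; _∷_)
open import Data.List.Relation.Unary.Unique.Propositional using (Unique)
open import Data.Maybe.Base using (Maybe; just; nothing)
open import Data.Nat.Base as ℕ using (zero; suc; _+_; _*_; _∸_; _<_; z≤n; s≤s; _≡ᵇ_)
import Data.Nat.Properties as ℕ
open import Data.Nat.Tactic.RingSolver using (solve-∀)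
open import Data.Product.Base using (∃-syntax; _,_; proj₁; proj₂)
open import Data.Rational.Base using (1ℚ; ½)
import Data.Rational.Properties as ℚ
open import Data.Rational.Solver using (module +-*-Solver)
import Data.Rational.Unnormalised.Base as ℚᵘ
import Data.Rational.Unnormalised.Properties as ℚᵘ
open import Data.Sum.Base using (_⊎_; inj₁; inj₂; [_,_]′)
open import Function.Base using (_∘_; id)
open import Level using (0ℓ)
open import Relation.Binary.Construct.Closure.ReflexiveTransitive as Star using (Star; _◅_; _◅◅_)
open import Relation.Binary.Definitions using (Tri; tri<; tri≈; tri>)
open import Relation.Binary.PropositionalEquality
  using (_≡_; _≢_; refl; sym; trans; cong; cong₂; subst; subst₂; module ≡-Reasoning)
import Relation.Binary.Reasoning.Setoid as SetoidReasoning
open import Relation.Binary.Structures using (IsEquivalence)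
open import Relation.Nullary using (Dec; does; yes; no; ¬_)
open import Relation.Nullary.Decidable using (T?; dec-true; dec-false; _×-dec_; ¬?)
open import Relation.Unary using (Decidable)

-- Cauchy reals

-- The weights answer to the smallest closed sets: one vertex of degree 0, two of degree 1 and three
-- of larger degree must each weigh 6, the least common multiple of 1, 2 and 3. A vertex of degree d
-- weighs nothing; a closed set that contains one but no isolated vertex is saved by its size limit
-- 3n/4, since expansion makes its boundary edges leave from at least three vertices, each of weight
-- at least 2. A block above the limit is no loss: it supplies about 3n/4 edges of one colour, well
-- above n / r.
--
-- At one vertex the amounts saved below 6 are 0, 3, 4 and 6 in the four cases. A single colour
-- saves 6, several colours save 4 + 3 or, as d ≥ 3, at least three times 3. This surplus of 1 is
-- the whole gain.
--
-- That x ⊥ 1 removes the first eigenvector takes an argument of its own for a basis that need not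
-- be orthogonal: summing coordinates shows that all other eigenvectors are orthogonal to 1, because
-- d - 2 < d.
--
-- The discrepancy must also be shown to exist, as a minimum of maxima over types of functions and
-- records; colourings and trees are therefore coded by numbers.

module Σℚ = SemiringSum (CommutativeRing.semiring ℚ.+-*-commutativeRing)

Eventually : (ℕ → Set) → Set
Eventually P = ∃[ N ] ∀ n → N ≤ n → P n

always : ∀ {P : ℕ → Set} → (∀ n → P n) → Eventually P
always p = 0 , λ n _ → p n

eventually-map : ∀ {P Q : ℕ → Set} → (∀ n → P n → Q n) → Eventually P → Eventually Q
eventually-map f (N , p) = N , λ n N≤n → f n (p n N≤n)

eventually-zip : ∀ {P Q R : ℕ → Set} → (∀ n → P n → Q n → R n) →
                 Eventually P → Eventually Q → Eventually R
eventually-zip f (M , p) (N , q) = M ℕ.⊔ N , λ n l →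
  f n (p n (ℕ.m⊔n≤o⇒m≤o M N l)) (q n (ℕ.m⊔n≤o⇒n≤o M N l))

eventually-witness : ∀ {P : ℕ → Set} → Eventually P → ∃[ n ] P n
eventually-witness (N , p) = N , p N ℕ.≤-refl

halve : ∀ {ε} → 0ℚ ℚ.< ε → Σ[ δ ∈ ℚ ] 0ℚ ℚ.< δ × δ ℚ.+ δ ≡ ε
halve {ε} 0<ε = ε ℚ.* ½
  , subst (ℚ._< ε ℚ.* ½) (ℚ.*-zeroˡ ½) (ℚ.*-monoˡ-<-pos ½ 0<ε)
  , trans (sym (ℚ.*-distribˡ-+ ε ½ ½)) (ℚ.*-identityʳ ε)

divide : ∀ {B ε} → 0ℚ ℚ.< B → 0ℚ ℚ.< ε → Σ[ δ ∈ ℚ ] 0ℚ ℚ.< δ × B ℚ.* δ ≡ ε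
divide {B} {ε} 0<B 0<ε = (ℚ.1/ B) ℚ.* ε
  , subst (ℚ._< (ℚ.1/ B) ℚ.* ε) (ℚ.*-zeroʳ (ℚ.1/ B)) (ℚ.*-monoʳ-<-pos (ℚ.1/ B) 0<ε)
  , trans (sym (ℚ.*-assoc B (ℚ.1/ B) ε))
      (trans (cong (ℚ._* ε) (ℚ.*-inverseʳ B)) (ℚ.*-identityˡ ε))
  where
  instance
    B-pos : ℚ.Positive B
    B-pos = ℚ.positive 0<B
    B-nonZero : ℚ.NonZero B
    B-nonZero = ℚ.pos⇒nonZero B
    1/B-pos : ℚ.Positive (ℚ.1/ B)
    1/B-pos = ℚ.1/pos⇒pos B

*-monoʳ : ∀ {p q r} → 0ℚ ℚ.≤ r → p ℚ.≤ q → r ℚ.* p ℚ.≤ r ℚ.* q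
*-monoʳ {r = r} 0≤r = ℚ.*-monoˡ-≤-nonNeg r {{ℚ.nonNegative 0≤r}}

*-mono : ∀ {p q r s} → 0ℚ ℚ.≤ p → 0ℚ ℚ.≤ s → p ℚ.≤ q → r ℚ.≤ s → p ℚ.* r ℚ.≤ q ℚ.* s
*-mono {p} {q} {r} {s} 0≤p 0≤s p≤q r≤s =
  ℚ.≤-trans (*-monoʳ 0≤p r≤s) (ℚ.*-monoʳ-≤-nonNeg s {{ℚ.nonNegative 0≤s}} p≤q)

∣-∣-sym : ∀ p q → ℚ.∣ p ℚ.- q ∣ ≡ ℚ.∣ q ℚ.- p ∣
∣-∣-sym p q = trans (cong ℚ.∣_∣ (lemma p q)) (ℚ.∣-p∣≡∣p∣ (q ℚ.- p))
  where
  open +-*-Solver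
  lemma : ∀ p q → p ℚ.- q ≡ ℚ.- (q ℚ.- p)
  lemma = solve 2 (λ p q → p :- q := :- (q :- p)) refl

∣-∣-triangle : ∀ p q r → ℚ.∣ p ℚ.- r ∣ ℚ.≤ ℚ.∣ p ℚ.- q ∣ ℚ.+ ℚ.∣ q ℚ.- r ∣
∣-∣-triangle p q r = begin
  ℚ.∣ p ℚ.- r ∣                          ≡⟨ cong ℚ.∣_∣ (lemma p q r) ⟩
  ℚ.∣ (p ℚ.- q) ℚ.+ (q ℚ.- r) ∣          ≤⟨ ℚ.∣p+q∣≤∣p∣+∣q∣ (p ℚ.- q) (q ℚ.- r) ⟩
  ℚ.∣ p ℚ.- q ∣ ℚ.+ ℚ.∣ q ℚ.- r ∣        ∎
  where
  open ℚ.≤-Reasoning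
  lemma : ∀ p q r → p ℚ.- r ≡ (p ℚ.- q) ℚ.+ (q ℚ.- r)
  lemma = solve 3 (λ p q r → p :- r := (p :- q) :+ (q :- r)) refl
    where open +-*-Solver

∣-∣-+ : ∀ {δ η} p p′ q q′ → ℚ.∣ p ℚ.- p′ ∣ ℚ.< δ → ℚ.∣ q ℚ.- q′ ∣ ℚ.< η →
        ℚ.∣ (p ℚ.+ q) ℚ.- (p′ ℚ.+ q′) ∣ ℚ.< δ ℚ.+ η
∣-∣-+ {δ} {η} p p′ q q′ p<δ q<η = begin-strict
  ℚ.∣ (p ℚ.+ q) ℚ.- (p′ ℚ.+ q′) ∣        ≡⟨ cong ℚ.∣_∣ (lemma p p′ q q′) ⟩
  ℚ.∣ (p ℚ.- p′) ℚ.+ (q ℚ.- q′) ∣        ≤⟨ ℚ.∣p+q∣≤∣p∣+∣q∣ (p ℚ.- p′) (q ℚ.- q′) ⟩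
  ℚ.∣ p ℚ.- p′ ∣ ℚ.+ ℚ.∣ q ℚ.- q′ ∣      <⟨ ℚ.+-mono-< p<δ q<η ⟩
  δ ℚ.+ η                                ∎
  where
  open ℚ.≤-Reasoning
  lemma : ∀ a a′ b b′ → (a ℚ.+ b) ℚ.- (a′ ℚ.+ b′) ≡ (a ℚ.- a′) ℚ.+ (b ℚ.- b′)
  lemma = solve 4 (λ a a′ b b′ → (a :+ b) :- (a′ :+ b′) := (a :- a′) :+ (b :- b′)) refl
    where open +-*-Solver

∣-∣-* : ∀ {B δ} p q q′ → 0ℚ ℚ.< B → ℚ.∣ p ∣ ℚ.≤ B → ℚ.∣ q ℚ.- q′ ∣ ℚ.< δ →
        ℚ.∣ p ℚ.* q ℚ.- p ℚ.* q′ ∣ ℚ.< B ℚ.* δ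
∣-∣-* {B} {δ} p q q′ 0<B p≤B q<δ = begin-strict
  ℚ.∣ p ℚ.* q ℚ.- p ℚ.* q′ ∣             ≡⟨ cong ℚ.∣_∣ (lemma p q q′) ⟩
  ℚ.∣ p ℚ.* (q ℚ.- q′) ∣                 ≡⟨ ℚ.∣p*q∣≡∣p∣*∣q∣ p (q ℚ.- q′) ⟩
  ℚ.∣ p ∣ ℚ.* ℚ.∣ q ℚ.- q′ ∣
    ≤⟨ ℚ.*-monoʳ-≤-nonNeg ℚ.∣ q ℚ.- q′ ∣ {{ℚ.nonNegative (ℚ.0≤∣p∣ (q ℚ.- q′))}} p≤B ⟩
  B ℚ.* ℚ.∣ q ℚ.- q′ ∣                   <⟨ ℚ.*-monoʳ-<-pos B {{ℚ.positive 0<B}} q<δ ⟩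
  B ℚ.* δ                                ∎
  where
  open ℚ.≤-Reasoning
  lemma : ∀ a b c → a ℚ.* b ℚ.- a ℚ.* c ≡ a ℚ.* (b ℚ.- c)
  lemma = solve 3 (λ a b c → a :* b :- a :* c := a :* (b :- c)) refl
    where open +-*-Solver

termwise⇒≃ : ∀ x y → (∀ n → seq x n ≡ seq y n) → x ≃ y
termwise⇒≃ x y eq ε 0<ε = always λ n →
  subst (λ z → ℚ.∣ seq x n ℚ.- z ∣ ℚ.< ε) (eq n)
    (subst (λ z → ℚ.∣ z ∣ ℚ.< ε) (sym (ℚ.+-inverseʳ (seq x n))) 0<ε)

-- Unlike x ≃ y, which unfolds to a function type, x ≈ y determines x and y.
record _≈_ (x y : ℝ) : Set where
  constructor ⟨_⟩
  field unwrap : x ≃ y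

open _≈_ public

infix 4 _≈_

termwise : ∀ {x y} → (∀ n → seq x n ≡ seq y n) → x ≈ y
termwise {x} {y} eq = ⟨ termwise⇒≃ x y eq ⟩

≈-isEquivalence : IsEquivalence _≈_
≈-isEquivalence = record
  { refl = termwise λ _ → refl
  ; sym = λ {x} {y} x≈y → ⟨ (λ ε 0<ε → eventually-map
      (λ n → subst (ℚ._< ε) (∣-∣-sym (seq x n) (seq y n))) (unwrap x≈y ε 0<ε)) ⟩
  ; trans = λ {x} {y} {z} x≈y y≈z → ⟨ (λ ε 0<ε →
      let δ , 0<δ , δ+δ = halve 0<ε in
      eventually-zip
        (λ n p q → subst (ℚ.∣ seq x n ℚ.- seq z n ∣ ℚ.<_) δ+δ
          (ℚ.≤-<-trans (∣-∣-triangle (seq x n) (seq y n) (seq z n)) (ℚ.+-mono-< p q)))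
        (unwrap x≈y δ 0<δ) (unwrap y≈z δ 0<δ)) ⟩ }

eventually-bounded : ∀ x → Σ[ B ∈ ℚ ] 0ℚ ℚ.< B × Eventually (λ n → ℚ.∣ seq x n ∣ ℚ.≤ B)
eventually-bounded x with cauchy x 1ℚ (ℚ.positive⁻¹ 1ℚ)
... | N , close = 1ℚ ℚ.+ ℚ.∣ seq x N ∣
  , ℚ.+-mono-<-≤ (ℚ.positive⁻¹ 1ℚ) (ℚ.0≤∣p∣ (seq x N))
  , N , λ n N≤n → begin
    ℚ.∣ seq x n ∣                                ≡⟨ cong ℚ.∣_∣ (lemma (seq x n) (seq x N)) ⟨
    ℚ.∣ (seq x n ℚ.- seq x N) ℚ.+ seq x N ∣      ≤⟨ ℚ.∣p+q∣≤∣p∣+∣q∣ (seq x n ℚ.- seq x N) (seq x N) ⟩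
    ℚ.∣ seq x n ℚ.- seq x N ∣ ℚ.+ ℚ.∣ seq x N ∣  ≤⟨ ℚ.+-monoˡ-≤ ℚ.∣ seq x N ∣ (ℚ.<⇒≤ (close n N N≤n ℕ.≤-refl)) ⟩
    1ℚ ℚ.+ ℚ.∣ seq x N ∣                         ∎
  where
  open ℚ.≤-Reasoning
  lemma : ∀ a b → (a ℚ.- b) ℚ.+ b ≡ a
  lemma = solve 2 (λ a b → (a :- b) :+ b := a) refl
    where open +-*-Solver

+ᵣ-cong : ∀ {x x′ y y′} → x ≈ x′ → y ≈ y′ → x +ᵣ y ≈ x′ +ᵣ y′
+ᵣ-cong {x} {x′} {y} {y′} x≈x′ y≈y′ = ⟨ (λ ε 0<ε →
  let δ , 0<δ , δ+δ = halve 0<ε in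
  eventually-zip
    (λ n p q → subst (ℚ.∣ (seq x n ℚ.+ seq y n) ℚ.- (seq x′ n ℚ.+ seq y′ n) ∣ ℚ.<_) δ+δ
      (∣-∣-+ (seq x n) (seq x′ n) (seq y n) (seq y′ n) p q))
    (unwrap x≈x′ δ 0<δ) (unwrap y≈y′ δ 0<δ)) ⟩

*ᵣ-congˡ : ∀ x {y y′} → y ≈ y′ → x *ᵣ y ≈ x *ᵣ y′
*ᵣ-congˡ x {y} {y′} y≈y′ = ⟨ (λ ε 0<ε →
  let B , 0<B , x≤B = eventually-bounded x
      δ , 0<δ , Bδ = divide 0<B 0<ε in
  eventually-zip
    (λ n p q → subst (ℚ.∣ seq x n ℚ.* seq y n ℚ.- seq x n ℚ.* seq y′ n ∣ ℚ.<_) Bδ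
      (∣-∣-* (seq x n) (seq y n) (seq y′ n) 0<B p q))
    x≤B (unwrap y≈y′ δ 0<δ)) ⟩

*ᵣ-comm : ∀ x y → x *ᵣ y ≈ y *ᵣ x
*ᵣ-comm x y = termwise λ n → ℚ.*-comm (seq x n) (seq y n)

*ᵣ-cong : ∀ {x x′ y y′} → x ≈ x′ → y ≈ y′ → x *ᵣ y ≈ x′ *ᵣ y′
*ᵣ-cong {x} {x′} {y} {y′} x≈x′ y≈y′ =
  ≈-trans (*ᵣ-congˡ x y≈y′) (≈-trans (*ᵣ-comm x y′) (≈-trans (*ᵣ-congˡ y′ x≈x′) (*ᵣ-comm y′ x′)))
  where open IsEquivalence ≈-isEquivalence using () renaming (trans to ≈-trans)

*ᵣ-congʳ : ∀ x {y y′} → y ≈ y′ → y *ᵣ x ≈ y′ *ᵣ x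
*ᵣ-congʳ x y≈y′ = *ᵣ-cong y≈y′ (IsEquivalence.refl ≈-isEquivalence)

ℝ-commutativeSemiring : CommutativeSemiring 0ℓ 0ℓ
ℝ-commutativeSemiring = record
  { Carrier = ℝ
  ; _≈_ = _≈_
  ; _+_ = _+ᵣ_
  ; _*_ = _*ᵣ_
  ; 0# = 0ᵣ
  ; 1# = 1ᵣ
  ; isCommutativeSemiring = isCommutativeSemiringˡ record
    { +-isCommutativeMonoid = record
      { isMonoid = record
        { isSemigroup = record
          { isMagma = record { isEquivalence = ≈-isEquivalence ; ∙-cong = +ᵣ-cong }
          ; assoc = λ x y z → termwise λ n → ℚ.+-assoc (seq x n) (seq y n) (seq z n) }
        ; identity = (λ x → termwise λ n → ℚ.+-identityˡ (seq x n))
                   , (λ x → termwise λ n → ℚ.+-identityʳ (seq x n)) }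
      ; comm = λ x y → termwise λ n → ℚ.+-comm (seq x n) (seq y n) }
    ; *-isCommutativeMonoid = record
      { isMonoid = record
        { isSemigroup = record
          { isMagma = record { isEquivalence = ≈-isEquivalence ; ∙-cong = *ᵣ-cong }
          ; assoc = λ x y z → termwise λ n → ℚ.*-assoc (seq x n) (seq y n) (seq z n) }
        ; identity = (λ x → termwise λ n → ℚ.*-identityˡ (seq x n))
                   , (λ x → termwise λ n → ℚ.*-identityʳ (seq x n)) }
      ; comm = *ᵣ-comm }
    ; distribʳ = λ x y z → termwise λ n → ℚ.*-distribʳ-+ (seq x n) (seq y n) (seq z n)
    ; zeroˡ = λ x → termwise λ n → ℚ.*-zeroˡ (seq x n) } }

module ℝₛ = CommutativeSemiring ℝ-commutativeSemiring
module Σℝ = SemiringSum (CommutativeSemiring.semiring ℝ-commutativeSemiring)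

seq-sum : ∀ {m} (x : Fin m → ℝ) n → seq (sum x) n ≡ Σℚ.sum (λ i → seq (x i) n)
seq-sum {zero}  x n = refl
seq-sum {suc m} x n = cong (seq (x zero) n ℚ.+_) (seq-sum (x ∘ suc) n)

-- Rationals and self-adjoint operators

fromℤ : ℤ → ℚ
fromℤ z = z ℚ./ 1

toℚᵘ-fromℤ : ∀ z → ℚ.toℚᵘ (fromℤ z) ℚᵘ.≃ ℚᵘ.mkℚᵘ z 0
toℚᵘ-fromℤ z = ℚ.toℚᵘ-fromℚᵘ (ℚᵘ.mkℚᵘ z 0)

fromℤ-+ : ∀ y z → fromℤ (y ℤ.+ z) ≡ fromℤ y ℚ.+ fromℤ z
fromℤ-+ y z = ℚ.toℚᵘ-injective (begin
  ℚ.toℚᵘ (fromℤ (y ℤ.+ z))                     ≈⟨ toℚᵘ-fromℤ (y ℤ.+ z) ⟩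
  ℚᵘ.mkℚᵘ (y ℤ.+ z) 0
    ≈⟨ ℚᵘ.*≡* (cong (ℤ._* + 1) (sym (cong₂ ℤ._+_ (ℤ.*-identityʳ y) (ℤ.*-identityʳ z)))) ⟩
  ℚᵘ.mkℚᵘ y 0 ℚᵘ.+ ℚᵘ.mkℚᵘ z 0                 ≈⟨ ℚᵘ.+-cong (toℚᵘ-fromℤ y) (toℚᵘ-fromℤ z) ⟨
  ℚ.toℚᵘ (fromℤ y) ℚᵘ.+ ℚ.toℚᵘ (fromℤ z)       ≈⟨ ℚ.toℚᵘ-homo-+ (fromℤ y) (fromℤ z) ⟨
  ℚ.toℚᵘ (fromℤ y ℚ.+ fromℤ z)                 ∎)
  where open ℚᵘ.≃-Reasoning

fromℤ-* : ∀ y z → fromℤ (y ℤ.* z) ≡ fromℤ y ℚ.* fromℤ z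
fromℤ-* y z = ℚ.toℚᵘ-injective (begin
  ℚ.toℚᵘ (fromℤ (y ℤ.* z))                     ≈⟨ toℚᵘ-fromℤ (y ℤ.* z) ⟩
  ℚᵘ.mkℚᵘ y 0 ℚᵘ.* ℚᵘ.mkℚᵘ z 0                 ≈⟨ ℚᵘ.*-cong (toℚᵘ-fromℤ y) (toℚᵘ-fromℤ z) ⟨
  ℚ.toℚᵘ (fromℤ y) ℚᵘ.* ℚ.toℚᵘ (fromℤ z)       ≈⟨ ℚ.toℚᵘ-homo-* (fromℤ y) (fromℤ z) ⟨
  ℚ.toℚᵘ (fromℤ y ℚ.* fromℤ z)                 ∎)
  where open ℚᵘ.≃-Reasoning

fromℤ-neg : ∀ z → fromℤ (ℤ.- z) ≡ ℚ.- fromℤ z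
fromℤ-neg z = ℚ.toℚᵘ-injective (begin
  ℚ.toℚᵘ (fromℤ (ℤ.- z))                       ≈⟨ toℚᵘ-fromℤ (ℤ.- z) ⟩
  ℚᵘ.- ℚᵘ.mkℚᵘ z 0                             ≈⟨ ℚᵘ.-‿cong (toℚᵘ-fromℤ z) ⟨
  ℚᵘ.- ℚ.toℚᵘ (fromℤ z)                        ≈⟨ ℚ.toℚᵘ-homo‿- (fromℤ z) ⟨
  ℚ.toℚᵘ (ℚ.- fromℤ z)                         ∎)
  where open ℚᵘ.≃-Reasoning

fromℤ-mono-≤ : ∀ {y z} → y ℤ.≤ z → fromℤ y ℚ.≤ fromℤ z
fromℤ-mono-≤ {y} {z} y≤z = ℚ.toℚᵘ-cancel-≤ (begin
  ℚ.toℚᵘ (fromℤ y)  ≃⟨ toℚᵘ-fromℤ y ⟩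
  ℚᵘ.mkℚᵘ y 0       ≤⟨ ℚᵘ.*≤* (ℤ.*-monoʳ-≤-nonNeg (+ 1) y≤z) ⟩
  ℚᵘ.mkℚᵘ z 0       ≃⟨ toℚᵘ-fromℤ z ⟨
  ℚ.toℚᵘ (fromℤ z)  ∎)
  where open ℚᵘ.≤-Reasoning

fromℤ-cancel-≤ : ∀ {y z} → fromℤ y ℚ.≤ fromℤ z → y ℤ.≤ z
fromℤ-cancel-≤ {y} {z} le = ℤ.*-cancelʳ-≤-pos y z (+ 1) (ℚᵘ.drop-*≤* (begin
  ℚᵘ.mkℚᵘ y 0       ≃⟨ toℚᵘ-fromℤ y ⟨
  ℚ.toℚᵘ (fromℤ y)  ≤⟨ ℚ.toℚᵘ-mono-≤ le ⟩
  ℚ.toℚᵘ (fromℤ z)  ≃⟨ toℚᵘ-fromℤ z ⟩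
  ℚᵘ.mkℚᵘ z 0       ∎))
  where open ℚᵘ.≤-Reasoning

fromℕ-+ : ∀ j k → fromℕ (j + k) ≡ fromℕ j ℚ.+ fromℕ k
fromℕ-+ j k = trans (cong fromℤ (ℤ.pos-+ j k)) (fromℤ-+ (+ j) (+ k))

fromℕ-* : ∀ j k → fromℕ (j * k) ≡ fromℕ j ℚ.* fromℕ k
fromℕ-* j k = trans (cong fromℤ (ℤ.pos-* j k)) (fromℤ-* (+ j) (+ k))

fromℕ-mono-≤ : ∀ {j k} → j ≤ k → fromℕ j ℚ.≤ fromℕ k
fromℕ-mono-≤ j≤k = fromℤ-mono-≤ (ℤ.+≤+ j≤k)

fromℕ-cancel-≤ : ∀ {j k} → fromℕ j ℚ.≤ fromℕ k → j ≤ k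
fromℕ-cancel-≤ le = ℤ.drop‿+≤+ (fromℤ-cancel-≤ le)

-- Replacing the numerator by its absolute value and dropping the denominator, which is at least 1,
-- both only increase the fraction. Crude, but enough for `archimedean`.
p≤∣↥p∣ : ∀ p → p ℚ.≤ fromℕ ℤ.∣ ℚ.↥ p ∣
p≤∣↥p∣ p@(ℚ.mkℚ _ _ _) = ℚ.toℚᵘ-cancel-≤ (begin
  ℚ.toℚᵘ p                       ≤⟨ ℚᵘ.*≤* lemma ⟩
  ℚᵘ.mkℚᵘ (+ ℤ.∣ ℚ.↥ p ∣) 0      ≃⟨ toℚᵘ-fromℤ (+ ℤ.∣ ℚ.↥ p ∣) ⟨
  ℚ.toℚᵘ (fromℕ ℤ.∣ ℚ.↥ p ∣)     ∎)
  where
  open ℚᵘ.≤-Reasoning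
  k = ℤ.∣ ℚ.↥ p ∣
  i≤∣i∣ : ∀ i → i ℤ.≤ + ℤ.∣ i ∣
  i≤∣i∣ (+ n) = ℤ.≤-refl
  i≤∣i∣ (ℤ.-[1+ n ]) = ℤ.-≤+
  lemma : ℚ.↥ p ℤ.* + 1 ℤ.≤ + k ℤ.* ℚ.↧ p
  lemma = ℤ.≤-trans (ℤ.≤-reflexive (ℤ.*-identityʳ (ℚ.↥ p)))
    (ℤ.≤-trans (i≤∣i∣ (ℚ.↥ p)) (subst (+ k ℤ.≤_) (ℤ.pos-* k (ℚ.↧ₙ p)) (ℤ.+≤+ (ℕ.m≤m*n k (ℚ.↧ₙ p)))))

archimedean : ∀ {h} → 0ℚ ℚ.< h → ∀ K → ∃[ k ] K ℚ.≤ fromℕ k ℚ.* h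
archimedean {h} 0<h K with divide 0<h (ℚ.positive⁻¹ 1ℚ)
... | h⁻¹ , 0<h⁻¹ , h*h⁻¹ = k , (begin
    -- `h * h⁻¹ ≡ 1` is not a ring identity, so the defect `1 - h * h⁻¹` is split off as a term of
    -- its own, which the hypothesis then turns into 0.
    K                      ≡⟨ lemma K h h⁻¹ ⟩
    K ℚ.* h⁻¹ ℚ.* h ℚ.+ K ℚ.* (1ℚ ℚ.- h ℚ.* h⁻¹)
      ≡⟨ cong (λ z → K ℚ.* h⁻¹ ℚ.* h ℚ.+ K ℚ.* (1ℚ ℚ.- z)) h*h⁻¹ ⟩
    K ℚ.* h⁻¹ ℚ.* h ℚ.+ K ℚ.* 0ℚ
      ≡⟨ cong (K ℚ.* h⁻¹ ℚ.* h ℚ.+_) (ℚ.*-zeroʳ K) ⟩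
    K ℚ.* h⁻¹ ℚ.* h ℚ.+ 0ℚ ≡⟨ ℚ.+-identityʳ (K ℚ.* h⁻¹ ℚ.* h) ⟩
    K ℚ.* h⁻¹ ℚ.* h        ≤⟨ ℚ.*-monoʳ-≤-nonNeg h {{ℚ.nonNegative (ℚ.<⇒≤ 0<h)}} (p≤∣↥p∣ (K ℚ.* h⁻¹)) ⟩
    fromℕ k ℚ.* h          ∎)
  where
  open ℚ.≤-Reasoning
  k = ℤ.∣ ℚ.↥ (K ℚ.* h⁻¹) ∣
  lemma : ∀ K h g → K ≡ K ℚ.* g ℚ.* h ℚ.+ K ℚ.* (1ℚ ℚ.- h ℚ.* g)
  lemma = solve 3 (λ K h g → K := K :* g :* h :+ K :* (con 1ℚ :- h :* g)) refl
    where open +-*-Solver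

p≤∣p∣ : ∀ p → p ℚ.≤ ℚ.∣ p ∣
p≤∣p∣ p with ℚ.≤-total 0ℚ p
... | inj₁ 0≤p = ℚ.≤-reflexive (sym (ℚ.0≤p⇒∣p∣≡p 0≤p))
... | inj₂ p≤0 = ℚ.≤-trans p≤0 (ℚ.0≤∣p∣ p)

-- Linear consequences of inequalities are proved below by exhibiting the slack `r` as a sum of
-- visibly non-negative terms; what remains is an identity for the ring solver.
≤-witness : ∀ {p q} r → 0ℚ ℚ.≤ r → p ℚ.+ r ≡ q → p ℚ.≤ q
≤-witness {p} {q} r 0≤r p+r≡q = subst₂ ℚ._≤_ (ℚ.+-identityʳ p) p+r≡q (ℚ.+-monoʳ-≤ p 0≤r)

p≤q⇒0≤q-p : ∀ {p q} → p ℚ.≤ q → 0ℚ ℚ.≤ q ℚ.- p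
p≤q⇒0≤q-p {p} {q} p≤q = subst (ℚ._≤ q ℚ.- p) (ℚ.+-inverseʳ p) (ℚ.+-monoˡ-≤ (ℚ.- p) p≤q)

p<q⇒0<q-p : ∀ {p q} → p ℚ.< q → 0ℚ ℚ.< q ℚ.- p
p<q⇒0<q-p {p} {q} p<q = subst (ℚ._< q ℚ.- p) (ℚ.+-inverseʳ p) (ℚ.+-monoˡ-< (ℚ.- p) p<q)

0≤+ : ∀ {p q} → 0ℚ ℚ.≤ p → 0ℚ ℚ.≤ q → 0ℚ ℚ.≤ p ℚ.+ q
0≤+ = ℚ.+-mono-≤

0≤* : ∀ {p q} → 0ℚ ℚ.≤ p → 0ℚ ℚ.≤ q → 0ℚ ℚ.≤ p ℚ.* q
0≤* {p} 0≤p 0≤q = ℚ.≤-trans (ℚ.≤-reflexive (sym (ℚ.*-zeroʳ p))) (*-monoʳ 0≤p 0≤q)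

infix 8 ⟪_,_⟫

⟪_,_⟫ : ∀ {n} → (Fin n → ℚ) → (Fin n → ℚ) → ℚ
⟪ x , y ⟫ = Σℚ.sum λ u → x u ℚ.* y u

Σℚ-mono : ∀ {n} {x y : Fin n → ℚ} → (∀ u → x u ℚ.≤ y u) → Σℚ.sum x ℚ.≤ Σℚ.sum y
Σℚ-mono {zero}  x≤y = ℚ.≤-refl
Σℚ-mono {suc n} x≤y = ℚ.+-mono-≤ (x≤y zero) (Σℚ-mono (x≤y ∘ suc))

0≤p*p : ∀ p → 0ℚ ℚ.≤ p ℚ.* p
0≤p*p p with ℚ.≤-total 0ℚ p
... | inj₁ 0≤p = ℚ.≤-trans (ℚ.≤-reflexive (sym (ℚ.*-zeroʳ p))) (*-monoʳ 0≤p 0≤p)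
... | inj₂ p≤0 = ℚ.≤-trans (ℚ.≤-reflexive (sym (ℚ.*-zeroʳ p)))
        (ℚ.*-monoˡ-≤-nonPos p {{ℚ.nonPositive p≤0}} p≤0)

0≤Σℚ : ∀ {n} {x : Fin n → ℚ} → (∀ u → 0ℚ ℚ.≤ x u) → 0ℚ ℚ.≤ Σℚ.sum x
0≤Σℚ {n} 0≤x = ℚ.≤-trans (ℚ.≤-reflexive (sym (Σℚ.sum-replicate-zero n))) (Σℚ-mono 0≤x)

-- This is 0 ≤ ⟪ x - y , x - y ⟫, expanded coordinate by coordinate.
2⟪,⟫≤ : ∀ {n} (x y : Fin n → ℚ) → ⟪ x , y ⟫ ℚ.+ ⟪ x , y ⟫ ℚ.≤ ⟪ x , x ⟫ ℚ.+ ⟪ y , y ⟫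
2⟪,⟫≤ x y = begin
  ⟪ x , y ⟫ ℚ.+ ⟪ x , y ⟫                            ≡⟨ Σℚ.∑-distrib-+ (λ u → x u ℚ.* y u) (λ u → x u ℚ.* y u) ⟨
  Σℚ.sum (λ u → x u ℚ.* y u ℚ.+ x u ℚ.* y u)         ≤⟨ Σℚ-mono (λ u → pointwise (x u) (y u)) ⟩
  Σℚ.sum (λ u → x u ℚ.* x u ℚ.+ y u ℚ.* y u)         ≡⟨ Σℚ.∑-distrib-+ (λ u → x u ℚ.* x u) (λ u → y u ℚ.* y u) ⟩
  ⟪ x , x ⟫ ℚ.+ ⟪ y , y ⟫                            ∎
  where
  open ℚ.≤-Reasoning
  lemma : ∀ p q → p ℚ.* q ℚ.+ p ℚ.* q ℚ.+ (p ℚ.- q) ℚ.* (p ℚ.- q) ≡ p ℚ.* p ℚ.+ q ℚ.* q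
  lemma = solve 2 (λ p q → p :* q :+ p :* q :+ (p :- q) :* (p :- q) := p :* p :+ q :* q) refl
    where open +-*-Solver
  pointwise : ∀ p q → p ℚ.* q ℚ.+ p ℚ.* q ℚ.≤ p ℚ.* p ℚ.+ q ℚ.* q
  pointwise p q = begin
    p ℚ.* q ℚ.+ p ℚ.* q                                ≡⟨ ℚ.+-identityʳ (p ℚ.* q ℚ.+ p ℚ.* q) ⟨
    p ℚ.* q ℚ.+ p ℚ.* q ℚ.+ 0ℚ                         ≤⟨ ℚ.+-monoʳ-≤ (p ℚ.* q ℚ.+ p ℚ.* q) (0≤p*p (p ℚ.- q)) ⟩
    p ℚ.* q ℚ.+ p ℚ.* q ℚ.+ (p ℚ.- q) ℚ.* (p ℚ.- q)    ≡⟨ lemma p q ⟩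
    p ℚ.* p ℚ.+ q ℚ.* q                                ∎

module SelfAdjoint {n : ℕ} (T : (Fin n → ℚ) → (Fin n → ℚ))
                   (adjoint : ∀ x y → ⟪ T x , y ⟫ ≡ ⟪ x , T y ⟫) where

  iterate : ℕ → (Fin n → ℚ) → (Fin n → ℚ)
  iterate zero    x = x
  iterate (suc k) x = T (iterate k x)

  -- For j = k and x = y the left side is the squared norm of the k-th iterate, which thereby
  -- becomes the moment of index 2k.
  iterate-shift : ∀ j k x y → ⟪ iterate j x , iterate k y ⟫ ≡ ⟪ x , iterate (j + k) y ⟫
  iterate-shift zero    k x y = refl
  iterate-shift (suc j) k x y = begin
    ⟪ T (iterate j x) , iterate k y ⟫      ≡⟨ adjoint (iterate j x) (iterate k y) ⟩
    ⟪ iterate j x , iterate (suc k) y ⟫    ≡⟨ iterate-shift j (suc k) x y ⟩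
    ⟪ x , iterate (j + suc k) y ⟫        ≡⟨ cong (λ i → ⟪ x , iterate i y ⟫) (ℕ.+-suc j k) ⟩
    ⟪ x , iterate (suc (j + k)) y ⟫      ∎
    where open ≡-Reasoning

  module _ (x : Fin n → ℚ) where

    moment : ℕ → ℚ
    moment k = ⟪ x , iterate k x ⟫

    moment-double : ∀ k → moment k ℚ.+ moment k ℚ.≤ moment 0 ℚ.+ moment (k + k)
    moment-double k = subst (λ z → moment k ℚ.+ moment k ℚ.≤ moment 0 ℚ.+ z)
      (iterate-shift k k x x) (2⟪,⟫≤ x (iterate k x))

    -- Doubling the exponent at least doubles the excess over `moment 0`, so along 1, 2, 4, ... the
    -- excess outgrows every multiple of the initial one. The linear factor `suc j` is weaker than 2
    -- ^ j but already unbounded.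
    moment-growth : moment 0 ℚ.≤ moment 1 → ∀ j →
      ∃[ k ] moment 0 ℚ.+ fromℕ (suc j) ℚ.* (moment 1 ℚ.- moment 0) ℚ.≤ moment k
    moment-growth m₀≤m₁ zero = 1 , ℚ.≤-reflexive (lemma (moment 0) (moment 1))
      where
      lemma : ∀ a b → a ℚ.+ 1ℚ ℚ.* (b ℚ.- a) ≡ b
      lemma = solve 2 (λ a b → a :+ con 1ℚ :* (b :- a) := b) refl
        where open +-*-Solver
    moment-growth m₀≤m₁ (suc j) =
      let k , m₀+≤mₖ = moment-growth m₀≤m₁ j
          R = (F ℚ.- 1ℚ) ℚ.* h ℚ.+ (moment k ℚ.- (moment 0 ℚ.+ F ℚ.* h)) ℚ.+ (moment k ℚ.- (moment 0 ℚ.+ F ℚ.* h))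
            ℚ.+ (moment 0 ℚ.+ moment (k + k) ℚ.- (moment k ℚ.+ moment k)) in
      k + k , ≤-witness R
        (0≤+ (0≤+ (0≤+ (0≤* (p≤q⇒0≤q-p 1≤F) (p≤q⇒0≤q-p m₀≤m₁)) (p≤q⇒0≤q-p m₀+≤mₖ)) (p≤q⇒0≤q-p m₀+≤mₖ))
          (p≤q⇒0≤q-p (moment-double k)))
        (trans (cong (λ z → moment 0 ℚ.+ z ℚ.* h ℚ.+ R) (fromℕ-+ 1 (suc j)))
          (lemma (moment 0) h F (moment k) (moment (k + k))))
      where
      h F : ℚ
      h = moment 1 ℚ.- moment 0
      F = fromℕ (suc j)
      1≤F : 1ℚ ℚ.≤ F
      1≤F = fromℕ-mono-≤ {1} {suc j} (s≤s z≤n)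
      lemma : ∀ m h F k l → m ℚ.+ (1ℚ ℚ.+ F) ℚ.* h ℚ.+ ((F ℚ.- 1ℚ) ℚ.* h ℚ.+ (k ℚ.- (m ℚ.+ F ℚ.* h))
        ℚ.+ (k ℚ.- (m ℚ.+ F ℚ.* h)) ℚ.+ (m ℚ.+ l ℚ.- (k ℚ.+ k))) ≡ l
      lemma = solve 5 (λ m h F k l → m :+ (con 1ℚ :+ F) :* h :+ ((F :- con 1ℚ) :* h :+ (k :- (m :+ F :* h))
        :+ (k :- (m :+ F :* h)) :+ (m :+ l :- (k :+ k))) := l) refl
        where open +-*-Solver

    bounded⇒moment₁≤moment₀ : ∀ K → (∀ k → moment k ℚ.< K) → moment 1 ℚ.≤ moment 0
    bounded⇒moment₁≤moment₀ K bound with ℚ._≤?_ (moment 1) (moment 0)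
    ... | yes m₁≤m₀ = m₁≤m₀
    ... | no  m₁≰m₀ = ⊥-elim (ℚ.<-irrefl refl (begin-strict
      K                                              ≤⟨ K≤ ⟩
      fromℕ j ℚ.* h
        ≤⟨ ≤-witness (moment 0 ℚ.+ h) (0≤+ 0≤m₀ (ℚ.<⇒≤ 0<h)) (lemma (moment 0) (fromℕ j) h) ⟩
      moment 0 ℚ.+ (1ℚ ℚ.+ fromℕ j) ℚ.* h            ≡⟨ cong (λ z → moment 0 ℚ.+ z ℚ.* h) (fromℕ-+ 1 j) ⟨
      moment 0 ℚ.+ fromℕ (suc j) ℚ.* h               ≤⟨ proj₂ (moment-growth (ℚ.<⇒≤ m₀<m₁) j) ⟩
      moment (proj₁ (moment-growth (ℚ.<⇒≤ m₀<m₁) j)) <⟨ bound (proj₁ (moment-growth (ℚ.<⇒≤ m₀<m₁) j)) ⟩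
      K                                              ∎))
      where
      open ℚ.≤-Reasoning
      m₀<m₁ = ℚ.≰⇒> m₁≰m₀
      h = moment 1 ℚ.- moment 0
      0<h = p<q⇒0<q-p m₀<m₁
      j = proj₁ (archimedean 0<h K)
      K≤ = proj₂ (archimedean 0<h K)
      0≤m₀ : 0ℚ ℚ.≤ moment 0
      0≤m₀ = 0≤Σℚ λ u → 0≤p*p (x u)
      lemma : ∀ m j h → j ℚ.* h ℚ.+ (m ℚ.+ h) ≡ m ℚ.+ (1ℚ ℚ.+ j) ℚ.* h
      lemma = solve 3 (λ m j h → j :* h :+ (m :+ h) := m :+ (con 1ℚ :+ j) :* h) refl
        where open +-*-Solver

-- The Rayleigh quotient

module ≈-Reasoning = SetoidReasoning (CommutativeSemiring.setoid ℝ-commutativeSemiring)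

fromℚ-+ : ∀ p q → fromℚ (p ℚ.+ q) ≈ fromℚ p +ᵣ fromℚ q
fromℚ-+ p q = termwise λ _ → refl

fromℚ-* : ∀ p q → fromℚ (p ℚ.* q) ≈ fromℚ p *ᵣ fromℚ q
fromℚ-* p q = termwise λ _ → refl

fromℚ-sum : ∀ {n} (x : Fin n → ℚ) → fromℚ (Σℚ.sum x) ≈ sum (fromℚ ∘ x)
fromℚ-sum x = termwise λ k → sym (seq-sum (fromℚ ∘ x) k)

-- Cancelling p − q, which is bounded away from 0.
apart-cancel : ∀ p q {y γ} → 0ℚ ℚ.< γ → Eventually (λ n → γ ℚ.≤ seq p n ℚ.- seq q n) →
               p *ᵣ y ≈ q *ᵣ y → y ≈ 0ᵣ
apart-cancel p q {y} {γ} 0<γ γ≤p-q py≈qy = ⟨ (λ ε 0<ε → eventually-zip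
  (λ n → pointwise (seq p n) (seq q n) (seq y n) 0<ε)
  γ≤p-q (unwrap py≈qy (γ ℚ.* ε) (0<γε 0<ε))) ⟩
  where
  0<γε : ∀ {ε} → 0ℚ ℚ.< ε → 0ℚ ℚ.< γ ℚ.* ε
  0<γε {ε} 0<ε = subst (ℚ._< γ ℚ.* ε) (ℚ.*-zeroʳ γ) (ℚ.*-monoʳ-<-pos γ {{ℚ.positive 0<γ}} 0<ε)
  pointwise : ∀ a b c {ε} → 0ℚ ℚ.< ε → γ ℚ.≤ a ℚ.- b → ℚ.∣ a ℚ.* c ℚ.- b ℚ.* c ∣ ℚ.< γ ℚ.* ε →
              ℚ.∣ c ℚ.- 0ℚ ∣ ℚ.< ε
  pointwise a b c {ε} 0<ε γ≤ <γε = ℚ.*-cancelˡ-<-nonNeg γ {{ℚ.nonNegative (ℚ.<⇒≤ 0<γ)}} (begin-strict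
    γ ℚ.* ℚ.∣ c ℚ.- 0ℚ ∣           ≡⟨ cong (λ z → γ ℚ.* ℚ.∣ z ∣) (ℚ.+-identityʳ c) ⟩
    γ ℚ.* ℚ.∣ c ∣                  ≤⟨ ℚ.*-monoʳ-≤-nonNeg ℚ.∣ c ∣ {{ℚ.nonNegative (ℚ.0≤∣p∣ c)}} γ≤ ⟩
    (a ℚ.- b) ℚ.* ℚ.∣ c ∣          ≡⟨ cong (ℚ._* ℚ.∣ c ∣) (ℚ.0≤p⇒∣p∣≡p (ℚ.≤-trans (ℚ.<⇒≤ 0<γ) γ≤)) ⟨
    ℚ.∣ a ℚ.- b ∣ ℚ.* ℚ.∣ c ∣      ≡⟨ ℚ.∣p*q∣≡∣p∣*∣q∣ (a ℚ.- b) c ⟨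
    ℚ.∣ (a ℚ.- b) ℚ.* c ∣          ≡⟨ cong ℚ.∣_∣ (lemma a b c) ⟩
    ℚ.∣ a ℚ.* c ℚ.- b ℚ.* c ∣      <⟨ <γε ⟩
    γ ℚ.* ε                        ∎)
    where
    open ℚ.≤-Reasoning
    lemma : ∀ a b c → (a ℚ.- b) ℚ.* c ≡ a ℚ.* c ℚ.- b ℚ.* c
    lemma = solve 3 (λ a b c → (a :- b) :* c := a :* c :- b :* c) refl
      where open +-*-Solver

infixr 9 _^ᵣ_

_^ᵣ_ : ℝ → ℕ → ℝ
x ^ᵣ zero  = 1ᵣ
x ^ᵣ suc k = x *ᵣ x ^ᵣ k

UniformlyBounded : (ℕ → ℝ) → Set
UniformlyBounded y = Σ[ K ∈ ℚ ] Eventually λ n → ∀ k → ℚ.∣ seq (y k) n ∣ ℚ.≤ K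

-- Imposed on the approximating terms and not only on their limit, so that the terms of every power
-- stay in [0 , 1] as well. The margin ε of τ above σ is what makes this available.
UnitInterval : ℝ → Set
UnitInterval ρ = Eventually λ n → 0ℚ ℚ.≤ seq ρ n × seq ρ n ℚ.≤ 1ℚ

power-bounded : ∀ w ρ → UnitInterval ρ → UniformlyBounded λ k → w *ᵣ ρ ^ᵣ k
power-bounded w ρ 0≤ρ≤1 =
  let K , 0<K , w≤K = eventually-bounded w in
  K , eventually-zip (λ n w≤K ρ∈ k → pointwise n w≤K ρ∈ k) w≤K 0≤ρ≤1
  where
  power : ∀ n → 0ℚ ℚ.≤ seq ρ n × seq ρ n ℚ.≤ 1ℚ → ∀ k → 0ℚ ℚ.≤ seq (ρ ^ᵣ k) n × seq (ρ ^ᵣ k) n ℚ.≤ 1ℚ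
  power n (0≤ρ , ρ≤1) zero = ℚ.nonNegative⁻¹ 1ℚ , ℚ.≤-refl
  power n (0≤ρ , ρ≤1) (suc k) =
    let 0≤ρᵏ , ρᵏ≤1 = power n (0≤ρ , ρ≤1) k in
    0≤* 0≤ρ 0≤ρᵏ , *-mono 0≤ρ (ℚ.nonNegative⁻¹ 1ℚ) ρ≤1 ρᵏ≤1
  pointwise : ∀ {K} n → ℚ.∣ seq w n ∣ ℚ.≤ K → 0ℚ ℚ.≤ seq ρ n × seq ρ n ℚ.≤ 1ℚ →
              ∀ k → ℚ.∣ seq w n ℚ.* seq (ρ ^ᵣ k) n ∣ ℚ.≤ K
  pointwise {K} n w≤K ρ∈ k = let 0≤ρᵏ , ρᵏ≤1 = power n ρ∈ k in begin
    ℚ.∣ seq w n ℚ.* seq (ρ ^ᵣ k) n ∣           ≡⟨ ℚ.∣p*q∣≡∣p∣*∣q∣ (seq w n) (seq (ρ ^ᵣ k) n) ⟩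
    ℚ.∣ seq w n ∣ ℚ.* ℚ.∣ seq (ρ ^ᵣ k) n ∣     ≡⟨ cong (ℚ.∣ seq w n ∣ ℚ.*_) (ℚ.0≤p⇒∣p∣≡p 0≤ρᵏ) ⟩
    ℚ.∣ seq w n ∣ ℚ.* seq (ρ ^ᵣ k) n           ≤⟨ *-monoʳ (ℚ.0≤∣p∣ (seq w n)) ρᵏ≤1 ⟩
    ℚ.∣ seq w n ∣ ℚ.* 1ℚ                       ≡⟨ ℚ.*-identityʳ ℚ.∣ seq w n ∣ ⟩
    ℚ.∣ seq w n ∣                              ≤⟨ w≤K ⟩
    K                                          ∎
    where open ℚ.≤-Reasoning

sum-bounded : ∀ {m} (y : Fin m → ℕ → ℝ) → (∀ i → UniformlyBounded (y i)) →
              UniformlyBounded λ k → sum λ i → y i k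
sum-bounded {zero}  y b = 0ℚ , always λ n k → ℚ.≤-refl
sum-bounded {suc m} y b =
  let K , p = b zero
      L , q = sum-bounded (y ∘ suc) (b ∘ suc) in
  K ℚ.+ L , eventually-zip (λ n p q k →
    ℚ.≤-trans (ℚ.∣p+q∣≤∣p∣+∣q∣ (seq (y zero k) n) (seq (sum λ i → y (suc i) k) n))
      (ℚ.+-mono-≤ (p k) (q k))) p q

-- At a late index the term of the real number is within 1 of the rational one. That index may
-- depend on k; the bound `1ℚ + K` does not.
approximated-bounded : ∀ (q : ℕ → ℚ) (y : ℕ → ℝ) → (∀ k → fromℚ (q k) ≈ y k) →
                       UniformlyBounded y → ∃[ K ] ∀ k → q k ℚ.< K
approximated-bounded q y q≈y (K , y≤K) = 1ℚ ℚ.+ K , λ k →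
  let n , close , y≤K = eventually-witness (eventually-zip (λ n → _,_)
        (unwrap (q≈y k) 1ℚ (ℚ.positive⁻¹ 1ℚ)) y≤K) in
  pointwise (q k) (seq (y k) n) close (y≤K k)
  where
  pointwise : ∀ a b → ℚ.∣ a ℚ.- b ∣ ℚ.< 1ℚ → ℚ.∣ b ∣ ℚ.≤ K → a ℚ.< 1ℚ ℚ.+ K
  pointwise a b a-b<1 b≤K = begin-strict
    a                              ≡⟨ lemma a b ⟩
    (a ℚ.- b) ℚ.+ b                ≤⟨ ℚ.+-mono-≤ (p≤∣p∣ (a ℚ.- b)) (p≤∣p∣ b) ⟩
    ℚ.∣ a ℚ.- b ∣ ℚ.+ ℚ.∣ b ∣      <⟨ ℚ.+-mono-<-≤ a-b<1 b≤K ⟩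
    1ℚ ℚ.+ K                       ∎
    where
    open ℚ.≤-Reasoning
    lemma : ∀ a b → a ≡ (a ℚ.- b) ℚ.+ b
    lemma = solve 2 (λ a b → a := (a :- b) :+ b) refl
      where open +-*-Solver

uniform-bound : ∀ {m} (μ : Fin m → ℝ) → Σ[ B ∈ ℚ ] 0ℚ ℚ.< B × (∀ i → Eventually λ n → ℚ.∣ seq (μ i) n ∣ ℚ.≤ B)
uniform-bound {zero}  μ = 1ℚ , ℚ.positive⁻¹ 1ℚ , λ ()
uniform-bound {suc m} μ =
  let B , 0<B , b = eventually-bounded (μ zero)
      C , 0<C , c = uniform-bound (μ ∘ suc)
      B≤B+C = ≤-witness {B} {B ℚ.+ C} C (ℚ.<⇒≤ 0<C) refl
      C≤B+C = ≤-witness {C} {B ℚ.+ C} B (ℚ.<⇒≤ 0<B) (ℚ.+-comm C B) in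
  B ℚ.+ C , ℚ.+-mono-< 0<B 0<C , λ where
    zero    → eventually-map (λ n b → ℚ.≤-trans b B≤B+C) b
    (suc i) → eventually-map (λ n c → ℚ.≤-trans c C≤B+C) (c i)

limit-≤ : ∀ {p q} r → 0ℚ ℚ.≤ r → (∀ ε → 0ℚ ℚ.< ε → p ℚ.≤ q ℚ.+ ε ℚ.* r) → p ℚ.≤ q
limit-≤ {p} {q} r 0≤r p≤q+εr with p ℚ.≤? q
... | yes p≤q = p≤q
... | no  p≰q =
  -- With (1 + r) ε = p - q the hypothesis would give p ≤ q + ε r < p; the summand 1 keeps the
  -- divisor positive when r = 0.
  let ε , 0<ε , B*ε = divide {1ℚ ℚ.+ r} (ℚ.+-mono-<-≤ (ℚ.positive⁻¹ 1ℚ) 0≤r) (p<q⇒0<q-p (ℚ.≰⇒> p≰q)) in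
  ⊥-elim (ℚ.<-irrefl refl (begin-strict
    p                            ≤⟨ p≤q+εr ε 0<ε ⟩
    q ℚ.+ ε ℚ.* r                ≡⟨ ℚ.+-identityʳ (q ℚ.+ ε ℚ.* r) ⟨
    q ℚ.+ ε ℚ.* r ℚ.+ 0ℚ         <⟨ ℚ.+-monoʳ-< (q ℚ.+ ε ℚ.* r) 0<ε ⟩
    q ℚ.+ ε ℚ.* r ℚ.+ ε          ≡⟨ lemma q ε r ⟩
    q ℚ.+ (1ℚ ℚ.+ r) ℚ.* ε       ≡⟨ cong (q ℚ.+_) B*ε ⟩
    q ℚ.+ (p ℚ.- q)              ≡⟨ lemma′ p q ⟩
    p                            ∎))
  where
  open ℚ.≤-Reasoning
  lemma : ∀ q ε r → q ℚ.+ ε ℚ.* r ℚ.+ ε ≡ q ℚ.+ (1ℚ ℚ.+ r) ℚ.* ε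
  lemma = solve 3 (λ q ε r → q :+ ε :* r :+ ε := q :+ (con 1ℚ :+ r) :* ε) refl
    where open +-*-Solver
  lemma′ : ∀ p q → q ℚ.+ (p ℚ.- q) ≡ p
  lemma′ = solve 2 (λ p q → q :+ (p :- q) := p) refl
    where open +-*-Solver

module Rayleigh {m : ℕ}
  (a : Fin (suc m) → Fin (suc m) → ℚ) (a-sym : ∀ u w → a u w ≡ a w u)
  (δ : ℚ) (row-sum : ∀ u → Σℚ.sum (a u) ≡ δ)
  (μ : Fin (suc m) → ℝ) (v : Fin (suc m) → Vecᵣ (suc m))
  (spanning : ∀ w → ∃[ c ] combination c v ≋ w)
  (eigenequation : ∀ i → (λ u w → fromℚ (a u w)) · v i ≋ λ j → μ i *ᵣ v i j)
  (σ : ℚ) (σ<δ : σ ℚ.< δ)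
  (μ≤σ : ∀ i ε → 0ℚ ℚ.< ε → Eventually λ k → seq (μ (suc i)) k ℚ.< σ ℚ.+ ε)
  where

  private
    n : ℕ
    n = suc m

  open CommutativeSemiring ℝ-commutativeSemiring using ()
    renaming (sym to ≈-sym; trans to ≈-trans; *-assoc to *ᵣ-assoc; +-congˡ to +ᵣ-congˡ;
      +-congʳ to +ᵣ-congʳ; zeroˡ to *ᵣ-zeroˡ; zeroʳ to *ᵣ-zeroʳ; *-identityʳ to *ᵣ-identityʳ;
      +-identityʳ to +ᵣ-identityʳ; +-identityˡ to +ᵣ-identityˡ)

  A : Matrix n
  A u w = fromℚ (a u w)

  Av≈μv : ∀ i u → sum (λ w → A u w *ᵣ v i w) ≈ μ i *ᵣ v i u
  Av≈μv i u = ⟨ eigenequation i u ⟩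

  -- The inner product of the i-th eigenvector with the all-ones vector.
  α : Fin n → ℝ
  α i = sum (v i)

  column-sum : ∀ w → sum (λ u → A u w) ≈ fromℚ δ
  column-sum w = ≈-trans (≈-sym (fromℚ-sum λ u → a u w))
    (ℝₛ.reflexive (cong fromℚ (trans (Σℚ.sum-cong-≗ λ u → a-sym u w) (row-sum w))))

  -- The coordinates of A v are summed in two ways: by the eigenvalue equation, and through the
  -- column sums of A, which are δ by symmetry.
  δα≈μα : ∀ i → fromℚ δ *ᵣ α i ≈ μ i *ᵣ α i
  δα≈μα i = ≈-sym (begin
    μ i *ᵣ sum (v i)                             ≈⟨ Σℝ.*-distribˡ-sum (μ i) (v i) ⟩
    sum (λ u → μ i *ᵣ v i u)                     ≈⟨ Σℝ.sum-cong-≋ (Av≈μv i) ⟨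
    sum (λ u → sum λ w → A u w *ᵣ v i w)         ≈⟨ Σℝ.∑-comm (λ u w → A u w *ᵣ v i w) ⟩
    sum (λ w → sum λ u → A u w *ᵣ v i w)         ≈⟨ Σℝ.sum-cong-≋ (λ w → Σℝ.*-distribʳ-sum (v i w) (λ u → A u w)) ⟨
    sum (λ w → sum (λ u → A u w) *ᵣ v i w)       ≈⟨ Σℝ.sum-cong-≋ (λ w → *ᵣ-congʳ (v i w) (column-sum w)) ⟩
    sum (λ w → fromℚ δ *ᵣ v i w)                 ≈⟨ Σℝ.*-distribˡ-sum (fromℚ δ) (v i) ⟨
    fromℚ δ *ᵣ sum (v i)                         ∎)
    where open ≈-Reasoning

  -- With γ half of δ - σ, the terms of `μ (suc i)` eventually stay below σ + γ, hence at least γ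
  -- below δ. So the factor δ - μ can be cancelled from `δα≈μα`.
  α≈0 : ∀ i → α (suc i) ≈ 0ᵣ
  α≈0 i =
    let γ , 0<γ , γ+γ = halve (p<q⇒0<q-p σ<δ) in
    apart-cancel (fromℚ δ) (μ (suc i)) {γ = γ} 0<γ
      (eventually-map (λ k μ< → ≤-witness (σ ℚ.+ γ ℚ.- seq (μ (suc i)) k) (p≤q⇒0≤q-p (ℚ.<⇒≤ μ<))
          (trans (lemma γ σ (seq (μ (suc i)) k)) (trans (cong (λ z → z ℚ.+ σ ℚ.- seq (μ (suc i)) k) γ+γ)
                  (lemma′ δ σ (seq (μ (suc i)) k)))))
        (μ≤σ i γ 0<γ))
      (δα≈μα (suc i))
    where
    open +-*-Solver
    lemma : ∀ γ σ μ → γ ℚ.+ (σ ℚ.+ γ ℚ.- μ) ≡ γ ℚ.+ γ ℚ.+ σ ℚ.- μ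
    lemma = solve 3 (λ γ σ μ → γ :+ (σ :+ γ :- μ) := γ :+ γ :+ σ :- μ) refl
    lemma′ : ∀ δ σ μ → (δ ℚ.- σ) ℚ.+ σ ℚ.- μ ≡ δ ℚ.- μ
    lemma′ = solve 3 (λ δ σ μ → (δ :- σ) :+ σ :- μ := δ :- μ) refl

  sum-combination : ∀ c → sum (combination c v) ≈ c zero *ᵣ α zero
  sum-combination c = begin
    sum (λ j → sum λ i → c i *ᵣ v i j)           ≈⟨ Σℝ.∑-comm (λ j i → c i *ᵣ v i j) ⟩
    sum (λ i → sum λ j → c i *ᵣ v i j)           ≈⟨ Σℝ.sum-cong-≋ (λ i → Σℝ.*-distribˡ-sum (c i) (v i)) ⟨
    sum (λ i → c i *ᵣ α i)
      ≈⟨ +ᵣ-congˡ (Σℝ.sum-cong-≋ λ i → ≈-trans (*ᵣ-congˡ (c (suc i)) (α≈0 i)) (*ᵣ-zeroʳ (c (suc i)))) ⟩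
    c zero *ᵣ α zero +ᵣ sum (λ (i : Fin m) → 0ᵣ) ≈⟨ +ᵣ-congˡ (Σℝ.sum-replicate-zero m) ⟩
    c zero *ᵣ α zero +ᵣ 0ᵣ                       ≈⟨ +ᵣ-identityʳ (c zero *ᵣ α zero) ⟩
    c zero *ᵣ α zero                             ∎
    where open ≈-Reasoning

  module _ (x : Fin n → ℚ) (x⊥1 : Σℚ.sum x ≡ 0ℚ) where

    X : Vecᵣ n
    X = fromℚ ∘ x

    c : Fin n → ℝ
    c = proj₁ (spanning X)

    cv≈X : ∀ j → combination c v j ≈ X j
    cv≈X j = ⟨ proj₂ (spanning X) j ⟩

    -- If e are the coordinates of the all-ones vector, summing coordinates gives e₀ α₀ = n, and the
    -- same for x gives c₀ α₀ = 0. Hence n c₀ = e₀ α₀ c₀ = 0, without having to invert α₀.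
    c₀≈0 : c zero ≈ 0ᵣ
    c₀≈0 = apart-cancel (fromℚ N) 0ᵣ (ℚ.positive⁻¹ 1ℚ) (always λ _ → 1≤N-0) (begin
      fromℚ N *ᵣ c zero                ≈⟨ *ᵣ-congʳ (c zero) (fromℚ-sum {n} (λ _ → 1ℚ)) ⟩
      sum {n} (λ _ → 1ᵣ) *ᵣ c zero     ≈⟨ *ᵣ-congʳ (c zero) (Σℝ.sum-cong-≋ ev≈1) ⟨
      sum (combination e v) *ᵣ c zero  ≈⟨ *ᵣ-congʳ (c zero) (sum-combination e) ⟩
      e zero *ᵣ α zero *ᵣ c zero       ≈⟨ *ᵣ-assoc (e zero) (α zero) (c zero) ⟩
      e zero *ᵣ (α zero *ᵣ c zero)     ≈⟨ *ᵣ-congˡ (e zero) (*ᵣ-comm (α zero) (c zero)) ⟩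
      e zero *ᵣ (c zero *ᵣ α zero)     ≈⟨ *ᵣ-congˡ (e zero) (sum-combination c) ⟨
      e zero *ᵣ sum (combination c v)  ≈⟨ *ᵣ-congˡ (e zero) (Σℝ.sum-cong-≋ cv≈X) ⟩
      e zero *ᵣ sum X                  ≈⟨ *ᵣ-congˡ (e zero) (fromℚ-sum x) ⟨
      e zero *ᵣ fromℚ (Σℚ.sum x)       ≈⟨ *ᵣ-congˡ (e zero) (ℝₛ.reflexive (cong fromℚ x⊥1)) ⟩
      e zero *ᵣ 0ᵣ                     ≈⟨ *ᵣ-zeroʳ (e zero) ⟩
      0ᵣ                               ≈⟨ *ᵣ-zeroˡ (c zero) ⟨
      0ᵣ *ᵣ c zero                     ∎)
      where
      open ≈-Reasoning
      e = proj₁ (spanning λ _ → 1ᵣ)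
      ev≈1 : ∀ j → combination e v j ≈ 1ᵣ
      ev≈1 j = ⟨ proj₂ (spanning λ _ → 1ᵣ) j ⟩
      N = Σℚ.sum {n} (λ _ → 1ℚ)
      1≤N-0 : 1ℚ ℚ.≤ N ℚ.- 0ℚ
      1≤N-0 = ≤-witness (Σℚ.sum {m} (λ _ → 1ℚ)) (0≤Σℚ {m} λ _ → ℚ.nonNegative⁻¹ 1ℚ)
        (sym (ℚ.+-identityʳ N))

    module _ (κ s : ℚ) where

      operator : (Fin n → ℚ) → (Fin n → ℚ)
      operator y u = κ ℚ.* y u ℚ.+ s ℚ.* ⟪ a u , y ⟫

      ρ : Fin n → ℝ
      ρ i = fromℚ κ +ᵣ fromℚ s *ᵣ μ i

      -- The operator multiplies the i-th coordinate by `ρ i`. Carrying coordinates along makes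
      -- those of the k-th iterate `c i *ᵣ ρ i ^ᵣ k`, whichever expansion `c` of x was chosen at the
      -- start.
      operator-combination : ∀ y b → (∀ u → fromℚ (y u) ≈ combination b v u) →
                             ∀ u → fromℚ (operator y u) ≈ combination (λ i → b i *ᵣ ρ i) v u
      operator-combination y b y≈ u = begin
        fromℚ (operator y u)
          ≈⟨ fromℚ-+ (κ ℚ.* y u) (s ℚ.* ⟪ a u , y ⟫) ⟩
        fromℚ (κ ℚ.* y u) +ᵣ fromℚ (s ℚ.* ⟪ a u , y ⟫)
          ≈⟨ +ᵣ-cong (fromℚ-* κ (y u)) (fromℚ-* s ⟪ a u , y ⟫) ⟩
        fromℚ κ *ᵣ fromℚ (y u) +ᵣ fromℚ s *ᵣ fromℚ ⟪ a u , y ⟫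
          ≈⟨ +ᵣ-cong (*ᵣ-congˡ (fromℚ κ) (y≈ u)) (*ᵣ-congˡ (fromℚ s) ay≈) ⟩
        fromℚ κ *ᵣ combination b v u +ᵣ fromℚ s *ᵣ sum (λ i → b i *ᵣ (μ i *ᵣ v i u))
          ≈⟨ +ᵣ-cong (Σℝ.*-distribˡ-sum (fromℚ κ) (λ i → b i *ᵣ v i u))
                  (Σℝ.*-distribˡ-sum (fromℚ s) (λ i → b i *ᵣ (μ i *ᵣ v i u))) ⟩
        sum (λ i → fromℚ κ *ᵣ (b i *ᵣ v i u)) +ᵣ sum (λ i → fromℚ s *ᵣ (b i *ᵣ (μ i *ᵣ v i u)))
          ≈⟨ Σℝ.∑-distrib-+ (λ i → fromℚ κ *ᵣ (b i *ᵣ v i u)) (λ i → fromℚ s *ᵣ (b i *ᵣ (μ i *ᵣ v i u))) ⟨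
        sum (λ i → fromℚ κ *ᵣ (b i *ᵣ v i u) +ᵣ fromℚ s *ᵣ (b i *ᵣ (μ i *ᵣ v i u)))
          ≈⟨ Σℝ.sum-cong-≋ (λ i → expand (b i) (v i u) (μ i)) ⟩
        sum (λ i → (b i *ᵣ ρ i) *ᵣ v i u) ∎
        where
        open ≈-Reasoning
        lemma : ∀ κ s b v μ → κ ℚ.* (b ℚ.* v) ℚ.+ s ℚ.* (b ℚ.* (μ ℚ.* v)) ≡ b ℚ.* (κ ℚ.+ s ℚ.* μ) ℚ.* v
        lemma = solve 5 (λ κ s b v μ → κ :* (b :* v) :+ s :* (b :* (μ :* v)) := b :* (κ :+ s :* μ) :* v) refl
          where open +-*-Solver
        expand : ∀ b v μ → fromℚ κ *ᵣ (b *ᵣ v) +ᵣ fromℚ s *ᵣ (b *ᵣ (μ *ᵣ v)) ≈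
                 (b *ᵣ (fromℚ κ +ᵣ fromℚ s *ᵣ μ)) *ᵣ v
        expand b v μ = termwise λ k → lemma κ s (seq b k) (seq v k) (seq μ k)
        swap : ∀ x y z → x *ᵣ (y *ᵣ z) ≈ y *ᵣ (x *ᵣ z)
        swap x y z = termwise λ k → swapℚ (seq x k) (seq y k) (seq z k)
          where
          swapℚ : ∀ x y z → x ℚ.* (y ℚ.* z) ≡ y ℚ.* (x ℚ.* z)
          swapℚ = solve 3 (λ x y z → x :* (y :* z) := y :* (x :* z)) refl
            where open +-*-Solver
        ay≈ : fromℚ ⟪ a u , y ⟫ ≈ sum (λ i → b i *ᵣ (μ i *ᵣ v i u))
        ay≈ = begin
          fromℚ ⟪ a u , y ⟫                                ≈⟨ fromℚ-sum (λ w → a u w ℚ.* y w) ⟩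
          sum (λ w → fromℚ (a u w ℚ.* y w))
            ≈⟨ Σℝ.sum-cong-≋ (λ w → ≈-trans (fromℚ-* (a u w) (y w)) (*ᵣ-congˡ (A u w) (y≈ w))) ⟩
          sum (λ w → A u w *ᵣ combination b v w)
            ≈⟨ Σℝ.sum-cong-≋ (λ w → Σℝ.*-distribˡ-sum (A u w) (λ i → b i *ᵣ v i w)) ⟩
          sum (λ w → sum λ i → A u w *ᵣ (b i *ᵣ v i w))    ≈⟨ Σℝ.∑-comm (λ w i → A u w *ᵣ (b i *ᵣ v i w)) ⟩
          sum (λ i → sum λ w → A u w *ᵣ (b i *ᵣ v i w))
            ≈⟨ Σℝ.sum-cong-≋ (λ i → Σℝ.sum-cong-≋ λ w → swap (A u w) (b i) (v i w)) ⟩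
          sum (λ i → sum λ w → b i *ᵣ (A u w *ᵣ v i w))
            ≈⟨ Σℝ.sum-cong-≋ (λ i → Σℝ.*-distribˡ-sum (b i) (λ w → A u w *ᵣ v i w)) ⟨
          sum (λ i → b i *ᵣ sum λ w → A u w *ᵣ v i w)      ≈⟨ Σℝ.sum-cong-≋ (λ i → *ᵣ-congˡ (b i) (Av≈μv i u)) ⟩
          sum (λ i → b i *ᵣ (μ i *ᵣ v i u))                ∎

      adjoint : ∀ y z → ⟪ operator y , z ⟫ ≡ ⟪ y , operator z ⟫
      adjoint y z = begin
        Σℚ.sum (λ u → (κ ℚ.* y u ℚ.+ s ℚ.* ⟪ a u , y ⟫) ℚ.* z u)
          ≡⟨ Σℚ.sum-cong-≗ (λ u → lemma κ s (y u) (z u) ⟪ a u , y ⟫) ⟩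
        Σℚ.sum (λ u → κ ℚ.* (y u ℚ.* z u) ℚ.+ s ℚ.* (z u ℚ.* ⟪ a u , y ⟫))
          ≡⟨ Σℚ.∑-distrib-+ (λ u → κ ℚ.* (y u ℚ.* z u)) (λ u → s ℚ.* (z u ℚ.* ⟪ a u , y ⟫)) ⟩
        Σℚ.sum (λ u → κ ℚ.* (y u ℚ.* z u)) ℚ.+ Σℚ.sum (λ u → s ℚ.* (z u ℚ.* ⟪ a u , y ⟫))
          ≡⟨ cong (Σℚ.sum (λ u → κ ℚ.* (y u ℚ.* z u)) ℚ.+_) (begin
             Σℚ.sum (λ u → s ℚ.* (z u ℚ.* ⟪ a u , y ⟫))  ≡⟨ Σℚ.*-distribˡ-sum s (λ u → z u ℚ.* ⟪ a u , y ⟫) ⟨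
             s ℚ.* Σℚ.sum (λ u → z u ℚ.* ⟪ a u , y ⟫)    ≡⟨ cong (s ℚ.*_) (form-sym z y) ⟩
             s ℚ.* Σℚ.sum (λ u → y u ℚ.* ⟪ a u , z ⟫)    ≡⟨ Σℚ.*-distribˡ-sum s (λ u → y u ℚ.* ⟪ a u , z ⟫) ⟩
             Σℚ.sum (λ u → s ℚ.* (y u ℚ.* ⟪ a u , z ⟫))  ∎) ⟩
        Σℚ.sum (λ u → κ ℚ.* (y u ℚ.* z u)) ℚ.+ Σℚ.sum (λ u → s ℚ.* (y u ℚ.* ⟪ a u , z ⟫))
          ≡⟨ Σℚ.∑-distrib-+ (λ u → κ ℚ.* (y u ℚ.* z u)) (λ u → s ℚ.* (y u ℚ.* ⟪ a u , z ⟫)) ⟨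
        Σℚ.sum (λ u → κ ℚ.* (y u ℚ.* z u) ℚ.+ s ℚ.* (y u ℚ.* ⟪ a u , z ⟫))
          ≡⟨ Σℚ.sum-cong-≗ (λ u → lemma′ κ s (y u) (z u) ⟪ a u , z ⟫) ⟩
        Σℚ.sum (λ u → y u ℚ.* (κ ℚ.* z u ℚ.+ s ℚ.* ⟪ a u , z ⟫)) ∎
        where
        open ≡-Reasoning
        lemma : ∀ κ s y z p → (κ ℚ.* y ℚ.+ s ℚ.* p) ℚ.* z ≡ κ ℚ.* (y ℚ.* z) ℚ.+ s ℚ.* (z ℚ.* p)
        lemma = solve 5 (λ κ s y z p → (κ :* y :+ s :* p) :* z := κ :* (y :* z) :+ s :* (z :* p)) refl
          where open +-*-Solver
        lemma′ : ∀ κ s y z p → κ ℚ.* (y ℚ.* z) ℚ.+ s ℚ.* (y ℚ.* p) ≡ y ℚ.* (κ ℚ.* z ℚ.+ s ℚ.* p)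
        lemma′ = solve 5 (λ κ s y z p → κ :* (y :* z) :+ s :* (y :* p) := y :* (κ :* z :+ s :* p)) refl
          where open +-*-Solver
        swap : ∀ x y z → x ℚ.* (y ℚ.* z) ≡ z ℚ.* (y ℚ.* x)
        swap = solve 3 (λ x y z → x :* (y :* z) := z :* (y :* x)) refl
          where open +-*-Solver
        form-sym : ∀ y z → Σℚ.sum (λ u → y u ℚ.* ⟪ a u , z ⟫) ≡ Σℚ.sum (λ u → z u ℚ.* ⟪ a u , y ⟫)
        form-sym y z = begin
          Σℚ.sum (λ u → y u ℚ.* ⟪ a u , z ⟫)
            ≡⟨ Σℚ.sum-cong-≗ (λ u → Σℚ.*-distribˡ-sum (y u) (λ w → a u w ℚ.* z w)) ⟩
          Σℚ.sum (λ u → Σℚ.sum λ w → y u ℚ.* (a u w ℚ.* z w))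
            ≡⟨ Σℚ.∑-comm (λ u w → y u ℚ.* (a u w ℚ.* z w)) ⟩
          Σℚ.sum (λ w → Σℚ.sum λ u → y u ℚ.* (a u w ℚ.* z w))
            ≡⟨ Σℚ.sum-cong-≗ (λ w → Σℚ.sum-cong-≗ λ u → trans (cong (λ p → y u ℚ.* (p ℚ.* z w)) (a-sym u w))
                    (swap (y u) (a w u) (z w))) ⟩
          Σℚ.sum (λ w → Σℚ.sum λ u → z w ℚ.* (a w u ℚ.* y u))
            ≡⟨ Σℚ.sum-cong-≗ (λ w → Σℚ.*-distribˡ-sum (z w) (λ u → a w u ℚ.* y u)) ⟨
          Σℚ.sum (λ w → z w ℚ.* ⟪ a w , y ⟫) ∎

      open SelfAdjoint operator adjoint

      iterate-combination : ∀ k u → fromℚ (iterate k x u) ≈ combination (λ i → c i *ᵣ ρ i ^ᵣ k) v u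
      iterate-combination zero u = ≈-sym (≈-trans
        (Σℝ.sum-cong-≋ λ i → *ᵣ-congʳ (v i u) (*ᵣ-identityʳ (c i))) (cv≈X u))
      iterate-combination (suc k) u = ≈-trans
        (operator-combination (iterate k x) (λ i → c i *ᵣ ρ i ^ᵣ k) (iterate-combination k) u)
        (Σℝ.sum-cong-≋ λ i → *ᵣ-congʳ (v i u) (≈-trans (*ᵣ-assoc (c i) (ρ i ^ᵣ k) (ρ i))
                (*ᵣ-congˡ (c i) (*ᵣ-comm (ρ i ^ᵣ k) (ρ i)))))

      -- For an orthonormal basis this would be the square of `c i`. In general its sign is unknown,
      -- so the moments are controlled only through their boundedness in k.
      weight : Fin n → ℝ
      weight i = c i *ᵣ sum λ j → X j *ᵣ v i j

      moment≈ : ∀ k → fromℚ (moment x k) ≈ sum (λ i → weight (suc i) *ᵣ ρ (suc i) ^ᵣ k)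
      moment≈ k = begin
        fromℚ ⟪ x , iterate k x ⟫
          ≈⟨ fromℚ-sum (λ j → x j ℚ.* iterate k x j) ⟩
        sum (λ j → fromℚ (x j ℚ.* iterate k x j))
          ≈⟨ Σℝ.sum-cong-≋ (λ j → ≈-trans (fromℚ-* (x j) (iterate k x j)) (*ᵣ-congˡ (X j) (iterate-combination k j))) ⟩
        sum (λ j → X j *ᵣ sum λ i → (c i *ᵣ ρ i ^ᵣ k) *ᵣ v i j)
          ≈⟨ Σℝ.sum-cong-≋ (λ j → Σℝ.*-distribˡ-sum (X j) (λ i → (c i *ᵣ ρ i ^ᵣ k) *ᵣ v i j)) ⟩
        sum (λ j → sum λ i → X j *ᵣ ((c i *ᵣ ρ i ^ᵣ k) *ᵣ v i j))
          ≈⟨ Σℝ.∑-comm (λ j i → X j *ᵣ ((c i *ᵣ ρ i ^ᵣ k) *ᵣ v i j)) ⟩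
        sum (λ i → sum λ j → X j *ᵣ ((c i *ᵣ ρ i ^ᵣ k) *ᵣ v i j))
          ≈⟨ Σℝ.sum-cong-≋ (λ i → Σℝ.sum-cong-≋ λ j → rearrange (X j) (c i) (ρ i ^ᵣ k) (v i j)) ⟩
        sum (λ i → sum λ j → (c i *ᵣ ρ i ^ᵣ k) *ᵣ (X j *ᵣ v i j))
          ≈⟨ Σℝ.sum-cong-≋ (λ i → Σℝ.*-distribˡ-sum (c i *ᵣ ρ i ^ᵣ k) (λ j → X j *ᵣ v i j)) ⟨
        sum (λ i → (c i *ᵣ ρ i ^ᵣ k) *ᵣ sum λ j → X j *ᵣ v i j)
          ≈⟨ Σℝ.sum-cong-≋ (λ i → rearrange′ (c i) (ρ i ^ᵣ k) (sum λ j → X j *ᵣ v i j)) ⟩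
        weight zero *ᵣ ρ zero ^ᵣ k +ᵣ sum (λ i → weight (suc i) *ᵣ ρ (suc i) ^ᵣ k)
          ≈⟨ +ᵣ-congʳ (≈-trans (*ᵣ-congʳ (ρ zero ^ᵣ k)
                  (≈-trans (*ᵣ-congʳ (sum λ j → X j *ᵣ v zero j) c₀≈0) (*ᵣ-zeroˡ (sum λ j → X j *ᵣ v zero j))))
                  (*ᵣ-zeroˡ (ρ zero ^ᵣ k))) ⟩
        0ᵣ +ᵣ sum (λ i → weight (suc i) *ᵣ ρ (suc i) ^ᵣ k)
          ≈⟨ +ᵣ-identityˡ (sum (λ i → weight (suc i) *ᵣ ρ (suc i) ^ᵣ k)) ⟩
        sum (λ i → weight (suc i) *ᵣ ρ (suc i) ^ᵣ k) ∎
        where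
        open ≈-Reasoning
        lemma : ∀ x c r v → x ℚ.* ((c ℚ.* r) ℚ.* v) ≡ (c ℚ.* r) ℚ.* (x ℚ.* v)
        lemma = solve 4 (λ x c r v → x :* ((c :* r) :* v) := (c :* r) :* (x :* v)) refl
          where open +-*-Solver
        rearrange : ∀ x c r v → x *ᵣ ((c *ᵣ r) *ᵣ v) ≈ (c *ᵣ r) *ᵣ (x *ᵣ v)
        rearrange x c r v = termwise λ k → lemma (seq x k) (seq c k) (seq r k) (seq v k)
        lemma′ : ∀ c r p → (c ℚ.* r) ℚ.* p ≡ (c ℚ.* p) ℚ.* r
        lemma′ = solve 3 (λ c r p → (c :* r) :* p := (c :* p) :* r) refl
          where open +-*-Solver
        rearrange′ : ∀ c r p → (c *ᵣ r) *ᵣ p ≈ (c *ᵣ p) *ᵣ r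
        rearrange′ c r p = termwise λ k → lemma′ (seq c k) (seq r k) (seq p k)

      contraction⇒moment₁≤moment₀ : (∀ i → UnitInterval (ρ (suc i))) → moment x 1 ℚ.≤ moment x 0
      contraction⇒moment₁≤moment₀ ρ∈[0,1] =
        let K , m<K = approximated-bounded (moment x) (λ k → sum λ i → weight (suc i) *ᵣ ρ (suc i) ^ᵣ k) moment≈
                        (sum-bounded _ λ i → power-bounded (weight (suc i)) (ρ (suc i)) (ρ∈[0,1] i)) in
        bounded⇒moment₁≤moment₀ x K m<K

    -- I + s (A − τ I), with s small, has all eigenvalues but the first in [0 , 1].
    quadratic-form-bound-ε : ∀ ε → 0ℚ ℚ.< ε →
      Σℚ.sum (λ u → x u ℚ.* ⟪ a u , x ⟫) ℚ.≤ (σ ℚ.+ ε) ℚ.* ⟪ x , x ⟫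
    quadratic-form-bound-ε ε 0<ε = ℚ.*-cancelˡ-≤-pos s {{ℚ.positive 0<s}}
      (≤-witness (⟪ x , x ⟫ ℚ.- (κ ℚ.* ⟪ x , x ⟫ ℚ.+ s ℚ.* Q))
        (p≤q⇒0≤q-p (subst (ℚ._≤ ⟪ x , x ⟫) moment₁ (contraction⇒moment₁≤moment₀ κ s ρ∈[0,1])))
        (lemma τ s ⟪ x , x ⟫ Q))
      where
      τ = σ ℚ.+ ε
      Q = Σℚ.sum (λ u → x u ℚ.* ⟪ a u , x ⟫)
      bound = uniform-bound (μ ∘ suc)
      B = proj₁ bound
      -- Taking s = 1 / (∣τ∣ + B) gives 1 + s (μ - τ) ≥ 0 from μ - τ ≥ -(∣τ∣ + B); the upper end 1
      -- needs only μ < τ.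
      inverse : Σ[ s ∈ ℚ ] 0ℚ ℚ.< s × (ℚ.∣ τ ∣ ℚ.+ B) ℚ.* s ≡ 1ℚ
      inverse = divide (ℚ.+-mono-≤-< (ℚ.0≤∣p∣ τ) (proj₁ (proj₂ bound))) (ℚ.positive⁻¹ 1ℚ)
      s = proj₁ inverse
      0<s = proj₁ (proj₂ inverse)
      0≤s = ℚ.<⇒≤ 0<s
      κ = 1ℚ ℚ.- s ℚ.* τ
      lemma : ∀ τ s p Q → s ℚ.* Q ℚ.+ (p ℚ.- ((1ℚ ℚ.- s ℚ.* τ) ℚ.* p ℚ.+ s ℚ.* Q)) ≡ s ℚ.* (τ ℚ.* p)
      lemma = solve 4 (λ τ s p Q → s :* Q :+ (p :- ((con 1ℚ :- s :* τ) :* p :+ s :* Q)) := s :* (τ :* p)) refl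
        where open +-*-Solver
      moment₁ : ⟪ x , operator κ s x ⟫ ≡ κ ℚ.* ⟪ x , x ⟫ ℚ.+ s ℚ.* Q
      moment₁ = begin
        Σℚ.sum (λ u → x u ℚ.* (κ ℚ.* x u ℚ.+ s ℚ.* ⟪ a u , x ⟫))
          ≡⟨ Σℚ.sum-cong-≗ (λ u → lemma′ κ s (x u) ⟪ a u , x ⟫) ⟩
        Σℚ.sum (λ u → κ ℚ.* (x u ℚ.* x u) ℚ.+ s ℚ.* (x u ℚ.* ⟪ a u , x ⟫))
          ≡⟨ Σℚ.∑-distrib-+ (λ u → κ ℚ.* (x u ℚ.* x u)) (λ u → s ℚ.* (x u ℚ.* ⟪ a u , x ⟫)) ⟩
        Σℚ.sum (λ u → κ ℚ.* (x u ℚ.* x u)) ℚ.+ Σℚ.sum (λ u → s ℚ.* (x u ℚ.* ⟪ a u , x ⟫))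
          ≡⟨ cong₂ ℚ._+_ (Σℚ.*-distribˡ-sum κ (λ u → x u ℚ.* x u)) (Σℚ.*-distribˡ-sum s (λ u → x u ℚ.* ⟪ a u , x ⟫)) ⟨
        κ ℚ.* ⟪ x , x ⟫ ℚ.+ s ℚ.* Q ∎
        where
        open ≡-Reasoning
        lemma′ : ∀ κ s x p → x ℚ.* (κ ℚ.* x ℚ.+ s ℚ.* p) ≡ κ ℚ.* (x ℚ.* x) ℚ.+ s ℚ.* (x ℚ.* p)
        lemma′ = solve 4 (λ κ s x p → x :* (κ :* x :+ s :* p) := κ :* (x :* x) :+ s :* (x :* p)) refl
          where open +-*-Solver
      ρ∈[0,1] : ∀ i → UnitInterval (ρ κ s (suc i))
      ρ∈[0,1] i = eventually-zip (λ k → pointwise (seq (μ (suc i)) k)) (proj₂ (proj₂ bound) i) (μ≤σ i ε 0<ε)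
        where
        pointwise : ∀ z → ℚ.∣ z ∣ ℚ.≤ B → z ℚ.< τ → 0ℚ ℚ.≤ κ ℚ.+ s ℚ.* z × κ ℚ.+ s ℚ.* z ℚ.≤ 1ℚ
        pointwise z ∣z∣≤B z<τ =
            subst (0ℚ ℚ.≤_) (trans (lemma₁ s τ z ℚ.∣ τ ∣ B)
                    (cong (λ t → t ℚ.- s ℚ.* τ ℚ.+ s ℚ.* z) (proj₂ (proj₂ inverse))))
              (0≤* 0≤s (0≤+ (p≤q⇒0≤q-p (p≤∣p∣ τ)) (subst (0ℚ ℚ.≤_) (lemma₂ B z)
                      (p≤q⇒0≤q-p (ℚ.≤-trans (p≤∣p∣ (ℚ.- z)) (subst (ℚ._≤ B) (sym (ℚ.∣-p∣≡∣p∣ z)) ∣z∣≤B))))))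
          , ≤-witness (s ℚ.* (τ ℚ.- z)) (0≤* 0≤s (p≤q⇒0≤q-p (ℚ.<⇒≤ z<τ))) (lemma₃ s τ z)
          where
          open +-*-Solver
          lemma₁ : ∀ s τ z t B → s ℚ.* ((t ℚ.- τ) ℚ.+ (B ℚ.+ z)) ≡ (t ℚ.+ B) ℚ.* s ℚ.- s ℚ.* τ ℚ.+ s ℚ.* z
          lemma₁ = solve 5 (λ s τ z t B → s :* ((t :- τ) :+ (B :+ z)) := (t :+ B) :* s :- s :* τ :+ s :* z) refl
          lemma₂ : ∀ B z → B ℚ.- (ℚ.- z) ≡ B ℚ.+ z
          lemma₂ = solve 2 (λ B z → B :- (:- z) := B :+ z) refl
          lemma₃ : ∀ s τ z → (1ℚ ℚ.- s ℚ.* τ) ℚ.+ s ℚ.* z ℚ.+ s ℚ.* (τ ℚ.- z) ≡ 1ℚ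
          lemma₃ = solve 3 (λ s τ z → (con 1ℚ :- s :* τ) :+ s :* z :+ s :* (τ :- z) := con 1ℚ) refl

    quadratic-form-bound : Σℚ.sum (λ u → x u ℚ.* ⟪ a u , x ⟫) ℚ.≤ σ ℚ.* ⟪ x , x ⟫
    quadratic-form-bound = limit-≤ ⟪ x , x ⟫ 0≤Q λ ε 0<ε →
      subst (Q ℚ.≤_) (ℚ.*-distribʳ-+ ⟪ x , x ⟫ σ ε) (quadratic-form-bound-ε ε 0<ε)
      where
      Q = Σℚ.sum (λ u → x u ℚ.* ⟪ a u , x ⟫)
      0≤Q = 0≤Σℚ λ u → 0≤p*p (x u)

-- Edge expansion

module Σℕ = SemiringSum ℕ.+-*-semiring

true≢false : true ≢ false
true≢false ()

[_] : Bool → ℕ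
[ b ] = if b then 1 else 0

∣_∣ : ∀ {n} → (Fin n → Bool) → ℕ
∣ S ∣ = Σℕ.sum λ u → [ S u ]

length-filterᵇ-tabulate : ∀ {n} {A : Set} (p : A → Bool) (f : Fin n → A) →
  length (filterᵇ p (tabulate f)) ≡ ∣ p ∘ f ∣
length-filterᵇ-tabulate {zero}  p f = refl
length-filterᵇ-tabulate {suc n} p f with p (f zero)
... | true  = cong suc (length-filterᵇ-tabulate p (f ∘ suc))
... | false = length-filterᵇ-tabulate p (f ∘ suc)

degree≡sum : ∀ {n} (G : Graph n) u → degree G u ≡ ∣ adj G u ∣
degree≡sum G u = length-filterᵇ-tabulate (adj G u) id

fromℕ-sum : ∀ {n} (f : Fin n → ℕ) → fromℕ (Σℕ.sum f) ≡ Σℚ.sum (fromℕ ∘ f)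
fromℕ-sum {zero}  f = refl
fromℕ-sum {suc n} f = trans (fromℕ-+ (f zero) (Σℕ.sum (f ∘ suc))) (cong (fromℕ (f zero) ℚ.+_) (fromℕ-sum (f ∘ suc)))

[not] : ∀ b → [ b ] + [ not b ] ≡ 1
[not] true  = refl
[not] false = refl

[]-idem : ∀ b → [ b ] * [ b ] ≡ [ b ]
[]-idem true  = refl
[]-idem false = refl

sum-const : ∀ n c → Σℕ.sum {n} (λ _ → c) ≡ n * c
sum-const zero    c = refl
sum-const (suc n) c = cong (c ℕ.+_) (sum-const n c)

boundary : ∀ {n} → Graph n → (Fin n → Bool) → ℕ
boundary G S = Σℕ.sum λ u → [ S u ] * Σℕ.sum λ w → [ adj G u w ] * [ not (S w) ]

∣S∣+∣∁S∣≡n : ∀ {n} (S : Fin n → Bool) → ∣ S ∣ + ∣ not ∘ S ∣ ≡ n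
∣S∣+∣∁S∣≡n {n} S = begin
  ∣ S ∣ + ∣ not ∘ S ∣                      ≡⟨ Σℕ.∑-distrib-+ (λ u → [ S u ]) (λ u → [ not (S u) ]) ⟨
  Σℕ.sum (λ u → [ S u ] + [ not (S u) ])   ≡⟨ Σℕ.sum-cong-≗ (λ u → [not] (S u)) ⟩
  Σℕ.sum {n} (λ _ → 1)                       ≡⟨ sum-const n 1 ⟩
  n * 1                                    ≡⟨ ℕ.*-identityʳ n ⟩
  n                                          ∎
  where open ≡-Reasoning

-- The factor 2 is the gap between d and d - 2. Multiplying by n keeps the inequality in ℕ.
Expanding : ∀ {n} → Graph n → Set
Expanding {n} G = ∀ S → 2 * (∣ S ∣ * ∣ not ∘ S ∣) ≤ n * boundary G S

Σℚ-const : ∀ n c → Σℚ.sum {n} (λ _ → c) ≡ fromℕ n ℚ.* c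
Σℚ-const zero    c = sym (ℚ.*-zeroˡ c)
Σℚ-const (suc n) c = begin
  c ℚ.+ Σℚ.sum {n} (λ _ → c)       ≡⟨ cong₂ ℚ._+_ (sym (ℚ.*-identityˡ c)) (Σℚ-const n c) ⟩
  1ℚ ℚ.* c ℚ.+ fromℕ n ℚ.* c       ≡⟨ ℚ.*-distribʳ-+ c 1ℚ (fromℕ n) ⟨
  (1ℚ ℚ.+ fromℕ n) ℚ.* c           ≡⟨ cong (ℚ._* c) (fromℕ-+ 1 n) ⟨
  fromℕ (suc n) ℚ.* c              ∎
  where open ≡-Reasoning

Σℚ-affine : ∀ {n} p q r t (f g h : Fin n → ℚ) →
  Σℚ.sum (λ u → p ℚ.* f u ℚ.+ q ℚ.* g u ℚ.+ r ℚ.* h u ℚ.+ t) ≡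
  p ℚ.* Σℚ.sum f ℚ.+ q ℚ.* Σℚ.sum g ℚ.+ r ℚ.* Σℚ.sum h ℚ.+ fromℕ n ℚ.* t
Σℚ-affine {n} p q r t f g h = begin
  Σℚ.sum (λ u → p ℚ.* f u ℚ.+ q ℚ.* g u ℚ.+ r ℚ.* h u ℚ.+ t)
    ≡⟨ Σℚ.∑-distrib-+ (λ u → p ℚ.* f u ℚ.+ q ℚ.* g u ℚ.+ r ℚ.* h u) (λ _ → t) ⟩
  Σℚ.sum (λ u → p ℚ.* f u ℚ.+ q ℚ.* g u ℚ.+ r ℚ.* h u) ℚ.+ Σℚ.sum {n} (λ _ → t)
    ≡⟨ cong₂ ℚ._+_ (Σℚ.∑-distrib-+ (λ u → p ℚ.* f u ℚ.+ q ℚ.* g u) (λ u → r ℚ.* h u)) (Σℚ-const n t) ⟩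
  Σℚ.sum (λ u → p ℚ.* f u ℚ.+ q ℚ.* g u) ℚ.+ Σℚ.sum (λ u → r ℚ.* h u) ℚ.+ fromℕ n ℚ.* t
    ≡⟨ cong (λ z → z ℚ.+ Σℚ.sum (λ u → r ℚ.* h u) ℚ.+ fromℕ n ℚ.* t)
            (Σℚ.∑-distrib-+ (λ u → p ℚ.* f u) (λ u → q ℚ.* g u)) ⟩
  Σℚ.sum (λ u → p ℚ.* f u) ℚ.+ Σℚ.sum (λ u → q ℚ.* g u) ℚ.+ Σℚ.sum (λ u → r ℚ.* h u) ℚ.+ fromℕ n ℚ.* t
    ≡⟨ cong (ℚ._+ fromℕ n ℚ.* t) (cong₂ ℚ._+_ (cong₂ ℚ._+_ (Σℚ.*-distribˡ-sum p f) (Σℚ.*-distribˡ-sum q g))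
            (Σℚ.*-distribˡ-sum r h)) ⟨
  p ℚ.* Σℚ.sum f ℚ.+ q ℚ.* Σℚ.sum g ℚ.+ r ℚ.* Σℚ.sum h ℚ.+ fromℕ n ℚ.* t ∎
  where open ≡-Reasoning

module Expansion {m d : ℕ} (G : Graph (suc m)) (regular : Regular d G) (x : ℝ)
  (second : IsSecondLargestEigenvalue (adjacencyMatrix G) x)
  (x≤ : x ≤ᵣ fromℚ ((+ d ℤ.- + 2) ℚ./ 1)) where

  private
    n : ℕ
    n = suc m

  μ : Fin n → ℝ
  μ = proj₁ second

  open IsSpectrum (proj₁ (proj₂ second))
  open IsBasis eigenbasis

  i₁ : Fin n
  i₁ = proj₁ (proj₂ (proj₂ second))

  a : Fin n → Fin n → ℚ
  a u w = fromℕ [ adj G u w ]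

  δ σ : ℚ
  δ = fromℕ d
  σ = (+ d ℤ.- + 2) ℚ./ 1

  σ≡δ-2 : σ ≡ δ ℚ.- fromℕ 2
  σ≡δ-2 = trans (fromℤ-+ (+ d) (ℤ.- (+ 2))) (cong (δ ℚ.+_) (fromℤ-neg (+ 2)))

  a-sym : ∀ u w → a u w ≡ a w u
  a-sym u w = cong (fromℕ ∘ [_]) (symmetric G u w)

  row-sum : ∀ u → Σℚ.sum (a u) ≡ δ
  row-sum u = trans (sym (fromℕ-sum λ w → [ adj G u w ])) (cong fromℕ (trans (sym (degree≡sum G u)) (regular u)))

  entry : ∀ u w → fromℚ (a u w) ≡ adjacencyMatrix G u w
  entry u w with adj G u w
  ... | true  = refl
  ... | false = refl

  eigenequation′ : ∀ i → (λ u w → fromℚ (a u w)) · eigenvector i ≋ λ j → μ i *ᵣ eigenvector i j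
  eigenequation′ i u = subst (_≃ μ i *ᵣ eigenvector i u)
    (Σℝ.sum-cong-≗ λ w → cong (_*ᵣ eigenvector i w) (sym (entry u w))) (eigenequation i u)

  σ<δ : σ ℚ.< δ
  σ<δ = subst (ℚ._< δ) (sym σ≡δ-2)
    (subst (δ ℚ.- fromℕ 2 ℚ.<_) (ℚ.+-identityʳ δ) (ℚ.+-monoʳ-< δ {ℚ.- fromℕ 2} {0ℚ} (ℚ.negative⁻¹ (ℚ.- fromℕ 2))))

  μ≤σ : ∀ i ε → 0ℚ ℚ.< ε → Eventually λ k → seq (μ (suc i)) k ℚ.< σ ℚ.+ ε
  μ≤σ i ε 0<ε =
    -- The margin ε is spent in three places: η on the ordering of the eigenvalues, and ζ each on
    -- `μ i₁ ≃ x` and on x ≤ σ.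
    let η , 0<η , η+η = halve 0<ε
        ζ , 0<ζ , ζ+ζ = halve 0<η in
    eventually-zip (λ k p q → pointwise (seq (μ (suc i)) k) (seq (μ i₁) k) (seq x k) η+η ζ+ζ p (proj₁ q) (proj₂ q))
      (decreasing i₁ (suc i) (subst (ℕ._≤ suc (toℕ i)) (sym (proj₁ (proj₂ (proj₂ (proj₂ second))))) (s≤s z≤n)) η 0<η)
      (eventually-zip (λ k → _,_) (proj₂ (proj₂ (proj₂ (proj₂ second))) ζ 0<ζ) (x≤ ζ 0<ζ))
    where
    pointwise : ∀ {η ζ} p q r → η ℚ.+ η ≡ ε → ζ ℚ.+ ζ ≡ η → p ℚ.< q ℚ.+ η → ℚ.∣ q ℚ.- r ∣ ℚ.< ζ → r ℚ.< σ ℚ.+ ζ →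
                p ℚ.< σ ℚ.+ ε
    pointwise {η} {ζ} p q r η+η ζ+ζ p< q-r< r< = begin-strict
      p                                ≤⟨ ℚ.<⇒≤ p< ⟩
      q ℚ.+ η                          ≡⟨ lemma q r η ⟩
      (q ℚ.- r) ℚ.+ r ℚ.+ η            <⟨ ℚ.+-monoˡ-< η (ℚ.+-mono-< (ℚ.≤-<-trans (p≤∣p∣ (q ℚ.- r)) q-r<) r<) ⟩
      ζ ℚ.+ (σ ℚ.+ ζ) ℚ.+ η            ≡⟨ lemma′ ζ σ η ⟩
      σ ℚ.+ (ζ ℚ.+ ζ ℚ.+ η)            ≡⟨ cong (λ z → σ ℚ.+ (z ℚ.+ η)) ζ+ζ ⟩
      σ ℚ.+ (η ℚ.+ η)                  ≡⟨ cong (σ ℚ.+_) η+η ⟩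
      σ ℚ.+ ε                          ∎
      where
      open ℚ.≤-Reasoning
      lemma : ∀ q r η → q ℚ.+ η ≡ (q ℚ.- r) ℚ.+ r ℚ.+ η
      lemma = solve 3 (λ q r η → q :+ η := (q :- r) :+ r :+ η) refl
        where open +-*-Solver
      lemma′ : ∀ ζ σ η → ζ ℚ.+ (σ ℚ.+ ζ) ℚ.+ η ≡ σ ℚ.+ (ζ ℚ.+ ζ ℚ.+ η)
      lemma′ = solve 3 (λ ζ σ η → ζ :+ (σ :+ ζ) :+ η := σ :+ (ζ :+ ζ :+ η)) refl
        where open +-*-Solver

  open Rayleigh a a-sym δ row-sum μ eigenvector spanning eigenequation′ σ σ<δ μ≤σ using (quadratic-form-bound)

  -- The test vector y = n χ - s is n times the projection of the indicator χ of S to the complement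
  -- of 1. With E boundary edges, ⟪ y , y ⟫ = n s s̄ and ⟪ y , A y ⟫ = d n s s̄ - n² E, so the
  -- quadratic form bound becomes 2 n s s̄ ≤ n² E.
  expanding : Expanding G
  expanding S = fromℕ-cancel-≤ (begin
    fromℕ (2 * (∣ S ∣ * ∣ not ∘ S ∣))
      ≡⟨ trans (fromℕ-* 2 (∣ S ∣ * ∣ not ∘ S ∣)) (cong (fromℕ 2 ℚ.*_) (fromℕ-* ∣ S ∣ ∣ not ∘ S ∣)) ⟩
    fromℕ 2 ℚ.* (s ℚ.* s̄)                             ≤⟨ ℚ.*-cancelˡ-≤-pos N {{ℚ.positive 0<N}} scaled ⟩
    N ℚ.* E                                           ≡⟨ fromℕ-* n (boundary G S) ⟨
    fromℕ (n * boundary G S)                        ∎)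
    where
    open ℚ.≤-Reasoning
    N s s̄ D E : ℚ
    N = fromℕ n
    s = fromℕ ∣ S ∣
    s̄ = fromℕ ∣ not ∘ S ∣
    χ κ y : Fin n → ℚ
    χ u = fromℕ [ S u ]
    κ u = ⟪ a u , χ ⟫
    y u = N ℚ.* χ u ℚ.- s
    D = Σℚ.sum λ u → χ u ℚ.* κ u
    E = fromℕ (boundary G S)
    0<N : 0ℚ ℚ.< N
    0<N = ℚ.<-≤-trans (ℚ.positive⁻¹ 1ℚ) (fromℕ-mono-≤ {1} {n} (s≤s z≤n))
    Σχ : Σℚ.sum χ ≡ s
    Σχ = sym (fromℕ-sum (λ u → [ S u ]))
    N≡s+s̄ : N ≡ s ℚ.+ s̄
    N≡s+s̄ = trans (cong fromℕ (sym (∣S∣+∣∁S∣≡n S))) (fromℕ-+ ∣ S ∣ ∣ not ∘ S ∣)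
    Σκ : Σℚ.sum κ ≡ δ ℚ.* s
    Σκ = trans (Σℚ.∑-comm (λ u w → a u w ℚ.* χ w))
      (trans (Σℚ.sum-cong-≗ λ w → trans (sym (Σℚ.*-distribʳ-sum (χ w) (λ u → a u w)))
          (cong (ℚ._* χ w) (trans (Σℚ.sum-cong-≗ λ u → a-sym u w) (row-sum w))))
        (trans (sym (Σℚ.*-distribˡ-sum δ χ)) (cong (δ ℚ.*_) Σχ)))
    D+E : D ℚ.+ E ≡ δ ℚ.* s
    D+E = begin-equality
      D ℚ.+ E
        ≡⟨ cong (D ℚ.+_) (trans (fromℕ-sum (λ u → [ S u ] * Σℕ.sum λ w → [ adj G u w ] * [ not (S w) ]))
             (Σℚ.sum-cong-≗ λ u → trans (fromℕ-* [ S u ] (Σℕ.sum λ w → [ adj G u w ] * [ not (S w) ]))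
                     (cong (χ u ℚ.*_) (trans (fromℕ-sum (λ w → [ adj G u w ] * [ not (S w) ]))
               (Σℚ.sum-cong-≗ λ w → fromℕ-* [ adj G u w ] [ not (S w) ]))))) ⟩
      D ℚ.+ Σℚ.sum (λ u → χ u ℚ.* ⟪ a u , χ̄ ⟫)
        ≡⟨ Σℚ.∑-distrib-+ (λ u → χ u ℚ.* κ u) (λ u → χ u ℚ.* ⟪ a u , χ̄ ⟫) ⟨
      Σℚ.sum (λ u → χ u ℚ.* κ u ℚ.+ χ u ℚ.* ⟪ a u , χ̄ ⟫)
        ≡⟨ Σℚ.sum-cong-≗ (λ u → trans (sym (ℚ.*-distribˡ-+ (χ u) (κ u) ⟪ a u , χ̄ ⟫))
                (trans (cong (χ u ℚ.*_) (κ+κ̄ u)) (ℚ.*-comm (χ u) δ))) ⟩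
      Σℚ.sum (λ u → δ ℚ.* χ u)
        ≡⟨ trans (sym (Σℚ.*-distribˡ-sum δ χ)) (cong (δ ℚ.*_) Σχ) ⟩
      δ ℚ.* s ∎
      where
      χ̄ : Fin n → ℚ
      χ̄ w = fromℕ [ not (S w) ]
      κ+κ̄ : ∀ u → κ u ℚ.+ ⟪ a u , χ̄ ⟫ ≡ δ
      κ+κ̄ u = trans (sym (Σℚ.∑-distrib-+ (λ w → a u w ℚ.* χ w) (λ w → a u w ℚ.* χ̄ w)))
        (trans (Σℚ.sum-cong-≗ λ w → trans (sym (ℚ.*-distribˡ-+ (a u w) (χ w) (χ̄ w)))
            (trans (cong (a u w ℚ.*_) (trans (sym (fromℕ-+ [ S w ] [ not (S w) ])) (cong fromℕ ([not] (S w)))))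
                    (ℚ.*-identityʳ (a u w))))
          (row-sum u))
    y⊥1 : Σℚ.sum y ≡ 0ℚ
    y⊥1 = begin-equality
      Σℚ.sum (λ u → N ℚ.* χ u ℚ.- s)                      ≡⟨ Σℚ.∑-distrib-+ (λ u → N ℚ.* χ u) (λ u → ℚ.- s) ⟩
      Σℚ.sum (λ u → N ℚ.* χ u) ℚ.+ Σℚ.sum {n} (λ u → ℚ.- s)
        ≡⟨ cong₂ ℚ._+_ (trans (sym (Σℚ.*-distribˡ-sum N χ)) (cong (N ℚ.*_) Σχ)) (Σℚ-const n (ℚ.- s)) ⟩
      N ℚ.* s ℚ.+ N ℚ.* (ℚ.- s)                           ≡⟨ lemma N s ⟩
      0ℚ                                                  ∎
      where
      lemma : ∀ N s → N ℚ.* s ℚ.+ N ℚ.* (ℚ.- s) ≡ 0ℚ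
      lemma = solve 2 (λ N s → N :* s :+ N :* (:- s) := con 0ℚ) refl
        where open +-*-Solver
    ay : ∀ u → ⟪ a u , y ⟫ ≡ N ℚ.* κ u ℚ.- s ℚ.* δ
    ay u = begin-equality
      Σℚ.sum (λ w → a u w ℚ.* (N ℚ.* χ w ℚ.- s))          ≡⟨ Σℚ.sum-cong-≗ (λ w → lemma (a u w) N (χ w) s) ⟩
      Σℚ.sum (λ w → N ℚ.* (a u w ℚ.* χ w) ℚ.+ ℚ.- s ℚ.* a u w)
        ≡⟨ Σℚ.∑-distrib-+ (λ w → N ℚ.* (a u w ℚ.* χ w)) (λ w → ℚ.- s ℚ.* a u w) ⟩
      Σℚ.sum (λ w → N ℚ.* (a u w ℚ.* χ w)) ℚ.+ Σℚ.sum (λ w → ℚ.- s ℚ.* a u w)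
        ≡⟨ cong₂ ℚ._+_ (Σℚ.*-distribˡ-sum N (λ w → a u w ℚ.* χ w)) (Σℚ.*-distribˡ-sum (ℚ.- s) (a u)) ⟨
      N ℚ.* κ u ℚ.+ ℚ.- s ℚ.* Σℚ.sum (a u)                ≡⟨ cong (λ z → N ℚ.* κ u ℚ.+ ℚ.- s ℚ.* z) (row-sum u) ⟩
      N ℚ.* κ u ℚ.+ ℚ.- s ℚ.* δ                           ≡⟨ cong (N ℚ.* κ u ℚ.+_) (ℚ.neg-distribˡ-* s δ) ⟨
      N ℚ.* κ u ℚ.- s ℚ.* δ                               ∎
      where
      lemma : ∀ a N χ s → a ℚ.* (N ℚ.* χ ℚ.- s) ≡ N ℚ.* (a ℚ.* χ) ℚ.+ ℚ.- s ℚ.* a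
      lemma = solve 4 (λ a N χ s → a :* (N :* χ :- s) := N :* (a :* χ) :+ :- s :* a) refl
        where open +-*-Solver
    Q : Σℚ.sum (λ u → y u ℚ.* ⟪ a u , y ⟫) ≡ N ℚ.* N ℚ.* D ℚ.+ ℚ.- (N ℚ.* s ℚ.* δ) ℚ.* s ℚ.+ ℚ.- (s ℚ.* N) ℚ.* (δ ℚ.* s)
            ℚ.+ N ℚ.* (s ℚ.* (s ℚ.* δ))
    Q = trans (Σℚ.sum-cong-≗ λ u → trans (cong (y u ℚ.*_) (ay u)) (lemma N (χ u) s (κ u) δ))
      (trans (Σℚ-affine (N ℚ.* N) (ℚ.- (N ℚ.* s ℚ.* δ)) (ℚ.- (s ℚ.* N)) (s ℚ.* (s ℚ.* δ)) (λ u → χ u ℚ.* κ u) χ κ)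
        (cong₂ (λ p q → N ℚ.* N ℚ.* D ℚ.+ ℚ.- (N ℚ.* s ℚ.* δ) ℚ.* p ℚ.+ ℚ.- (s ℚ.* N) ℚ.* q ℚ.+ N ℚ.*
                (s ℚ.* (s ℚ.* δ))) Σχ Σκ))
      where
      lemma : ∀ N χ s κ δ → (N ℚ.* χ ℚ.- s) ℚ.* (N ℚ.* κ ℚ.- s ℚ.* δ) ≡
        N ℚ.* N ℚ.* (χ ℚ.* κ) ℚ.+ ℚ.- (N ℚ.* s ℚ.* δ) ℚ.* χ ℚ.+ ℚ.- (s ℚ.* N) ℚ.* κ ℚ.+ s ℚ.* (s ℚ.* δ)
      lemma = solve 5 (λ N χ s κ δ → (N :* χ :- s) :* (N :* κ :- s :* δ) :=
        N :* N :* (χ :* κ) :+ :- (N :* s :* δ) :* χ :+ :- (s :* N) :* κ :+ s :* (s :* δ)) refl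
        where open +-*-Solver
    ⟪y,y⟫ : ⟪ y , y ⟫ ≡ N ℚ.* N ℚ.* s ℚ.+ ℚ.- (N ℚ.* s) ℚ.* s ℚ.+ ℚ.- (s ℚ.* N) ℚ.* s ℚ.+ N ℚ.* (s ℚ.* s)
    ⟪y,y⟫ = trans (Σℚ.sum-cong-≗ λ u → trans (lemma N (χ u) s)
            (cong (λ z → N ℚ.* N ℚ.* z ℚ.+ ℚ.- (N ℚ.* s) ℚ.* χ u ℚ.+ ℚ.- (s ℚ.* N) ℚ.* χ u ℚ.+ s ℚ.* s)
            (trans (sym (fromℕ-* [ S u ] [ S u ])) (cong fromℕ ([]-idem (S u))))))
      (trans (Σℚ-affine (N ℚ.* N) (ℚ.- (N ℚ.* s)) (ℚ.- (s ℚ.* N)) (s ℚ.* s) χ χ χ)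
        (cong (λ p → N ℚ.* N ℚ.* p ℚ.+ ℚ.- (N ℚ.* s) ℚ.* p ℚ.+ ℚ.- (s ℚ.* N) ℚ.* p ℚ.+ N ℚ.* (s ℚ.* s)) Σχ))
      where
      lemma : ∀ N χ s → (N ℚ.* χ ℚ.- s) ℚ.* (N ℚ.* χ ℚ.- s) ≡
        N ℚ.* N ℚ.* (χ ℚ.* χ) ℚ.+ ℚ.- (N ℚ.* s) ℚ.* χ ℚ.+ ℚ.- (s ℚ.* N) ℚ.* χ ℚ.+ s ℚ.* s
      lemma = solve 3 (λ N χ s → (N :* χ :- s) :* (N :* χ :- s) :=
        N :* N :* (χ :* χ) :+ :- (N :* s) :* χ :+ :- (s :* N) :* χ :+ s :* s) refl
        where open +-*-Solver
    scaled : N ℚ.* (fromℕ 2 ℚ.* (s ℚ.* s̄)) ℚ.≤ N ℚ.* (N ℚ.* E)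
    scaled = ≤-witness (gap N) (p≤q⇒0≤q-p (subst₂ ℚ._≤_ Q (cong₂ ℚ._*_ σ≡δ-2 ⟪y,y⟫) (quadratic-form-bound y y⊥1)))
      (trans (cong (λ z → z ℚ.* (fromℕ 2 ℚ.* (s ℚ.* s̄)) ℚ.+ gap z) N≡s+s̄)
        (trans (lemma s s̄ δ D)
          (trans (cong (λ z → (s ℚ.+ s̄) ℚ.* ((s ℚ.+ s̄) ℚ.* (z ℚ.- D))) (sym D+E))
            (trans (lemma′ (s ℚ.+ s̄) D E) (cong (λ z → z ℚ.* (z ℚ.* E)) (sym N≡s+s̄))))))
      where
      -- The slack takes n as an argument so that n = s + s̄ can be substituted before the ring
      -- solver is called; D + E = d s is substituted afterwards.
      gap : ℚ → ℚ
      gap z = (δ ℚ.- fromℕ 2) ℚ.* (z ℚ.* z ℚ.* s ℚ.+ ℚ.- (z ℚ.* s) ℚ.* s ℚ.+ ℚ.- (s ℚ.* z) ℚ.* s ℚ.+ z ℚ.* (s ℚ.* s))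
        ℚ.- (z ℚ.* z ℚ.* D ℚ.+ ℚ.- (z ℚ.* s ℚ.* δ) ℚ.* s ℚ.+ ℚ.- (s ℚ.* z) ℚ.* (δ ℚ.* s) ℚ.+ z ℚ.* (s ℚ.* (s ℚ.* δ)))
      lemma : ∀ s t δ D → (s ℚ.+ t) ℚ.* (fromℕ 2 ℚ.* (s ℚ.* t)) ℚ.+
              ((δ ℚ.- fromℕ 2) ℚ.* ((s ℚ.+ t) ℚ.* (s ℚ.+ t) ℚ.* s ℚ.+ ℚ.- ((s ℚ.+ t) ℚ.* s) ℚ.* s ℚ.+ ℚ.-
              (s ℚ.* (s ℚ.+ t)) ℚ.* s ℚ.+ (s ℚ.+ t) ℚ.* (s ℚ.* s))
          ℚ.- ((s ℚ.+ t) ℚ.* (s ℚ.+ t) ℚ.* D ℚ.+ ℚ.- ((s ℚ.+ t) ℚ.* s ℚ.* δ) ℚ.* s ℚ.+ ℚ.- (s ℚ.* (s ℚ.+ t)) ℚ.*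
                  (δ ℚ.* s) ℚ.+ (s ℚ.+ t) ℚ.* (s ℚ.* (s ℚ.* δ)))) ≡
          (s ℚ.+ t) ℚ.* ((s ℚ.+ t) ℚ.* (δ ℚ.* s ℚ.- D))
      lemma = solve 4 (λ s t δ D → (s :+ t) :* (con (fromℕ 2) :* (s :* t)) :+
              ((δ :- con (fromℕ 2)) :* ((s :+ t) :* (s :+ t) :* s :+ :- ((s :+ t) :* s) :* s :+ :-
              (s :* (s :+ t)) :* s :+ (s :+ t) :* (s :* s))
          :- ((s :+ t) :* (s :+ t) :* D :+ :- ((s :+ t) :* s :* δ) :* s :+ :- (s :* (s :+ t)) :* (δ :* s) :+ (s :+ t) :*
                  (s :* (s :* δ)))) :=
          (s :+ t) :* ((s :+ t) :* (δ :* s :- D))) refl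
        where open +-*-Solver
      lemma′ : ∀ N D E → N ℚ.* (N ℚ.* ((D ℚ.+ E) ℚ.- D)) ≡ N ℚ.* (N ℚ.* E)
      lemma′ = solve 3 (λ N D E → N :* (N :* ((D :+ E) :- D)) := N :* (N :* E)) refl
        where open +-*-Solver

-- Weights of unions of monochromatic components

Σℕ-mono : ∀ {n} {f g : Fin n → ℕ} → (∀ u → f u ≤ g u) → Σℕ.sum f ≤ Σℕ.sum g
Σℕ-mono {zero}  f≤g = z≤n
Σℕ-mono {suc n} f≤g = ℕ.+-mono-≤ (f≤g zero) (Σℕ-mono (f≤g ∘ suc))

term≤sum : ∀ {n} (f : Fin n → ℕ) i → f i ≤ Σℕ.sum f
term≤sum f zero    = ℕ.m≤m+n (f zero) _
term≤sum f (suc i) = ℕ.≤-trans (term≤sum (f ∘ suc) i) (ℕ.m≤n+m _ (f zero))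

Σℕ-sandwich : ∀ {n} {f g : Fin n → ℕ} → (∀ u → f u ≤ g u) → Σℕ.sum g ≤ Σℕ.sum f → ∀ u → f u ≡ g u
Σℕ-sandwich {suc n} {f} {g} f≤g Σg≤Σf zero = ℕ.≤-antisym (f≤g zero)
  (ℕ.+-cancelʳ-≤ (Σℕ.sum (g ∘ suc)) (g zero) (f zero)
    (ℕ.≤-trans Σg≤Σf (ℕ.+-monoʳ-≤ (f zero) (Σℕ-mono (f≤g ∘ suc)))))
Σℕ-sandwich {suc n} {f} {g} f≤g Σg≤Σf (suc u) = Σℕ-sandwich (f≤g ∘ suc)
  (ℕ.+-cancelˡ-≤ (f zero) (Σℕ.sum (g ∘ suc)) (Σℕ.sum (f ∘ suc))
    (ℕ.≤-trans (ℕ.+-monoˡ-≤ (Σℕ.sum (g ∘ suc)) (f≤g zero)) Σg≤Σf)) u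

1≤sum⇒∃ : ∀ {n} (f : Fin n → ℕ) → 1 ≤ Σℕ.sum f → ∃[ i ] 1 ≤ f i
1≤sum⇒∃ {suc n} f 1≤ with f zero in eq
... | suc k = zero , subst (1 ≤_) (sym eq) (s≤s z≤n)
... | zero  = let i , 1≤fi = 1≤sum⇒∃ (f ∘ suc) 1≤ in suc i , 1≤fi

average≤max : ∀ {n} (f : Fin (suc n) → ℕ) → ∃[ i ] Σℕ.sum f ≤ suc n * f i
average≤max {zero}  f = zero , ℕ.≤-refl
average≤max {suc n} f with average≤max (f ∘ suc)
... | i , Σf≤ with ℕ.≤-total (f zero) (f (suc i))
... | inj₁ f₀≤fᵢ = suc i , ℕ.+-mono-≤ f₀≤fᵢ Σf≤
... | inj₂ fᵢ≤f₀ = zero , ℕ.+-monoʳ-≤ (f zero) (ℕ.≤-trans Σf≤ (ℕ.*-monoʳ-≤ (suc n) fᵢ≤f₀))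

sum-indicator : ∀ {n} (v : Fin n) → Σℕ.sum (λ u → [ does (v Fin.≟ u) ]) ≡ 1
sum-indicator {suc n} zero    = cong suc (Σℕ.sum-replicate-zero n)
sum-indicator {suc n} (suc v) = sum-indicator v

weight : ℕ → ℕ → ℕ
weight d 0 = 6
weight d 1 = 3
weight d k@(suc (suc _)) = if k ≡ᵇ d then 0 else 2

≡ᵇ-refl : ∀ k → (k ≡ᵇ k) ≡ true
≡ᵇ-refl zero    = refl
≡ᵇ-refl (suc k) = ≡ᵇ-refl k

≢⇒≡ᵇ-false : ∀ {j k} → j ≢ k → (j ≡ᵇ k) ≡ false
≢⇒≡ᵇ-false {j} {k} j≢k with j ≡ᵇ k in eq
... | false = refl
... | true  = ⊥-elim (j≢k (ℕ.≡ᵇ⇒≡ j k (subst T (sym eq) _)))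

weight-full : ∀ {d} → 2 ≤ d → weight d d ≡ 0
weight-full {suc (suc d)} _ = cong (if_then 0 else 2) (≡ᵇ-refl d)
weight-full {suc zero} (s≤s ())

2≤weight : ∀ {d k} → k ≢ d → 2 ≤ weight d k
2≤weight {k = 0} k≢d = s≤s (s≤s z≤n)
2≤weight {k = 1} k≢d = s≤s (s≤s z≤n)
2≤weight {d} {suc (suc k)} k≢d = subst (λ b → 2 ≤ (if b then 0 else 2)) (sym (≢⇒≡ᵇ-false k≢d)) ℕ.≤-refl

weight≤6 : ∀ d k → weight d k ≤ 6
weight≤6 d 0 = ℕ.≤-refl
weight≤6 d 1 = s≤s (s≤s (s≤s z≤n))
weight≤6 d k@(suc (suc _)) with k ≡ᵇ d
... | true  = z≤n
... | false = s≤s (s≤s z≤n)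

weight-positive : ∀ d {k} → 1 ≤ k → weight d k ≤ 3
weight-positive d {1} _ = ℕ.≤-refl
weight-positive d {k@(suc (suc _))} _ with k ≡ᵇ d
... | true  = z≤n
... | false = s≤s (s≤s z≤n)

weight-large : ∀ d {k} → 2 ≤ k → weight d k ≤ 2
weight-large d {1} (s≤s ())
weight-large d {k@(suc (suc _))} _ with k ≡ᵇ d
... | true  = z≤n
... | false = ℕ.≤-refl

-- For symmetric `κ` these are the unions of connected components of the graph `κ`.
Closed : ∀ {n} → (Fin n → Fin n → Bool) → (Fin n → Bool) → Set
Closed κ C = ∀ u w → C u ≡ true → κ u w ≡ true → C w ≡ true

complement-large : ∀ {n} s t → s + t ≡ n → 4 * s ≤ 3 * n → n ≤ 4 * t
complement-large {n} s t s+t≡n 4s≤3n = ℕ.+-cancelˡ-≤ (3 * n) n (4 * t) (begin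
  3 * n + n           ≡⟨ ℕ.+-comm (3 * n) n ⟩
  4 * n               ≡⟨ cong (4 *_) s+t≡n ⟨
  4 * (s + t)         ≡⟨ ℕ.*-distribˡ-+ 4 s t ⟩
  4 * s + 4 * t       ≤⟨ ℕ.+-monoˡ-≤ (4 * t) 4s≤3n ⟩
  3 * n + 4 * t       ∎)
  where open ℕ.≤-Reasoning

-- Here e stands for d - 1. Expansion gives s t ≤ n e, and t ≥ n/4 turns this into s ≤ 4e. As s ≥ e
-- + 2, also (e + 2) n = (e + 2) s + (e + 2) t ≤ 4e (e + 2) + n e. So 2n ≤ 4 (e + 1)² - 4, against
-- the lower bound on n.
few-boundary-edges : ∀ {n E} e s t → s + t ≡ n → 4 * s ≤ 3 * n → suc e < s →
                     2 * (s * t) ≤ n * E → E ≤ 2 * e → 2 * (suc e * suc e) ≤ n → ⊥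
few-boundary-edges {n} {E} e s t s+t≡n 4s≤3n e+1<s 2st≤nE E≤2e 2[e+1]²≤n = ℕ.<-irrefl refl (begin-strict
  2 * (2 * (suc e * suc e))      ≤⟨ ℕ.*-monoʳ-≤ 2 2[e+1]²≤n ⟩
  2 * n                          ≤⟨ ℕ.+-cancelʳ-≤ (n * e) (2 * n) (suc (suc e) * (4 * e)) (begin
    2 * n + n * e                           ≡⟨ lemma₁ n e ⟩
    suc (suc e) * n                         ≡⟨ cong (suc (suc e) *_) s+t≡n ⟨
    suc (suc e) * (s + t)                   ≡⟨ ℕ.*-distribˡ-+ (suc (suc e)) s t ⟩
    suc (suc e) * s + suc (suc e) * t       ≤⟨ ℕ.+-mono-≤ (ℕ.*-monoʳ-≤ (suc (suc e)) s≤4e) (ℕ.*-monoˡ-≤ t e+1<s) ⟩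
    suc (suc e) * (4 * e) + s * t           ≤⟨ ℕ.+-monoʳ-≤ (suc (suc e) * (4 * e)) st≤ne ⟩
    suc (suc e) * (4 * e) + n * e           ∎) ⟩
  suc (suc e) * (4 * e)          <⟨ ℕ.m<m+n _ {4} (s≤s z≤n) ⟩
  suc (suc e) * (4 * e) + 4      ≡⟨ lemma₂ e ⟩
  2 * (2 * (suc e * suc e))      ∎)
  where
  open ℕ.≤-Reasoning
  lemma₁ : ∀ n e → 2 * n + n * e ≡ suc (suc e) * n
  lemma₁ = solve-∀
  lemma₂ : ∀ e → suc (suc e) * (4 * e) + 4 ≡ 2 * (2 * (suc e * suc e))
  lemma₂ = solve-∀
  lemma₄ : ∀ n e → n * (2 * e) ≡ 2 * (n * e)
  lemma₄ = solve-∀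
  lemma₅ : ∀ n e → 4 * (n * e) ≡ (4 * e) * n
  lemma₅ = solve-∀
  lemma₆ : ∀ s t → 4 * t * s ≡ 4 * (s * t)
  lemma₆ = solve-∀
  st≤ne : s * t ≤ n * e
  st≤ne = ℕ.*-cancelˡ-≤ 2 (ℕ.≤-trans 2st≤nE (ℕ.≤-trans (ℕ.*-monoʳ-≤ n E≤2e) (ℕ.≤-reflexive (lemma₄ n e))))
  n≤4t : n ≤ 4 * t
  n≤4t = complement-large s t s+t≡n 4s≤3n
  instance
    n≢0 : NonZero n
    n≢0 = ℕ.>-nonZero (ℕ.<-≤-trans (s≤s z≤n) (ℕ.≤-trans (ℕ.<⇒≤ e+1<s) (subst (s ≤_) s+t≡n (ℕ.m≤m+n s t))))
  s≤4e : s ≤ 4 * e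
  s≤4e = ℕ.*-cancelʳ-≤ s (4 * e) n (begin
    s * n               ≤⟨ ℕ.*-monoʳ-≤ s n≤4t ⟩
    s * (4 * t)         ≡⟨ ℕ.*-comm s (4 * t) ⟩
    4 * t * s           ≡⟨ lemma₆ s t ⟩
    4 * (s * t)         ≤⟨ ℕ.*-monoʳ-≤ 4 st≤ne ⟩
    4 * (n * e)         ≡⟨ lemma₅ n e ⟩
    4 * e * n           ∎)

module Subgraph {n : ℕ} (G : Graph n) {d : ℕ} (regular : Regular d G) (κ : Fin n → Fin n → Bool)
         (κ⊆adj : ∀ u w → κ u w ≡ true → adj G u w ≡ true) where

  deg : Fin n → ℕ
  deg u = ∣ κ u ∣

  Σadj : ∀ u → ∣ adj G u ∣ ≡ d
  Σadj u = trans (sym (degree≡sum G u)) (regular u)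

  [κ]≤[adj] : ∀ u w → [ κ u w ] ≤ [ adj G u w ]
  [κ]≤[adj] u w with κ u w in eq
  ... | false = z≤n
  ... | true  = ℕ.≤-reflexive (cong [_] (sym (κ⊆adj u w eq)))

  deg≡d⇒adj⊆κ : ∀ u → deg u ≡ d → ∀ w → adj G u w ≡ true → κ u w ≡ true
  deg≡d⇒adj⊆κ u deg≡d w u~w with κ u w | Σℕ-sandwich ([κ]≤[adj] u) (ℕ.≤-reflexive (trans (Σadj u) (sym deg≡d))) w
  ... | true  | _  = refl
  ... | false | eq with adj G u w
  deg≡d⇒adj⊆κ u deg≡d w refl | false | () | true

  module _ (C : Fin n → Bool) (closed : Closed κ C) where

    deg<∣C∣ : ∀ u → C u ≡ true → deg u < ∣ C ∣
    deg<∣C∣ u u∈C = begin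
      suc (deg u)                                                ≡⟨ ℕ.+-comm 1 (deg u) ⟩
      deg u + 1                                                  ≡⟨ cong (deg u ℕ.+_) (sum-indicator u) ⟨
      deg u + Σℕ.sum (λ w → [ does (u Fin.≟ w) ])
        ≡⟨ Σℕ.∑-distrib-+ (λ w → [ κ u w ]) (λ w → [ does (u Fin.≟ w) ]) ⟨
      Σℕ.sum (λ w → [ κ u w ] + [ does (u Fin.≟ w) ])            ≤⟨ Σℕ-mono pointwise ⟩
      ∣ C ∣                                                      ∎
      where
      open ℕ.≤-Reasoning
      pointwise : ∀ w → [ κ u w ] + [ does (u Fin.≟ w) ] ≤ [ C w ]
      pointwise w with κ u w in eq | u Fin.≟ w
      ... | true  | no  _    = ℕ.≤-reflexive (cong [_] (sym (closed u w u∈C eq)))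
      ... | false | no  _    = z≤n
      ... | false | yes refl = ℕ.≤-reflexive (cong [_] (sym u∈C))
      ... | true  | yes refl with () ← trans (sym (κ⊆adj u u eq)) (loopless G u)

    -- The κ-neighbours of a vertex of C lie in C, so the neighbours outside C and the κ-neighbours
    -- are disjoint parts of its neighbourhood.
    outside+deg≤d : ∀ u → C u ≡ true → Σℕ.sum (λ w → [ adj G u w ] * [ not (C w) ]) + deg u ≤ d
    outside+deg≤d u u∈C = begin
      Σℕ.sum (λ w → [ adj G u w ] * [ not (C w) ]) + deg u
        ≡⟨ Σℕ.∑-distrib-+ (λ w → [ adj G u w ] * [ not (C w) ]) (λ w → [ κ u w ]) ⟨
      Σℕ.sum (λ w → [ adj G u w ] * [ not (C w) ] + [ κ u w ])   ≤⟨ Σℕ-mono pointwise ⟩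
      ∣ adj G u ∣                                                ≡⟨ Σadj u ⟩
      d                                                          ∎
      where
      open ℕ.≤-Reasoning
      pointwise : ∀ w → [ adj G u w ] * [ not (C w) ] + [ κ u w ] ≤ [ adj G u w ]
      pointwise w with κ u w in eq
      ... | true rewrite closed u w u∈C eq | κ⊆adj u w eq = ℕ.≤-refl
      ... | false with adj G u w | C w
      ... | true  | true  = z≤n
      ... | true  | false = ℕ.≤-refl
      ... | false | _     = z≤n

    module _ (expanding : Expanding G) (3≤d : 3 ≤ d) (large : 2 * (d * d) ≤ n)
             (v : Fin n) (v∈C : C v ≡ true) (4∣C∣≤3n : 4 * ∣ C ∣ ≤ 3 * n) where

      total : ℕ
      total = Σℕ.sum λ u → [ C u ] * weight d (deg u)

      ∈C⇒≤total : ∀ u → C u ≡ true → weight d (deg u) ≤ total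
      ∈C⇒≤total u u∈C = ℕ.≤-trans
        (ℕ.≤-reflexive (sym (trans (cong (λ b → [ b ] * weight d (deg u)) u∈C) (ℕ.*-identityˡ _))))
        (term≤sum (λ u → [ C u ] * weight d (deg u)) u)

      constant≤total : ∀ c → (∀ u → C u ≡ true → c ≤ weight d (deg u)) → ∣ C ∣ * c ≤ total
      constant≤total c c≤ = ℕ.≤-trans (ℕ.≤-reflexive (Σℕ.*-distribʳ-sum c (λ u → [ C u ]))) (Σℕ-mono pointwise)
        where
        pointwise : ∀ u → [ C u ] * c ≤ [ C u ] * weight d (deg u)
        pointwise u with C u in eq
        ... | true  = ℕ.*-monoʳ-≤ 1 (c≤ u eq)
        ... | false = z≤n

      unsaturated : Fin n → Bool
      unsaturated u = C u ∧ not (deg u ≡ᵇ d)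

      2∣unsaturated∣≤total : ∣ unsaturated ∣ * 2 ≤ total
      2∣unsaturated∣≤total = ℕ.≤-trans (ℕ.≤-reflexive (Σℕ.*-distribʳ-sum 2 (λ u → [ unsaturated u ])))
              (Σℕ-mono pointwise)
        where
        pointwise : ∀ u → [ unsaturated u ] * 2 ≤ [ C u ] * weight d (deg u)
        pointwise u with C u | deg u ℕ.≟ d
        ... | false | _ = z≤n
        ... | true  | yes deg≡d rewrite deg≡d | ≡ᵇ-refl d = z≤n
        ... | true  | no  deg≢d rewrite ≢⇒≡ᵇ-false deg≢d = ℕ.≤-trans (2≤weight deg≢d) (ℕ.m≤m+n _ 0)

      -- A vertex of κ-degree d sends no edge out of C. Any other vertex of C keeps at least one
      -- edge inside, so at most d - 1 of its edges leave.
      boundary≤ : ∀ {e} → d ≡ suc e → (∀ u → C u ≡ true → 1 ≤ deg u) → boundary G C ≤ ∣ unsaturated ∣ * e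
      boundary≤ {e} d≡ 1≤deg = ℕ.≤-trans (Σℕ-mono pointwise)
              (ℕ.≤-reflexive (sym (Σℕ.*-distribʳ-sum e (λ u → [ unsaturated u ]))))
        where
        out : Fin n → ℕ
        out u = Σℕ.sum (λ w → [ adj G u w ] * [ not (C w) ])
        pointwise : ∀ u → [ C u ] * out u ≤ [ unsaturated u ] * e
        pointwise u with C u in eq | deg u ℕ.≟ d
        ... | false | _ = z≤n
        ... | true  | yes deg≡d rewrite deg≡d | ≡ᵇ-refl d = ℕ.≤-trans (ℕ.≤-reflexive (ℕ.+-identityʳ (out u)))
                (ℕ.+-cancelʳ-≤ d (out u) 0 (subst (λ k → out u + k ≤ d) deg≡d (outside+deg≤d u eq)))
        ... | true  | no  deg≢d rewrite ≢⇒≡ᵇ-false deg≢d = ℕ.+-monoˡ-≤ 0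
                (ℕ.+-cancelʳ-≤ 1 (out u) e (ℕ.≤-trans (ℕ.+-monoʳ-≤ (out u) (1≤deg u eq))
                  (ℕ.≤-trans (outside+deg≤d u eq) (ℕ.≤-reflexive (trans d≡ (ℕ.+-comm 1 e))))))

      -- A vertex of degree d forces more than d vertices into C. Two unsaturated vertices would
      -- supply at most 2 (d - 1) boundary edges, too few for the expansion of a set of that size;
      -- so there are at least three, of weight at least 2 each.
      full-vertex : (∀ u → C u ≡ true → 1 ≤ deg u) → ∀ u → C u ≡ true → deg u ≡ d → 6 ≤ total
      full-vertex 1≤deg u u∈C deg≡d with 3 ℕ.≤? ∣ unsaturated ∣
      ... | yes 3≤b = ℕ.≤-trans (ℕ.*-monoˡ-≤ 2 3≤b) 2∣unsaturated∣≤total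
      ... | no  3≰b = ⊥-elim (few-boundary-edges e ∣ C ∣ ∣ not ∘ C ∣ (∣S∣+∣∁S∣≡n C) 4∣C∣≤3n
              (subst (_< ∣ C ∣) (trans deg≡d d≡) (deg<∣C∣ u u∈C)) (expanding C)
              (ℕ.≤-trans (boundary≤ d≡ 1≤deg) (ℕ.*-monoˡ-≤ e (ℕ.≤-pred (ℕ.≰⇒> 3≰b))))
              (subst (λ k → 2 * (k * k) ≤ n) d≡ large))
        where
        e = ℕ.pred d
        d≡ : d ≡ suc e
        d≡ = sym (ℕ.suc-pred d {{ℕ.>-nonZero (ℕ.<-≤-trans (s≤s z≤n) 3≤d)}})

      -- The order of the cases matters. Isolated vertices go first, as `full-vertex` assumes that
      -- there are none. Once vertices of degree d are excluded as well, every weight is at least 2,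
      -- and a vertex of degree at least 2 brings two more vertices with it. In the remaining case
      -- all degrees are 1, and two vertices of weight 3 suffice.
      6≤total : 6 ≤ total
      6≤total with Fin.any? (λ u → C u Bool.≟ true ×-dec deg u ℕ.≟ 0)
      ... | yes (u , u∈C , deg≡0) = ℕ.≤-trans (ℕ.≤-reflexive (cong (weight d) (sym deg≡0))) (∈C⇒≤total u u∈C)
      ... | no  ∄0 with Fin.any? (λ u → C u Bool.≟ true ×-dec deg u ℕ.≟ d)
      ... | yes (u , u∈C , deg≡d) = full-vertex (λ u u∈C → ℕ.n≢0⇒n>0 λ deg≡0 → ∄0 (u , u∈C , deg≡0)) u u∈C deg≡d
      ... | no  ∄d with Fin.any? (λ u → C u Bool.≟ true ×-dec 2 ℕ.≤? deg u)
      ... | yes (u , u∈C , 2≤deg) = ℕ.≤-trans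
            (ℕ.*-monoˡ-≤ 2 (ℕ.≤-trans (s≤s 2≤deg) (deg<∣C∣ u u∈C)))
            (constant≤total 2 λ u u∈C → 2≤weight λ deg≡d → ∄d (u , u∈C , deg≡d))
      ... | no  ∄2 = ℕ.≤-trans
            (ℕ.*-monoˡ-≤ 3 (ℕ.≤-trans (s≤s (ℕ.≤-reflexive (sym (deg≡1 v v∈C)))) (deg<∣C∣ v v∈C)))
            (constant≤total 3 λ u u∈C → ℕ.≤-reflexive (cong (weight d) (sym (deg≡1 u u∈C))))
        where
        deg≡1 : ∀ u → C u ≡ true → deg u ≡ 1
        deg≡1 u u∈C = ℕ.≤-antisym (ℕ.≮⇒≥ λ 2≤deg → ∄2 (u , u∈C , 2≤deg)) (ℕ.n≢0⇒n>0 λ deg≡0 → ∄0 (u , u∈C , deg≡0))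

-- Weights at one vertex, summed over the colours

does⇒ : ∀ {P : Set} (P? : Dec P) → does P? ≡ true → P
does⇒ (yes p) _ = p

two-terms≤sum : ∀ {n} (f : Fin n → ℕ) {i j} → i ≢ j → f i + f j ≤ Σℕ.sum f
two-terms≤sum f {zero}  {zero}  i≢j = ⊥-elim (i≢j refl)
two-terms≤sum f {zero}  {suc j} i≢j = ℕ.+-monoʳ-≤ (f zero) (term≤sum (f ∘ suc) j)
two-terms≤sum f {suc i} {zero}  i≢j =
  ℕ.≤-trans (ℕ.≤-reflexive (ℕ.+-comm (f (suc i)) (f zero))) (ℕ.+-monoʳ-≤ (f zero) (term≤sum (f ∘ suc) i))
two-terms≤sum f {suc i} {suc j} i≢j = ℕ.≤-trans (two-terms≤sum (f ∘ suc) (i≢j ∘ cong suc)) (ℕ.m≤n+m _ (f zero))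

other-term : ∀ {n} (f : Fin n → ℕ) i → f i < Σℕ.sum f → ∃[ j ] i ≢ j × 1 ≤ f j
other-term f zero f₀<Σ =
  let j , 1≤fj = 1≤sum⇒∃ (f ∘ suc) (ℕ.+-cancelˡ-≤ (f zero) 1 _
          (ℕ.≤-trans (ℕ.≤-reflexive (ℕ.+-comm (f zero) 1)) f₀<Σ)) in
  suc j , (λ ()) , 1≤fj
other-term f (suc i) fᵢ<Σ with f zero in eq
... | suc k = zero , (λ ()) , subst (1 ≤_) (sym eq) (s≤s z≤n)
... | zero  = let j , i≢j , 1≤fj = other-term (f ∘ suc) i fᵢ<Σ in suc j , i≢j ∘ Fin.suc-injective , 1≤fj

deficit : ℕ → ℕ → ℕ
deficit d k = 6 ∸ weight d k

weights+deficits : ∀ {r} d (k : Fin r → ℕ) → Σℕ.sum (λ i → weight d (k i)) + Σℕ.sum (λ i → deficit d (k i)) ≡ r * 6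
weights+deficits {r} d k = begin
  Σℕ.sum (λ i → weight d (k i)) + Σℕ.sum (λ i → deficit d (k i))
    ≡⟨ Σℕ.∑-distrib-+ (λ i → weight d (k i)) (λ i → deficit d (k i)) ⟨
  Σℕ.sum (λ i → weight d (k i) + deficit d (k i))
    ≡⟨ Σℕ.sum-cong-≗ (λ i → ℕ.m+[n∸m]≡n (weight≤6 d (k i))) ⟩
  Σℕ.sum {r} (λ _ → 6)
    ≡⟨ sum-const r 6 ⟩
  r * 6 ∎
  where open ≡-Reasoning

module _ {r : ℕ} (d : ℕ) (k : Fin r → ℕ) (3≤d : 3 ≤ d) (Σk≡d : Σℕ.sum k ≡ d) where

  private
    h : Fin r → ℕ
    h i = deficit d (k i)

  -- A colour with at least two but not all of the d edges saves 4, and another colour that occurs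
  -- saves 3. If no colour occurs twice, then each of the d ≥ 3 edges saves 3, which makes at least
  -- 9.
  7≤Σdeficit : (∀ i → k i ≢ d) → 7 ≤ Σℕ.sum h
  7≤Σdeficit k≢d with Fin.any? (λ i → 2 ℕ.≤? k i)
  ... | yes (i , 2≤kᵢ) =
    let j , i≢j , 1≤kⱼ = other-term k i (ℕ.≤∧≢⇒< (term≤sum k i) (λ kᵢ≡ → k≢d i (trans kᵢ≡ Σk≡d))) in
    ℕ.≤-trans (ℕ.+-mono-≤ (ℕ.∸-monoʳ-≤ 6 (weight-large d 2≤kᵢ)) (ℕ.∸-monoʳ-≤ 6 (weight-positive d 1≤kⱼ)))
      (two-terms≤sum h i≢j)
  ... | no ∄2 = begin
    7                              ≤⟨ s≤s (s≤s (s≤s (s≤s (s≤s (s≤s (s≤s z≤n)))))) ⟩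
    3 * 3                          ≤⟨ ℕ.*-monoʳ-≤ 3 3≤d ⟩
    3 * d                          ≡⟨ cong (3 *_) Σk≡d ⟨
    3 * Σℕ.sum k                   ≡⟨ Σℕ.*-distribˡ-sum 3 k ⟩
    Σℕ.sum (λ i → 3 * k i)         ≤⟨ Σℕ-mono (λ i → pointwise (k i) (λ 2≤kᵢ → ∄2 (i , 2≤kᵢ))) ⟩
    Σℕ.sum h                       ∎
    where
    open ℕ.≤-Reasoning
    pointwise : ∀ l → ¬ 2 ≤ l → 3 * l ≤ deficit d l
    pointwise 0 _ = z≤n
    pointwise 1 _ = ℕ.≤-refl
    pointwise (suc (suc l)) 2≰l = ⊥-elim (2≰l (s≤s (s≤s z≤n)))

  6≤Σdeficit : 6 ≤ Σℕ.sum h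
  6≤Σdeficit with Fin.any? (λ i → k i ℕ.≟ d)
  ... | yes (i , kᵢ≡d) = ℕ.≤-trans
          (ℕ.≤-reflexive (sym (cong (6 ∸_) (trans (cong (weight d) kᵢ≡d) (weight-full (ℕ.≤-trans (ℕ.n≤1+n 2) 3≤d))))))
          (term≤sum h i)
  ... | no ∄ = ℕ.≤-trans (ℕ.n≤1+n 6) (7≤Σdeficit λ i kᵢ≡d → ∄ (i , kᵢ≡d))

  Σweight≤ : (unsaturated? : Dec (∀ i → k i ≢ d)) →
             Σℕ.sum (λ i → weight d (k i)) + (6 + [ does unsaturated? ]) ≤ r * 6
  Σweight≤ unsaturated? = ℕ.≤-trans (ℕ.+-monoʳ-≤ (Σℕ.sum (λ i → weight d (k i))) (bound unsaturated?))
                            (ℕ.≤-reflexive (weights+deficits d k))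
    where
    bound : (unsaturated? : Dec (∀ i → k i ≢ d)) → 6 + [ does unsaturated? ] ≤ Σℕ.sum h
    bound (yes k≢d) = 7≤Σdeficit k≢d
    bound (no  _)   = 6≤Σdeficit

-- Comparing the trees of all colours

module Counting {n d r₀ : ℕ} (G : Graph n) (regular : Regular d G) (expanding : Expanding G)
  (3≤d : 3 ≤ d) (2≤r : 2 ≤ suc r₀) (8≤n : 8 ≤ n)
  (K : Fin n → Fin n → Fin (suc r₀)) (K-sym : ∀ u w → K u w ≡ K w u) where

  private
    r : ℕ
    r = suc r₀

  κ : Fin r → Fin n → Fin n → Bool
  κ i u w = adj G u w ∧ does (K u w Fin.≟ i)

  κ⊆adj : ∀ i u w → κ i u w ≡ true → adj G u w ≡ true
  κ⊆adj i u w eq with adj G u w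
  ... | true = refl

  κ⇒K : ∀ i u w → κ i u w ≡ true → K u w ≡ i
  κ⇒K i u w eq with adj G u w
  ... | true = does⇒ (K u w Fin.≟ i) eq

  deg : Fin r → Fin n → ℕ
  deg i u = ∣ κ i u ∣

  Σadj : ∀ u → ∣ adj G u ∣ ≡ d
  Σadj u = trans (sym (degree≡sum G u)) (regular u)

  Σdeg : ∀ u → Σℕ.sum (λ i → deg i u) ≡ d
  Σdeg u = begin
    Σℕ.sum (λ i → Σℕ.sum λ w → [ κ i u w ])      ≡⟨ Σℕ.∑-comm (λ i w → [ κ i u w ]) ⟩
    Σℕ.sum (λ w → Σℕ.sum λ i → [ κ i u w ])      ≡⟨ Σℕ.sum-cong-≗ pointwise ⟩
    ∣ adj G u ∣                                  ≡⟨ Σadj u ⟩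
    d                                            ∎
    where
    open ≡-Reasoning
    pointwise : ∀ w → Σℕ.sum (λ i → [ κ i u w ]) ≡ [ adj G u w ]
    pointwise w with adj G u w
    ... | true  = sum-indicator (K u w)
    ... | false = Σℕ.sum-replicate-zero r

  full : Fin r → Fin n → Bool
  full i u = does (deg i u ℕ.≟ d)

  mixed? : ∀ u → Dec (∀ i → deg i u ≢ d)
  mixed? u = Fin.all? λ i → ¬? (deg i u ℕ.≟ d)

  mixed : Fin n → Bool
  mixed u = does (mixed? u)

  totalWeight : Fin r → ℕ
  totalWeight i = Σℕ.sum λ u → weight d (deg i u)

  Σweights : Σℕ.sum totalWeight + (6 * n + ∣ mixed ∣) ≤ 6 * (r * n)
  Σweights = begin
    Σℕ.sum totalWeight + (6 * n + ∣ mixed ∣)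
      ≡⟨ cong₂ (λ a b → a + (b + ∣ mixed ∣)) (Σℕ.∑-comm (λ i u → weight d (deg i u)))
              (trans (ℕ.*-comm 6 n) (sym (sum-const n 6))) ⟩
    Σℕ.sum (λ u → Σℕ.sum λ i → weight d (deg i u)) + (Σℕ.sum {n} (λ _ → 6) + ∣ mixed ∣)
      ≡⟨ cong (Σℕ.sum (λ u → Σℕ.sum λ i → weight d (deg i u)) ℕ.+_) (Σℕ.∑-distrib-+ (λ _ → 6) (λ u → [ mixed u ])) ⟨
    Σℕ.sum (λ u → Σℕ.sum λ i → weight d (deg i u)) + Σℕ.sum (λ u → 6 + [ mixed u ])
      ≡⟨ Σℕ.∑-distrib-+ (λ u → Σℕ.sum λ i → weight d (deg i u)) (λ u → 6 + [ mixed u ]) ⟨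
    Σℕ.sum (λ u → Σℕ.sum (λ i → weight d (deg i u)) + (6 + [ mixed u ]))
      ≤⟨ Σℕ-mono (λ u → Σweight≤ d (λ i → deg i u) 3≤d (Σdeg u) (mixed? u)) ⟩
    Σℕ.sum {n} (λ _ → r * 6)
      ≡⟨ sum-const n (r * 6) ⟩
    n * (r * 6)
      ≡⟨ lemma n r ⟩
    6 * (r * n) ∎
    where
    open ℕ.≤-Reasoning
    lemma : ∀ n r → n * (r * 6) ≡ 6 * (r * n)
    lemma = solve-∀

  full⇒deg≡d : ∀ i u → full i u ≡ true → deg i u ≡ d
  full⇒deg≡d i u = does⇒ (deg i u ℕ.≟ d)

  -- An edge leaving a vertex that is full in colour i has colour i.
  boundary-mixed : ∀ i u w → full i u ≡ true → adj G u w ≡ true → full i w ≡ false → mixed w ≡ true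
  boundary-mixed i u w u-full u~w w-not-full = dec-true (mixed? w) λ j deg≡d →
    let Kuw≡i = κ⇒K i u w (Subgraph.deg≡d⇒adj⊆κ G regular (κ i) (κ⊆adj i) u (full⇒deg≡d i u u-full) w u~w)
        Kwu≡j = κ⇒K j w u (Subgraph.deg≡d⇒adj⊆κ G regular (κ j) (κ⊆adj j) w deg≡d u (trans (symmetric G w u) u~w))
        j≡i = trans (sym Kwu≡j) (trans (K-sym w u) Kuw≡i) in
    true≢false (trans (sym (dec-true (deg i w ℕ.≟ d) (subst (λ l → deg l w ≡ d) j≡i deg≡d))) w-not-full)

  -- Each boundary edge is charged to its outer end, which is mixed by `boundary-mixed`; a mixed
  -- vertex is charged at most d times.
  boundary-full : ∀ i → boundary G (full i) ≤ d * ∣ mixed ∣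
  boundary-full i = begin
    Σℕ.sum (λ u → [ full i u ] * Σℕ.sum λ w → [ adj G u w ] * [ not (full i w) ])
      ≡⟨ Σℕ.sum-cong-≗ (λ u → Σℕ.*-distribˡ-sum [ full i u ] (λ w → [ adj G u w ] * [ not (full i w) ])) ⟩
    Σℕ.sum (λ u → Σℕ.sum λ w → [ full i u ] * ([ adj G u w ] * [ not (full i w) ]))
      ≤⟨ Σℕ-mono (λ u → Σℕ-mono λ w → pointwise u w) ⟩
    Σℕ.sum (λ u → Σℕ.sum λ w → [ adj G w u ] * [ mixed w ])
      ≡⟨ Σℕ.∑-comm (λ u w → [ adj G w u ] * [ mixed w ]) ⟩
    Σℕ.sum (λ w → Σℕ.sum λ u → [ adj G w u ] * [ mixed w ])
      ≡⟨ Σℕ.sum-cong-≗ (λ w → trans (sym (Σℕ.*-distribʳ-sum [ mixed w ] (λ u → [ adj G w u ])))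
              (cong (_* [ mixed w ]) (Σadj w))) ⟩
    Σℕ.sum (λ w → d * [ mixed w ])
      ≡⟨ Σℕ.*-distribˡ-sum d (λ w → [ mixed w ]) ⟨
    d * ∣ mixed ∣ ∎
    where
    open ℕ.≤-Reasoning
    pointwise : ∀ u w → [ full i u ] * ([ adj G u w ] * [ not (full i w) ]) ≤ [ adj G w u ] * [ mixed w ]
    pointwise u w with full i u in fu | adj G u w in uw | full i w in fw
    ... | false | _     | _     = z≤n
    ... | true  | false | _     = z≤n
    ... | true  | true  | true  = z≤n
    ... | true  | true  | false rewrite trans (symmetric G w u) uw | boundary-mixed i u w fu uw fw = ℕ.≤-refl

  -- With s full vertices and t ≥ n/4 others, expansion gives s n ≤ 4 s t ≤ 2 n d ∣mixed∣.
  full≤2d∣mixed∣ : ∀ i → 4 * ∣ full i ∣ ≤ 3 * n → ∣ full i ∣ ≤ 2 * d * ∣ mixed ∣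
  full≤2d∣mixed∣ i 4s≤3n = ℕ.*-cancelʳ-≤ s (2 * d * W) n {{ℕ.>-nonZero (ℕ.≤-trans (s≤s z≤n) 8≤n)}} (begin
    s * n                ≤⟨ ℕ.*-monoʳ-≤ s n≤4t ⟩
    s * (4 * t)          ≡⟨ lemma₁ s t ⟩
    2 * (2 * (s * t))    ≤⟨ ℕ.*-monoʳ-≤ 2 (expanding (full i)) ⟩
    2 * (n * boundary G (full i)) ≤⟨ ℕ.*-monoʳ-≤ 2 (ℕ.*-monoʳ-≤ n (boundary-full i)) ⟩
    2 * (n * (d * W))    ≡⟨ lemma₂ n d W ⟩
    2 * d * W * n        ∎)
    where
    open ℕ.≤-Reasoning
    s = ∣ full i ∣
    t = ∣ not ∘ full i ∣
    W = ∣ mixed ∣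
    lemma₁ : ∀ s t → s * (4 * t) ≡ 2 * (2 * (s * t))
    lemma₁ = solve-∀
    lemma₂ : ∀ n d W → 2 * (n * (d * W)) ≡ 2 * d * W * n
    lemma₂ = solve-∀
    n≤4t : n ≤ 4 * t
    n≤4t = complement-large s t (∣S∣+∣∁S∣≡n (full i)) 4s≤3n

  n≤Σfull+mixed : n ≤ Σℕ.sum (λ i → ∣ full i ∣) + ∣ mixed ∣
  n≤Σfull+mixed = begin
    n                                                          ≡⟨ trans (sym (ℕ.*-identityʳ n)) (sym (sum-const n 1)) ⟩
    Σℕ.sum {n} (λ _ → 1)                                       ≤⟨ Σℕ-mono pointwise ⟩
    Σℕ.sum (λ u → Σℕ.sum (λ i → [ full i u ]) + [ mixed u ])
      ≡⟨ Σℕ.∑-distrib-+ (λ u → Σℕ.sum (λ i → [ full i u ])) (λ u → [ mixed u ]) ⟩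
    Σℕ.sum (λ u → Σℕ.sum λ i → [ full i u ]) + ∣ mixed ∣
      ≡⟨ cong (_+ ∣ mixed ∣) (Σℕ.∑-comm (λ u i → [ full i u ])) ⟩
    Σℕ.sum (λ i → ∣ full i ∣) + ∣ mixed ∣                      ∎
    where
    open ℕ.≤-Reasoning
    pointwise : ∀ u → 1 ≤ Σℕ.sum (λ i → [ full i u ]) + [ mixed u ]
    pointwise u with Fin.any? (λ i → deg i u ℕ.≟ d)
    ... | yes (i , deg≡d) = ℕ.≤-trans (ℕ.≤-trans (ℕ.≤-reflexive (cong [_] (sym (dec-true (deg i u ℕ.≟ d) deg≡d))))
              (term≤sum (λ i → [ full i u ]) i)) (ℕ.m≤m+n _ _)
    ... | no ∄ = ℕ.≤-trans (ℕ.≤-reflexive (cong [_] (sym (dec-true (mixed? u) λ i deg≡d → ∄ (i , deg≡d)))))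
              (ℕ.m≤n+m _ _)

  -- The two outcomes of growing a spanning tree along colour i first, cnt being the number of
  -- edges of colour i that it uses.
  Adequate : Fin r → ℕ → Set
  Adequate i cnt = 3 * n ≤ 4 * cnt + 4 ⊎ 6 * n ≤ 6 * cnt + totalWeight i

  -- If no colour is full at more than 3n/4 vertices, then n ≤ c ∣mixed∣: each of the r colours is
  -- full at no more than 2d ∣mixed∣ vertices. A mixed vertex gains one sixth of an edge, hence
  -- `q = 6 * c`.
  c q : ℕ
  c = 1 + 2 * (d * r)
  q = 6 * c

  -- That is, r · cnt ≥ (1 + 1/q) n, which makes the discrepancy of the tree at least n / q.
  Abundant : ℕ → Set
  Abundant cnt = q * n + n ≤ q * (r * cnt)

  -- The assumption n ≥ 8 absorbs the additive loss: 6n ≤ 8 cnt + 8 ≤ 8 cnt + n. Hence r · cnt ≥ 2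
  -- cnt ≥ (1 + 1/4) n, and q ≥ 4.
  large⇒abundant : ∀ {cnt} → 3 * n ≤ 4 * cnt + 4 → Abundant cnt
  large⇒abundant {cnt} 3n≤ = ℕ.*-cancelˡ-≤ 4 (begin
    4 * (q * n + n)          ≡⟨ lemma₁ q n ⟩
    q * (4 * n) + 4 * n
      ≤⟨ ℕ.+-monoʳ-≤ (q * (4 * n)) (ℕ.*-monoˡ-≤ n (ℕ.≤-trans (ℕ.m≤m+n 4 2) (ℕ.*-monoʳ-≤ 6 {1} {c} (s≤s z≤n)))) ⟩
    q * (4 * n) + q * n      ≡⟨ lemma₂ q n ⟩
    q * (5 * n)              ≤⟨ ℕ.*-monoʳ-≤ q 5n≤8cnt ⟩
    q * (2 * (4 * cnt))      ≤⟨ ℕ.*-monoʳ-≤ q (ℕ.*-monoˡ-≤ (4 * cnt) 2≤r) ⟩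
    q * (r * (4 * cnt))      ≡⟨ lemma₃ q r cnt ⟩
    4 * (q * (r * cnt))      ∎)
    where
    open ℕ.≤-Reasoning
    lemma₁ : ∀ q n → 4 * (q * n + n) ≡ q * (4 * n) + 4 * n
    lemma₁ = solve-∀
    lemma₂ : ∀ q n → q * (4 * n) + q * n ≡ q * (5 * n)
    lemma₂ = solve-∀
    lemma₃ : ∀ q r k → q * (r * (4 * k)) ≡ 4 * (q * (r * k))
    lemma₃ = solve-∀
    lemma₄ : ∀ n → 5 * n + n ≡ 2 * (3 * n)
    lemma₄ = solve-∀
    lemma₅ : ∀ k → 2 * (4 * k + 4) ≡ 2 * (4 * k) + 8
    lemma₅ = solve-∀
    5n≤8cnt : 5 * n ≤ 2 * (4 * cnt)
    5n≤8cnt = ℕ.+-cancelʳ-≤ 8 (5 * n) (2 * (4 * cnt)) (begin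
      5 * n + 8              ≤⟨ ℕ.+-monoʳ-≤ (5 * n) 8≤n ⟩
      5 * n + n              ≡⟨ lemma₄ n ⟩
      2 * (3 * n)            ≤⟨ ℕ.*-monoʳ-≤ 2 3n≤ ⟩
      2 * (4 * cnt + 4)      ≡⟨ lemma₅ cnt ⟩
      2 * (4 * cnt) + 8      ∎)

  totalWeight+6∣full∣≤6n : ∀ i → totalWeight i + 6 * ∣ full i ∣ ≤ 6 * n
  totalWeight+6∣full∣≤6n i = begin
    totalWeight i + 6 * ∣ full i ∣
      ≡⟨ cong (totalWeight i ℕ.+_) (Σℕ.*-distribˡ-sum 6 (λ u → [ full i u ])) ⟩
    totalWeight i + Σℕ.sum (λ u → 6 * [ full i u ])
      ≡⟨ Σℕ.∑-distrib-+ (λ u → weight d (deg i u)) (λ u → 6 * [ full i u ]) ⟨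
    Σℕ.sum (λ u → weight d (deg i u) + 6 * [ full i u ])       ≤⟨ Σℕ-mono pointwise ⟩
    Σℕ.sum {n} (λ _ → 6)                                       ≡⟨ trans (sum-const n 6) (ℕ.*-comm n 6) ⟩
    6 * n                                                      ∎
    where
    open ℕ.≤-Reasoning
    bound : ∀ {k} (k≟d : Dec (k ≡ d)) → weight d k + 6 * [ does k≟d ] ≤ 6
    bound (yes refl) = ℕ.≤-reflexive (cong (_+ 6) (weight-full (ℕ.≤-trans (ℕ.n≤1+n 2) 3≤d)))
    bound {k} (no _) = ℕ.≤-trans (ℕ.≤-reflexive (ℕ.+-identityʳ (weight d k))) (weight≤6 d k)
    pointwise : ∀ u → weight d (deg i u) + 6 * [ full i u ] ≤ 6
    pointwise u = bound (deg i u ℕ.≟ d)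

  -- A full vertex weighs 0 instead of up to 6, so the weight bound says that the tree has at least
  -- as many edges of colour i as there are vertices full in i.
  many-full⇒abundant : ∀ i {cnt} → 3 * n < 4 * ∣ full i ∣ → 6 * n ≤ 6 * cnt + totalWeight i → Abundant cnt
  many-full⇒abundant i {cnt} 3n<4∣full∣ 6n≤ = large⇒abundant {cnt} (begin
    3 * n            ≤⟨ ℕ.<⇒≤ 3n<4∣full∣ ⟩
    4 * ∣ full i ∣
      ≤⟨ ℕ.*-monoʳ-≤ 4 (ℕ.*-cancelˡ-≤ {∣ full i ∣} {cnt} 6 (ℕ.+-cancelˡ-≤ (totalWeight i) (6 * ∣ full i ∣) (6 * cnt)
                        (ℕ.≤-trans (totalWeight+6∣full∣≤6n i) (ℕ.≤-trans 6n≤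
                                (ℕ.≤-reflexive (ℕ.+-comm (6 * cnt) (totalWeight i))))))) ⟩
    4 * cnt          ≤⟨ ℕ.m≤m+n (4 * cnt) 4 ⟩
    4 * cnt + 4      ∎)
    where open ℕ.≤-Reasoning

  -- Adding up the weight bounds for all colours and inserting `Σweights` gives 6 Σ cnt ≥ 6n +
  -- ∣mixed∣. Since n ≤ c ∣mixed∣, the trees together have at least (1 + 1/q) n edges of their own
  -- colours, and some colour attains the average.
  few-full⇒abundant : (∀ i → 4 * ∣ full i ∣ ≤ 3 * n) → (cnt : Fin r → ℕ) →
                      (∀ i → 6 * n ≤ 6 * cnt i + totalWeight i) → ∃[ i ] Abundant (cnt i)
  few-full⇒abundant few cnt 6n≤ = let i , Σcnt≤ = average≤max cnt in i , (begin
    q * n + n                         ≤⟨ ℕ.+-monoʳ-≤ (q * n) n≤cW ⟩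
    q * n + c * W                     ≡⟨ lemma₁ c n W ⟩
    c * (6 * n + W)                   ≤⟨ ℕ.*-monoʳ-≤ c 6n+W≤ ⟩
    c * (6 * Σℕ.sum cnt)              ≡⟨ lemma₂ c (Σℕ.sum cnt) ⟩
    q * Σℕ.sum cnt                    ≤⟨ ℕ.*-monoʳ-≤ q Σcnt≤ ⟩
    q * (r * cnt i)                   ∎)
    where
    open ℕ.≤-Reasoning
    W = ∣ mixed ∣
    lemma₁ : ∀ c n W → 6 * c * n + c * W ≡ c * (6 * n + W)
    lemma₁ = solve-∀
    lemma₂ : ∀ c s → c * (6 * s) ≡ 6 * c * s
    lemma₂ = solve-∀
    lemma₃ : ∀ d r W → r * (2 * d * W) + W ≡ (1 + 2 * (d * r)) * W
    lemma₃ = solve-∀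
    lemma₄ : ∀ r n → 6 * (r * n) ≡ r * (6 * n)
    lemma₄ = solve-∀
    n≤cW : n ≤ c * W
    n≤cW = begin
      n                                                ≤⟨ n≤Σfull+mixed ⟩
      Σℕ.sum (λ i → ∣ full i ∣) + W                    ≤⟨ ℕ.+-monoˡ-≤ W (Σℕ-mono λ i → full≤2d∣mixed∣ i (few i)) ⟩
      Σℕ.sum {r} (λ _ → 2 * d * W) + W                 ≡⟨ cong (_+ W) (sum-const r (2 * d * W)) ⟩
      r * (2 * d * W) + W                              ≡⟨ lemma₃ d r W ⟩
      c * W                                            ∎
    6n+W≤ : 6 * n + W ≤ 6 * Σℕ.sum cnt
    6n+W≤ = ℕ.+-cancelˡ-≤ (Σℕ.sum totalWeight) (6 * n + W) (6 * Σℕ.sum cnt) (begin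
      Σℕ.sum totalWeight + (6 * n + W)                 ≤⟨ Σweights ⟩
      6 * (r * n)                                      ≡⟨ trans (lemma₄ r n) (sym (sum-const r (6 * n))) ⟩
      Σℕ.sum {r} (λ _ → 6 * n)                         ≤⟨ Σℕ-mono 6n≤ ⟩
      Σℕ.sum (λ i → 6 * cnt i + totalWeight i)         ≡⟨ Σℕ.∑-distrib-+ (λ i → 6 * cnt i) totalWeight ⟩
      Σℕ.sum (λ i → 6 * cnt i) + Σℕ.sum totalWeight    ≡⟨ cong (_+ Σℕ.sum totalWeight) (Σℕ.*-distribˡ-sum 6 cnt) ⟨
      6 * Σℕ.sum cnt + Σℕ.sum totalWeight              ≡⟨ ℕ.+-comm (6 * Σℕ.sum cnt) (Σℕ.sum totalWeight) ⟩
      Σℕ.sum totalWeight + 6 * Σℕ.sum cnt              ∎)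

  some-abundant : (cnt : Fin r → ℕ) → (∀ i → Adequate i (cnt i)) → ∃[ i ] Abundant (cnt i)
  some-abundant cnt adequate with Fin.any? (λ i → 3 * n ℕ.≤? 4 * cnt i + 4)
  ... | yes (i , 3n≤) = i , large⇒abundant {cnt i} 3n≤
  ... | no ∄ = by-weight λ i → [ (λ 3n≤ → ⊥-elim (∄ (i , 3n≤))) , id ]′ (adequate i)
    where
    by-weight : (∀ i → 6 * n ≤ 6 * cnt i + totalWeight i) → ∃[ i ] Abundant (cnt i)
    by-weight 6n≤ with Fin.any? (λ i → suc (3 * n) ℕ.≤? 4 * ∣ full i ∣)
    ... | yes (i , 3n<) = i , many-full⇒abundant i {cnt i} 3n< (6n≤ i)
    ... | no ∄full = few-full⇒abundant (λ i → ℕ.≮⇒≥ λ 3n< → ∄full (i , 3n<)) cnt 6n≤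

-- Growing spanning trees

sum-update : ∀ {n} (f g : Fin n → ℕ) w → (∀ v → w ≢ v → g v ≡ f v) → Σℕ.sum g + f w ≡ Σℕ.sum f + g w
sum-update {suc n} f g zero agree = begin
  g zero + Σℕ.sum (g ∘ suc) + f zero   ≡⟨ cong (λ z → g zero + z + f zero) (Σℕ.sum-cong-≗ λ v → agree (suc v) λ ()) ⟩
  g zero + Σℕ.sum (f ∘ suc) + f zero   ≡⟨ lemma (g zero) (Σℕ.sum (f ∘ suc)) (f zero) ⟩
  f zero + Σℕ.sum (f ∘ suc) + g zero   ∎
  where
  open ≡-Reasoning
  lemma : ∀ a b c → a + b + c ≡ c + b + a
  lemma = solve-∀
sum-update {suc n} f g (suc w) agree = begin
  g zero + Σℕ.sum (g ∘ suc) + f (suc w)    ≡⟨ ℕ.+-assoc (g zero) _ _ ⟩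
  g zero + (Σℕ.sum (g ∘ suc) + f (suc w))
    ≡⟨ cong₂ _+_ (agree zero λ ()) (sum-update (f ∘ suc) (g ∘ suc) w λ v w≢v → agree (suc v)
            (w≢v ∘ Fin.suc-injective)) ⟩
  f zero + (Σℕ.sum (f ∘ suc) + g (suc w))  ≡⟨ ℕ.+-assoc (f zero) _ _ ⟨
  f zero + Σℕ.sum (f ∘ suc) + g (suc w)    ∎
  where open ≡-Reasoning

-- A spanning tree of H, encoded by parent pointers; time orders the vertices by insertion.
record Rooted {n} (H : Graph n) : Set where
  field
    root           : Fin n
    parent         : Fin n → Fin n
    time           : Fin n → ℕ
    parent-root    : parent root ≡ root
    parent-adj     : ∀ v → v ≢ root → adj H v (parent v) ≡ true
    parent-earlier : ∀ v → v ≢ root → time (parent v) < time v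

  count : (Fin n → Fin n → Bool) → ℕ
  count κ = Σℕ.sum λ v → [ κ v (parent v) ]

-- A certificate of disconnectedness, returned when no vertex can be attached any more. It is
-- refuted by expansion for `G` itself and by connectedness for the graph that codes a tree.
record Separated {n} (H : Graph n) : Set where
  field
    X              : Fin n → Bool
    closed         : Closed (adj H) X
    inside outside : Fin n
    inside∈X       : X inside ≡ true
    outside∉X      : X outside ≡ false

module Growth {n : ℕ} (H : Graph n) (κ : Fin n → Fin n → Bool)
  (κ⊆adj : ∀ u w → κ u w ≡ true → adj H u w ≡ true) (κ-sym : ∀ u w → κ u w ≡ κ w u)
  (weight : Fin n → ℕ)
  (block-weight : ∀ C → Closed κ C → ∀ v → C v ≡ true → 4 * ∣ C ∣ ≤ 3 * n → 6 ≤ Σℕ.sum λ u → [ C u ] * weight u)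
  (root : Fin n) where

  record Partial (k : ℕ) : Set where
    field
      X           : Fin n → Bool
      parent      : Fin n → Fin n
      time        : Fin n → ℕ
      root∈X      : X root ≡ true
      parent-root : parent root ≡ root
      size        : ∣ X ∣ ≡ k
      time<k      : ∀ v → X v ≡ true → time v < k
      parent∈X    : ∀ v → X v ≡ true → v ≢ root → X (parent v) ≡ true
      parent-adj  : ∀ v → X v ≡ true → v ≢ root → adj H v (parent v) ≡ true
      earlier     : ∀ v → X v ≡ true → v ≢ root → time (parent v) < time v

    count : ℕ
    count = Σℕ.sum λ v → [ X v ] * [ κ v (parent v) ]

  open Partial

  module _ {k : ℕ} (P : Partial k) (u w : Fin n) (u∈X : X P u ≡ true) (w∉X : X P w ≡ false)
          (w~u : adj H w u ≡ true) where

    private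
      update : ∀ {A : Set} → (Fin n → A) → A → Fin n → A
      update f a v = if does (w Fin.≟ v) then a else f v

      X⇒≢w : ∀ v → X P v ≡ true → w ≢ v
      X⇒≢w v v∈X refl with () ← trans (sym v∈X) w∉X

      update-w : ∀ {A : Set} (f : Fin n → A) a → update f a w ≡ a
      update-w f a rewrite dec-true (w Fin.≟ w) refl = refl

      update-≢ : ∀ {A : Set} (f : Fin n → A) a v → w ≢ v → update f a v ≡ f v
      update-≢ f a v w≢v rewrite dec-false (w Fin.≟ v) w≢v = refl

      update-X : ∀ {A : Set} (f : Fin n → A) a v → X P v ≡ true → update f a v ≡ f v
      update-X f a v v∈X = update-≢ f a v (X⇒≢w v v∈X)

      X′ : Fin n → Bool
      X′ = update (X P) true

      X⇒X′ : ∀ v → X P v ≡ true → X′ v ≡ true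
      X⇒X′ v v∈X = trans (update-X (X P) true v v∈X) v∈X

      ∣X′∣ : ∣ X′ ∣ ≡ suc k
      ∣X′∣ = begin
        ∣ X′ ∣                   ≡⟨ ℕ.+-identityʳ ∣ X′ ∣ ⟨
        ∣ X′ ∣ + 0               ≡⟨ cong (λ b → ∣ X′ ∣ + [ b ]) w∉X ⟨
        ∣ X′ ∣ + [ X P w ]
          ≡⟨ sum-update (λ v → [ X P v ]) (λ v → [ X′ v ]) w (λ v w≢v → cong [_] (update-≢ (X P) true v w≢v)) ⟩
        ∣ X P ∣ + [ X′ w ]       ≡⟨ cong₂ (λ s b → s + [ b ]) (size P) (update-w (X P) true) ⟩
        k + 1                    ≡⟨ ℕ.+-comm k 1 ⟩
        suc k                    ∎
        where open ≡-Reasoning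

      X′-elim : ∀ v → X′ v ≡ true → w ≡ v ⊎ (w ≢ v × X P v ≡ true)
      X′-elim v v∈X′ with w Fin.≟ v
      ... | yes w≡v = inj₁ w≡v
      ... | no  w≢v = inj₂ (w≢v , v∈X′)

    extend : Partial (suc k)
    extend = record
      { X = X′
      ; parent = parent′
      ; time = time′
      ; root∈X = X⇒X′ root (root∈X P)
      ; parent-root = trans (update-X (parent P) u root (root∈X P)) (parent-root P)
      ; size = ∣X′∣
      ; time<k = λ v v∈X′ → time-case v (X′-elim v v∈X′)
      ; parent∈X = λ v v∈X′ v≢root → parent∈X-case v v≢root (X′-elim v v∈X′)
      ; parent-adj = λ v v∈X′ v≢root → adj-case v v≢root (X′-elim v v∈X′)
      ; earlier = λ v v∈X′ v≢root → earlier-case v v≢root (X′-elim v v∈X′) }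
      where
      parent′ = update (parent P) u
      -- All earlier time stamps are below k, the number of vertices inserted so far, so the parent
      -- of `w` precedes `w`.
      time′ = update (time P) k
      time-case : ∀ v → w ≡ v ⊎ (w ≢ v × X P v ≡ true) → time′ v < suc k
      time-case v (inj₁ refl) = s≤s (ℕ.≤-reflexive (update-w (time P) k))
      time-case v (inj₂ (w≢v , v∈X)) = subst (_< suc k) (sym (update-≢ (time P) k v w≢v)) (ℕ.m<n⇒m<1+n (time<k P v v∈X))
      parent∈X-case : ∀ v → v ≢ root → w ≡ v ⊎ (w ≢ v × X P v ≡ true) → X′ (parent′ v) ≡ true
      parent∈X-case v v≢root (inj₁ refl) = trans (cong X′ (update-w (parent P) u)) (X⇒X′ u u∈X)
      parent∈X-case v v≢root (inj₂ (w≢v , v∈X)) =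
        trans (cong X′ (update-≢ (parent P) u v w≢v)) (X⇒X′ (parent P v) (parent∈X P v v∈X v≢root))
      adj-case : ∀ v → v ≢ root → w ≡ v ⊎ (w ≢ v × X P v ≡ true) → adj H v (parent′ v) ≡ true
      adj-case v v≢root (inj₁ refl) = trans (cong (adj H w) (update-w (parent P) u)) w~u
      adj-case v v≢root (inj₂ (w≢v , v∈X)) = trans (cong (adj H v) (update-≢ (parent P) u v w≢v))
              (parent-adj P v v∈X v≢root)
      earlier-case : ∀ v → v ≢ root → w ≡ v ⊎ (w ≢ v × X P v ≡ true) → time′ (parent′ v) < time′ v
      earlier-case v v≢root (inj₁ refl) = subst₂ _<_
        (sym (trans (cong time′ (update-w (parent P) u)) (update-X (time P) k u u∈X))) (sym (update-w (time P) k))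
                (time<k P u u∈X)
      earlier-case v v≢root (inj₂ (w≢v , v∈X)) = subst₂ _<_
        (sym (trans (cong time′ (update-≢ (parent P) u v w≢v))
                (update-X (time P) k (parent P v) (parent∈X P v v∈X v≢root))))
        (sym (update-≢ (time P) k v w≢v)) (earlier P v v∈X v≢root)

    X⊆X-extend : ∀ v → X P v ≡ true → X extend v ≡ true
    X⊆X-extend = X⇒X′

    w∈X-extend : X extend w ≡ true
    w∈X-extend = update-w (X P) true

    count-extend : count extend ≡ count P + [ κ w u ]
    count-extend = begin
      count extend                                     ≡⟨ ℕ.+-identityʳ (count extend) ⟨
      count extend + 0                                 ≡⟨ cong (λ b → count extend + [ b ] * [ κ w (parent P w) ]) w∉X ⟨
      count extend + [ X P w ] * [ κ w (parent P w) ]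
        ≡⟨ sum-update (λ v → [ X P v ] * [ κ v (parent P v) ]) (λ v → [ X extend v ] * [ κ v (parent extend v) ]) w
             (λ v w≢v → cong₂ (λ b p → [ b ] * [ κ v p ]) (update-≢ (X P) true v w≢v) (update-≢ (parent P) u v w≢v)) ⟩
      count P + [ X extend w ] * [ κ w (parent extend w) ]
        ≡⟨ cong₂ (λ b p → count P + [ b ] * [ κ w p ]) w∈X-extend (update-w (parent P) u) ⟩
      count P + ([ κ w u ] + 0)                        ≡⟨ cong (count P ℕ.+_) (ℕ.+-identityʳ [ κ w u ]) ⟩
      count P + [ κ w u ]                              ∎
      where open ≡-Reasoning

  weightOf : (Fin n → Bool) → ℕ
  weightOf S = Σℕ.sum λ u → [ S u ] * weight u

  -- X is Y, a union of closed blocks, together with the block under construction.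
  record Blocks {k} (P : Partial k) : Set where
    field
      Y           : Fin n → Bool
      blocks      : ℕ
      Y⊆X         : ∀ v → Y v ≡ true → X P v ≡ true
      Y-closed    : Closed κ Y
      current     : Fin n
      current∈X   : X P current ≡ true
      current∉Y   : Y current ≡ false
      -- Of the k - 1 edges, one per finished block lies outside `κ`, namely the edge that started
      -- the block after it. The `suc` is the current block.
      counted     : count P + suc blocks ≡ k
      -- As X has `count P + 1 + blocks` vertices, this leaves at most `count P + 1` of them for the
      -- current block.
      blocks≤∣Y∣  : blocks ≤ ∣ Y ∣
      heavy       : 3 * n ≤ 4 * count P + 4 ⊎ 6 * blocks ≤ weightOf Y

  open Blocks

  Heavy : ∀ {k} → Partial k → ℕ → Set
  Heavy P b = 3 * n ≤ 4 * count P + 4 ⊎ 6 * b ≤ weightOf (X P)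

  module _ {k : ℕ} (P : Partial k) (Q : Blocks P) (X-closed : Closed κ (X P)) where

    private
      B : Fin n → Bool
      B v = X P v ∧ not (Y Q v)

      B+Y : ∀ v → [ B v ] + [ Y Q v ] ≡ [ X P v ]
      B+Y v with X P v in Xv | Y Q v in Yv
      ... | true  | true  = refl
      ... | true  | false = refl
      ... | false | false = refl
      ... | false | true  with () ← trans (sym Xv) (Y⊆X Q v Yv)

      B-elim : ∀ v → B v ≡ true → X P v ≡ true × Y Q v ≡ false
      B-elim v v∈B with X P v | Y Q v
      ... | true | false = refl , refl

      B-intro : ∀ {v} → X P v ≡ true → Y Q v ≡ false → B v ≡ true
      B-intro v∈X v∉Y rewrite v∈X | v∉Y = refl

      B-closed : Closed κ B
      B-closed u w u∈B u~w = B-intro (X-closed u w (proj₁ (B-elim u u∈B)) u~w) (Bool.¬-not λ w∈Y →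
        true≢false (trans (sym (Y-closed Q w u w∈Y (trans (κ-sym w u) u~w))) (proj₂ (B-elim u u∈B))))

      ∣B∣≤ : ∣ B ∣ ≤ count P + 1
      ∣B∣≤ = ℕ.+-cancelʳ-≤ (blocks Q) ∣ B ∣ (count P + 1) (begin
        ∣ B ∣ + blocks Q                         ≤⟨ ℕ.+-monoʳ-≤ ∣ B ∣ (blocks≤∣Y∣ Q) ⟩
        ∣ B ∣ + ∣ Y Q ∣                          ≡⟨ Σℕ.∑-distrib-+ (λ v → [ B v ]) (λ v → [ Y Q v ]) ⟨
        Σℕ.sum (λ v → [ B v ] + [ Y Q v ])       ≡⟨ Σℕ.sum-cong-≗ B+Y ⟩
        ∣ X P ∣                                  ≡⟨ trans (size P) (sym (counted Q)) ⟩
        count P + (1 + blocks Q)                 ≡⟨ ℕ.+-assoc (count P) 1 (blocks Q) ⟨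
        count P + 1 + blocks Q                   ∎)
        where open ℕ.≤-Reasoning

    -- The current block is X without Y, closed because X and Y are and `κ` is symmetric. Up to 3n/4
    -- vertices it contributes weight 6. A larger one proves by its mere size that about 3n/4 edges
    -- of `κ` have been used, and this alternative persists as the tree grows.
    close-block : Heavy P (suc (blocks Q))
    close-block with heavy Q | 4 * ∣ B ∣ ℕ.≤? 3 * n
    ... | inj₁ large | _         = inj₁ large
    ... | inj₂ 6b≤   | yes small = inj₂ (begin
      6 * suc (blocks Q)                                   ≡⟨ ℕ.*-suc 6 (blocks Q) ⟩
      6 + 6 * blocks Q
        ≤⟨ ℕ.+-mono-≤ (block-weight B B-closed (current Q) (B-intro (current∈X Q) (current∉Y Q)) small) 6b≤ ⟩
      weightOf B + weightOf (Y Q)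
        ≡⟨ Σℕ.∑-distrib-+ (λ u → [ B u ] * weight u) (λ u → [ Y Q u ] * weight u) ⟨
      Σℕ.sum (λ u → [ B u ] * weight u + [ Y Q u ] * weight u)
        ≡⟨ Σℕ.sum-cong-≗ (λ u → trans (sym (ℕ.*-distribʳ-+ (weight u) [ B u ] [ Y Q u ]))
                (cong (_* weight u) (B+Y u))) ⟩
      weightOf (X P)                                       ∎)
      where open ℕ.≤-Reasoning
    ... | inj₂ _     | no  big   = inj₁ (begin
      3 * n                    ≤⟨ ℕ.<⇒≤ (ℕ.≰⇒> big) ⟩
      4 * ∣ B ∣                ≤⟨ ℕ.*-monoʳ-≤ 4 ∣B∣≤ ⟩
      4 * (count P + 1)        ≡⟨ ℕ.*-distribˡ-+ 4 (count P) 1 ⟩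
      4 * count P + 4          ∎)
      where open ℕ.≤-Reasoning

  module _ {k : ℕ} (P : Partial k) (Q : Blocks P) (u w : Fin n)
           (u∈X : X P u ≡ true) (w∉X : X P w ≡ false) (w~u : adj H w u ≡ true) where

    private
      P′ = extend P u w u∈X w∉X w~u

    continue-block : κ w u ≡ true → Blocks P′
    continue-block κwu = record
      { Y = Y Q
      ; blocks = blocks Q
      ; Y⊆X = λ v v∈Y → X⊆X-extend P u w u∈X w∉X w~u v (Y⊆X Q v v∈Y)
      ; Y-closed = Y-closed Q
      ; current = current Q
      ; current∈X = X⊆X-extend P u w u∈X w∉X w~u (current Q) (current∈X Q)
      ; current∉Y = current∉Y Q
      ; counted = trans (cong (_+ suc (blocks Q)) count′) (cong suc (counted Q))
      ; blocks≤∣Y∣ = blocks≤∣Y∣ Q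
      ; heavy = increase (heavy Q) }
      where
      count′ : count P′ ≡ suc (count P)
      count′ = trans (count-extend P u w u∈X w∉X w~u) (trans (cong (λ b → count P + [ b ]) κwu) (ℕ.+-comm (count P) 1))
      increase : 3 * n ≤ 4 * count P + 4 ⊎ 6 * blocks Q ≤ weightOf (Y Q) → 3 * n ≤ 4 * count P′ + 4 ⊎ 6 * blocks Q
              ≤ weightOf (Y Q)
      increase (inj₁ large) = inj₁ (ℕ.≤-trans large
              (ℕ.+-monoˡ-≤ 4 (ℕ.*-monoʳ-≤ 4 (ℕ.≤-trans (ℕ.n≤1+n (count P)) (ℕ.≤-reflexive (sym count′))))))
      increase (inj₂ 6b≤) = inj₂ 6b≤

    -- When X is closed, the current block is complete and can join Y. The edge to `w` leaves a
    -- closed set, so it is not in `κ` and `count` does not change.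
    new-block : Closed κ (X P) → Blocks P′
    new-block X-closed = record
      { Y = X P
      ; blocks = suc (blocks Q)
      ; Y⊆X = X⊆X-extend P u w u∈X w∉X w~u
      ; Y-closed = X-closed
      ; current = w
      ; current∈X = w∈X-extend P u w u∈X w∉X w~u
      ; current∉Y = w∉X
      ; counted = trans (cong (_+ suc (suc (blocks Q))) count′)
              (trans (ℕ.+-suc (count P) (suc (blocks Q))) (cong suc (counted Q)))
      ; blocks≤∣Y∣ = ℕ.≤-trans (ℕ.m≤n+m (suc (blocks Q)) (count P)) (ℕ.≤-reflexive (trans (counted Q) (sym (size P))))
      ; heavy = subst (λ c → 3 * n ≤ 4 * c + 4 ⊎ 6 * suc (blocks Q) ≤ weightOf (X P)) (sym count′)
              (close-block P Q X-closed) }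
      where
      κwu≡false : κ w u ≡ false
      κwu≡false = Bool.¬-not λ κwu → true≢false (trans (sym (X-closed u w u∈X (trans (κ-sym u w) κwu))) w∉X)
      count′ : count P′ ≡ count P
      count′ = trans (count-extend P u w u∈X w∉X w~u)
              (trans (cong (λ b → count P + [ b ]) κwu≡false) (ℕ.+-identityʳ (count P)))

  record Grown : Set where
    field
      tree : Rooted H
      adequate : 3 * n ≤ 4 * Rooted.count tree κ + 4 ⊎ 6 * n ≤ 6 * Rooted.count tree κ + Σℕ.sum weight

  -- All vertices are in X, since X has n of them; so X is closed and the last block can be
  -- completed too. Now `counted` says that n is `count` plus the number of all blocks, and six
  -- times that number is at most the total weight.
  finish : (P : Partial n) → Blocks P → Grown
  finish P Q = record
    { tree = record
      { root = root
      ; parent = parent P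
      ; time = time P
      ; parent-root = parent-root P
      ; parent-adj = λ v → parent-adj P v (all v)
      ; parent-earlier = λ v → earlier P v (all v) }
    ; adequate = adequate (close-block P Q λ u w _ _ → all w) }
    where
    all : ∀ v → X P v ≡ true
    all v with X P v | Σℕ-sandwich {f = λ u → [ X P u ]} {g = λ _ → 1} (λ u → [b]≤1 (X P u))
                 (ℕ.≤-reflexive (trans (sum-const n 1) (trans (ℕ.*-identityʳ n) (sym (size P))))) v
      where
      [b]≤1 : ∀ b → [ b ] ≤ 1
      [b]≤1 true  = ℕ.≤-refl
      [b]≤1 false = z≤n
    ... | true | _ = refl
    count≡ : count P ≡ Σℕ.sum (λ v → [ κ v (parent P v) ])
    count≡ = Σℕ.sum-cong-≗ λ v → trans (cong (λ b → [ b ] * [ κ v (parent P v) ]) (all v)) (ℕ.*-identityˡ _)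
    weight≡ : weightOf (X P) ≡ Σℕ.sum weight
    weight≡ = Σℕ.sum-cong-≗ λ v → trans (cong (λ b → [ b ] * weight v) (all v)) (ℕ.*-identityˡ _)
    adequate : Heavy P (suc (blocks Q)) →
      3 * n ≤ 4 * Σℕ.sum (λ v → [ κ v (parent P v) ]) + 4 ⊎ 6 * n ≤ 6 * Σℕ.sum
              (λ v → [ κ v (parent P v) ]) + Σℕ.sum weight
    adequate (inj₁ large) = inj₁ (subst (λ c → 3 * n ≤ 4 * c + 4) count≡ large)
    adequate (inj₂ 6b≤)   = inj₂ (begin
      6 * n                                   ≡⟨ cong (6 *_) (counted Q) ⟨
      6 * (count P + suc (blocks Q))          ≡⟨ ℕ.*-distribˡ-+ 6 (count P) (suc (blocks Q)) ⟩
      6 * count P + 6 * suc (blocks Q)        ≤⟨ ℕ.+-monoʳ-≤ (6 * count P) 6b≤ ⟩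
      6 * count P + weightOf (X P)            ≡⟨ cong₂ (λ c t → 6 * c + t) count≡ weight≡ ⟩
      6 * Σℕ.sum (λ v → [ κ v (parent P v) ]) + Σℕ.sum weight ∎)
      where open ℕ.≤-Reasoning

  -- Edges of κ leaving X are used as long as there are any; only then a new block is started.
  grow : ∀ j {k} → j + k ≡ n → (P : Partial k) → Blocks P → Separated H ⊎ Grown
  grow zero    refl P Q = inj₂ (finish P Q)
  grow (suc j) {k} eq P Q with search κ
    where
    search : ∀ (ρ : Fin n → Fin n → Bool) → Dec (∃[ u ] X P u ≡ true × ∃[ w ] X P w ≡ false × ρ u w ≡ true)
    search ρ = Fin.any? λ u → X P u Bool.≟ true ×-dec Fin.any? λ w → X P w Bool.≟ false ×-dec ρ u w Bool.≟ true
  ... | yes (u , u∈X , w , w∉X , κuw) =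
    grow j (trans (ℕ.+-suc j k) eq) (extend P u w u∈X w∉X w~u)
      (continue-block P Q u w u∈X w∉X w~u (trans (κ-sym w u) κuw))
    where w~u = κ⊆adj w u (trans (κ-sym w u) κuw)
  ... | no ∄κ with search (adj H)
    where
    search : ∀ (ρ : Fin n → Fin n → Bool) → Dec (∃[ u ] X P u ≡ true × ∃[ w ] X P w ≡ false × ρ u w ≡ true)
    search ρ = Fin.any? λ u → X P u Bool.≟ true ×-dec Fin.any? λ w → X P w Bool.≟ false ×-dec ρ u w Bool.≟ true
  ... | yes (u , u∈X , w , w∉X , u~w) =
    grow j (trans (ℕ.+-suc j k) eq) (extend P u w u∈X w∉X w~u)
      (new-block P Q u w u∈X w∉X w~u λ u w u∈X κuw → Bool.¬-not λ w∉X → ∄κ (u , u∈X , w , w∉X , κuw))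
    where w~u = trans (symmetric H w u) u~w
  ... | no ∄ = inj₁ (record
    { X = X P
    ; closed = λ u w u∈X u~w → Bool.¬-not λ w∉X → ∄ (u , u∈X , w , w∉X , u~w)
    ; inside = root
    ; outside = proj₁ outside
    ; inside∈X = root∈X P
    ; outside∉X = proj₂ outside })
    where
    outside : ∃[ v ] X P v ≡ false
    outside with Fin.any? (λ v → X P v Bool.≟ false)
    ... | yes v = v
    ... | no ∄v = ⊥-elim (ℕ.<-irrefl (trans (sym (size P))
            (trans (Σℕ.sum-cong-≗ λ v → cong [_] (Bool.¬-not λ v∉X → ∄v (v , v∉X)))
                    (trans (sum-const n 1) (ℕ.*-identityʳ n)))) (subst (k <_) eq (s≤s (ℕ.m≤n+m k j))))

  span : Separated H ⊎ Grown
  span = grow (ℕ.pred n) (trans (ℕ.+-comm (ℕ.pred n) 1) (ℕ.suc-pred n {{Fin.nonZeroIndex root}})) start₀ blocks₀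
    where
    start₀ : Partial 1
    start₀ = record
      { X = λ v → does (root Fin.≟ v)
      ; parent = λ _ → root
      ; time = λ _ → 0
      ; root∈X = dec-true (root Fin.≟ root) refl
      ; parent-root = refl
      ; size = sum-indicator root
      ; time<k = λ _ _ → s≤s z≤n
      ; parent∈X = λ v v∈X v≢root → ⊥-elim (v≢root (sym (does⇒ (root Fin.≟ v) v∈X)))
      ; parent-adj = λ v v∈X v≢root → ⊥-elim (v≢root (sym (does⇒ (root Fin.≟ v) v∈X)))
      ; earlier = λ v v∈X v≢root → ⊥-elim (v≢root (sym (does⇒ (root Fin.≟ v) v∈X))) }
    κ-loopless : κ root root ≡ false
    κ-loopless = Bool.¬-not λ κrr → true≢false (trans (sym (κ⊆adj root root κrr)) (loopless H root))
    count₀ : count start₀ ≡ 0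
    count₀ = trans (Σℕ.sum-cong-≗ pointwise) (Σℕ.sum-replicate-zero n)
      where
      pointwise : ∀ v → [ does (root Fin.≟ v) ] * [ κ v root ] ≡ 0
      pointwise v with root Fin.≟ v
      ... | yes refl rewrite κ-loopless = refl
      ... | no  _    = refl
    blocks₀ : Blocks start₀
    blocks₀ = record
      { Y = λ _ → false
      ; blocks = 0
      ; Y⊆X = λ _ ()
      ; Y-closed = λ _ _ ()
      ; current = root
      ; current∈X = root∈X start₀
      ; current∉Y = refl
      ; counted = cong (_+ 1) count₀
      ; blocks≤∣Y∣ = z≤n
      ; heavy = inj₂ z≤n }

-- Acyclicity

private
  variable
    A : Set

T⇒≡true : ∀ {b} → T b → b ≡ true
T⇒≡true {true} _ = refl

≡true⇒T : ∀ {b} → b ≡ true → T b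
≡true⇒T refl = _

lastOf : A → List A → A
lastOf x []       = x
lastOf x (y ∷ ys) = lastOf y ys

-- In the walk x y zs… e, any two vertices at distance 2 along the walk differ.
NonBacktracking : A → A → List A → A → Set
NonBacktracking x y []       e = x ≢ e
NonBacktracking x y (z ∷ zs) e = x ≢ z × NonBacktracking y z zs e

unique⇒nonBacktracking : ∀ {e : A} x y zs → Unique (x ∷ y ∷ zs) → All (_≢ e) (x ∷ y ∷ zs) → NonBacktracking x y zs e
unique⇒nonBacktracking x y []       _                      (x≢e ∷ _)   = x≢e
unique⇒nonBacktracking x y (z ∷ zs) ((_ ∷ x≢z ∷ _) ∷ uniq) (_ ∷ all≢e) = x≢z , unique⇒nonBacktracking y z zs uniq all≢e

≢lastOf : ∀ {x : A} y ys → All (x ≢_) (y ∷ ys) → x ≢ lastOf y ys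
≢lastOf y []       (x≢y ∷ _) = x≢y
≢lastOf y (z ∷ zs) (_ ∷ x≢)  = ≢lastOf z zs x≢

module RootedTree {n : ℕ} {H : Graph n} (R : Rooted H) where
  open Rooted R

  -- The root is its own parent, so it has to be excluded.
  isParent : Fin n → Fin n → Bool
  isParent u w = not (does (u Fin.≟ root)) ∧ does (parent u Fin.≟ w)

  Up Down : Fin n → Fin n → Set
  Up u w = u ≢ root × parent u ≡ w
  Down u w = Up w u

  isParent⇒Up : ∀ u w → isParent u w ≡ true → Up u w
  isParent⇒Up u w eq with u Fin.≟ root
  ... | no u≢root = u≢root , does⇒ (parent u Fin.≟ w) eq

  Up⇒isParent : ∀ {u w} → Up u w → isParent u w ≡ true
  Up⇒isParent {u} {w} (u≢root , eq) rewrite dec-false (u Fin.≟ root) u≢root = dec-true (parent u Fin.≟ w) eq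

  Up⇒earlier : ∀ {u w} → Up u w → time w < time u
  Up⇒earlier (u≢root , refl) = parent-earlier _ u≢root

  ¬isParent-refl : ∀ u → isParent u u ≡ false
  ¬isParent-refl u = Bool.¬-not λ eq → ℕ.<-irrefl refl (Up⇒earlier (isParent⇒Up u u eq))

  tree : Graph n
  tree = record
    { adj = λ u w → isParent u w ∨ isParent w u
    ; symmetric = λ u w → Bool.∨-comm (isParent u w) (isParent w u)
    ; loopless = λ u → cong₂ _∨_ (¬isParent-refl u) (¬isParent-refl u) }

  adj⇒Up⊎Down : ∀ u w → Adj tree u w → Up u w ⊎ Down u w
  adj⇒Up⊎Down u w u~w with isParent u w in eq
  ... | true  = inj₁ (isParent⇒Up u w eq)
  ... | false = inj₂ (isParent⇒Up w u (T⇒≡true u~w))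

  Up⇒adj : ∀ {u w} → Up u w → Adj tree u w
  Up⇒adj {u} {w} up = subst (λ b → T (b ∨ isParent w u)) (sym (Up⇒isParent up)) _

  Adj-sym : ∀ u w → Adj tree u w → Adj tree w u
  Adj-sym u w = subst T (symmetric tree u w)

  to-root : ∀ k v → time v < k → Star (Adj tree) v root
  to-root (suc k) v (s≤s v≤k) with v Fin.≟ root
  ... | yes refl   = Star.ε
  ... | no  v≢root = Up⇒adj (v≢root , refl) ◅ to-root k (parent v) (ℕ.<-≤-trans (parent-earlier v v≢root) v≤k)

  connected : Connected tree
  connected u w = to-root _ u ℕ.≤-refl ◅◅ Star.reverse (λ {u} {w} → Adj-sym u w) (to-root _ w ℕ.≤-refl)

  -- A walk without backtracking that has gone down once can only continue downwards.
  descend : ∀ {e} x y zs → Down x y → Linked (Adj tree) (y ∷ zs ++ e ∷ []) → NonBacktracking x y zs e →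
            time x < time e × Down (lastOf y zs) e
  descend x y [] x↓y (y~e ∷ _) x≢e with adj⇒Up⊎Down y _ y~e
  ... | inj₁ y↑e = ⊥-elim (x≢e (trans (sym (proj₂ x↓y)) (proj₂ y↑e)))
  ... | inj₂ y↓e = ℕ.<-trans (Up⇒earlier x↓y) (Up⇒earlier y↓e) , y↓e
  descend x y (z ∷ zs) x↓y (y~z ∷ walk) (x≢z , nb) with adj⇒Up⊎Down y z y~z
  ... | inj₁ y↑z = ⊥-elim (x≢z (trans (sym (proj₂ x↓y)) (proj₂ y↑z)))
  ... | inj₂ y↓z = let y<e , last↓e = descend y z zs y↓z walk nb in ℕ.<-trans (Up⇒earlier x↓y) y<e , last↓e

  -- Either the walk climbs all the way, and then its end is earlier than its start, or it turns
  -- downwards once and must arrive by a step down.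
  ascend : ∀ {e} x y zs → Up x y → Linked (Adj tree) (y ∷ zs ++ e ∷ []) → NonBacktracking x y zs e →
           time e < time x ⊎ Down (lastOf y zs) e
  ascend x y [] x↑y (y~e ∷ _) x≢e with adj⇒Up⊎Down y _ y~e
  ... | inj₁ y↑e = inj₁ (ℕ.<-trans (Up⇒earlier y↑e) (Up⇒earlier x↑y))
  ... | inj₂ y↓e = inj₂ y↓e
  ascend x y (z ∷ zs) x↑y (y~z ∷ walk) (x≢z , nb) with adj⇒Up⊎Down y z y~z
  ... | inj₂ y↓z = inj₂ (proj₂ (descend y z zs y↓z walk nb))
  ... | inj₁ y↑z with ascend y z zs y↑z walk nb
  ...   | inj₁ e<y    = inj₁ (ℕ.<-trans e<y (Up⇒earlier x↑y))
  ...   | inj₂ last↓e = inj₂ last↓e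

  -- A cycle that starts downwards, or climbs throughout, would return to a vertex of a different
  -- time. One that starts upwards and arrives downwards would have its second and its last vertex
  -- both equal to the parent of the start, although they are distinct.
  acyclic : ¬ Cycle tree
  acyclic record { rest = [] ; long = () }
  acyclic record { rest = a ∷ [] ; long = s≤s () }
  acyclic record { start = s ; rest = a ∷ b ∷ cs ; distinct = (s≢a ∷ s≢b ∷ s≢cs) ∷ uniq@(a≢ ∷ _) ; closed = s~a ∷ walk }
    with adj⇒Up⊎Down s a s~a
  ... | inj₂ s↓a = ℕ.<-irrefl refl (proj₁ (descend s a (b ∷ cs) s↓a walk nb))
    where
    nb : NonBacktracking s a (b ∷ cs) s
    nb = s≢b , unique⇒nonBacktracking a b cs uniq (All.map (λ s≢ eq → s≢ (sym eq)) (s≢a ∷ s≢b ∷ s≢cs))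
  ... | inj₁ s↑a with ascend s a (b ∷ cs) s↑a walk
        (s≢b , unique⇒nonBacktracking a b cs uniq (All.map (λ s≢ eq → s≢ (sym eq)) (s≢a ∷ s≢b ∷ s≢cs)))
  ...   | inj₁ s<s    = ℕ.<-irrefl refl s<s
  ...   | inj₂ last↓s = ≢lastOf b cs a≢ (trans (sym (proj₂ s↑a)) (proj₂ last↓s))

  isTree : IsTree tree
  isTree = record { connected = connected ; acyclic = acyclic }

  tree⊆H : ∀ u w → Adj tree u w → Adj H u w
  tree⊆H u w u~w with adj⇒Up⊎Down u w u~w
  ... | inj₁ (u≢root , refl) = ≡true⇒T (parent-adj u u≢root)
  ... | inj₂ (w≢root , refl) = subst T (symmetric H w (parent w)) (≡true⇒T (parent-adj w w≢root))

SimplePath : (A → A → Set) → A → A → Set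
SimplePath {A} R u w = Σ[ vs ∈ List A ] Unique (u ∷ vs) × Linked R (u ∷ vs) × lastOf u vs ≡ w

module _ {n : ℕ} {R : Fin n → Fin n → Set} where
  open DecMembership (Fin._≟_ {n}) using (_∈?_)

  suffix : ∀ {u w} x xs → u ∈ x ∷ xs → Unique (x ∷ xs) → Linked R (x ∷ xs) → lastOf x xs ≡ w → SimplePath R u w
  suffix x xs (here refl) uniq linked last≡ = xs , uniq , linked , last≡
  suffix x (y ∷ ys) (there u∈) (_ ∷ uniq) (_ ∷ linked) last≡ = suffix y ys u∈ uniq linked last≡

  -- Loop erasure: if the new first vertex already lies on the path, only the part from that
  -- occurrence on is kept.
  simplify : ∀ {u w} → Star R u w → SimplePath R u w
  simplify Star.ε = [] , [] ∷ [] , [-] , refl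
  simplify {u} (_◅_ {j = v} u~v walk) with simplify walk
  ... | vs , uniq , linked , last≡ with u ∈? (v ∷ vs)
  ... | yes u∈ = suffix v vs u∈ uniq linked last≡
  ... | no  u∉ = v ∷ vs , All.¬Any⇒All¬ (v ∷ vs) u∉ ∷ uniq , u~v ∷ linked , last≡

  close : ∀ {e} x xs → Linked R (x ∷ xs) → R (lastOf x xs) e → Linked R (x ∷ xs ++ e ∷ [])
  close x []       [-]          last~e = last~e ∷ [-]
  close x (y ∷ ys) (x~y ∷ walk) last~e = x~y ∷ close y ys walk last~e

-- An edge of G missing from G′ would close a simple path of G′ to a cycle of G: a path of length 0
-- would make the edge a loop, and one of length 1 would be the missing edge. This serves to recover
-- a tree from any spanning tree grown inside it.
acyclic⇒minimal : ∀ {n} (G G′ : Graph n) → ¬ Cycle G → (∀ u w → Adj G′ u w → Adj G u w) → Connected G′ →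
                  ∀ u w → adj G′ u w ≡ adj G u w
acyclic⇒minimal G G′ acyclic G′⊆G connected u w with adj G u w in Guw | adj G′ u w in G′uw
... | true  | true  = refl
... | false | false = refl
... | false | true  = ⊥-elim (subst T Guw (G′⊆G u w (≡true⇒T G′uw)))
... | true  | false with simplify (connected u w)
... | [] , _ , _ , refl with () ← trans (sym Guw) (loopless G u)
... | x ∷ [] , _ , u~x ∷ _ , refl = ⊥-elim (subst T G′uw u~x)
... | x ∷ y ∷ vs , uniq , walk , refl = ⊥-elim (acyclic (record
        { start = u
        ; rest = x ∷ y ∷ vs
        ; long = s≤s (s≤s z≤n)
        ; distinct = uniq
        ; closed = close u (x ∷ y ∷ vs) (Linked.map (λ {a} {b} → G′⊆G a b) walk)
                (≡true⇒T (trans (symmetric G w u) Guw)) }))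

-- Counting edges of one colour

-- The enumeration of edges in Defs uses a local function; unification gives it a name.
mutual
  toEdge : ∀ {n} (G : Graph n) → Fin n × Fin n → Maybe (Edge G)
  toEdge = _

  edges≡mapMaybe-toEdge : ∀ {n} (G : Graph n) → edges G ≡ mapMaybe (toEdge G) (cartesianProduct (allFin n) (allFin n))
  edges≡mapMaybe-toEdge G = refl

toEdge-just : ∀ {n} (G : Graph n) u w (u<w : u Fin.< w) (u~w : Adj G u w) → toEdge G (u , w) ≡ just (edge u w u<w u~w)
toEdge-just G u w u<w u~w with u Fin.<? w | T? (adj G u w)
... | yes _  | yes _  = refl
... | yes _  | no u≁w = ⊥-elim (u≁w u~w)
... | no u≮w | _      = ⊥-elim (u≮w u<w)

toEdge-nothing : ∀ {n} (G : Graph n) u w → ¬ (u Fin.< w × Adj G u w) → toEdge G (u , w) ≡ nothing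
toEdge-nothing G u w ∄ with u Fin.<? w | T? (adj G u w)
... | yes u<w | yes u~w = ⊥-elim (∄ (u<w , u~w))
... | yes _   | no _    = refl
... | no _    | _       = refl

hits : {B : Set} {P : B → Set} → Decidable P → Maybe B → ℕ
hits P? nothing  = 0
hits P? (just b) = [ does (P? b) ]

module _ {A B : Set} {P : B → Set} (P? : Decidable P) (g : A → Maybe B) where

  hitCount : List A → ℕ
  hitCount xs = length (filter P? (mapMaybe g xs))

  hitCount-∷ : ∀ x xs → hitCount (x ∷ xs) ≡ hits P? (g x) + hitCount xs
  hitCount-∷ x xs with g x
  ... | nothing = refl
  ... | just b with does (P? b)
  ...   | true  = refl
  ...   | false = refl

  hitCount-++ : ∀ xs ys → hitCount (xs ++ ys) ≡ hitCount xs + hitCount ys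
  hitCount-++ []       ys = refl
  hitCount-++ (x ∷ xs) ys = begin
    hitCount (x ∷ xs ++ ys)                    ≡⟨ hitCount-∷ x (xs ++ ys) ⟩
    hits P? (g x) + hitCount (xs ++ ys)           ≡⟨ cong (hits P? (g x) ℕ.+_) (hitCount-++ xs ys) ⟩
    hits P? (g x) + (hitCount xs + hitCount ys)   ≡⟨ ℕ.+-assoc (hits P? (g x)) (hitCount xs) (hitCount ys) ⟨
    hits P? (g x) + hitCount xs + hitCount ys     ≡⟨ cong (_+ hitCount ys) (hitCount-∷ x xs) ⟨
    hitCount (x ∷ xs) + hitCount ys            ∎
    where open ≡-Reasoning

  hitCount-map-tabulate : ∀ {n} {C : Set} (h : C → A) (k : Fin n → C) →
    hitCount (map h (tabulate k)) ≡ Σℕ.sum λ j → hits P? (g (h (k j)))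
  hitCount-map-tabulate {zero}  h k = refl
  hitCount-map-tabulate {suc n} h k = trans (hitCount-∷ (h (k zero)) (map h (tabulate (k ∘ suc))))
    (cong (hits P? (g (h (k zero))) ℕ.+_) (hitCount-map-tabulate h (k ∘ suc)))

hitCount-cartesianProduct : ∀ {m n} {C D B : Set} {P : B → Set} (P? : Decidable P) (g : C × D → Maybe B)
  (h : Fin m → C) (k : Fin n → D) →
  hitCount P? g (cartesianProduct (tabulate h) (tabulate k)) ≡ Σℕ.sum λ i → Σℕ.sum λ j → hits P? (g (h i , k j))
hitCount-cartesianProduct {zero}  P? g h k = refl
hitCount-cartesianProduct {suc m} P? g h k =
  trans (hitCount-++ P? g (map (h zero ,_) (tabulate k)) (cartesianProduct (tabulate (h ∘ suc)) (tabulate k)))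
    (cong₂ _+_ (hitCount-map-tabulate P? g (h zero ,_) k) (hitCount-cartesianProduct P? g (h ∘ suc) k))

module Colour {n r₀ : ℕ} {G : Graph n} (f : Colouring G (suc r₀)) where

  private
    r : ℕ
    r = suc r₀

  -- Extends the colouring to all pairs of vertices. The default colour `zero` is masked by the
  -- adjacency tests wherever edges are counted.
  upper : Fin n → Fin n → Fin r
  upper u w with u Fin.<? w | T? (adj G u w)
  ... | yes u<w | yes u~w = f (edge u w u<w u~w)
  ... | _       | _       = zero

  colour : Fin n → Fin n → Fin r
  colour u w = if does (u Fin.<? w) then upper u w else upper w u

  upper-edge : ∀ u w .(u<w : u Fin.< w) .(u~w : Adj G u w) → upper u w ≡ f (edge u w u<w u~w)
  upper-edge u w u<w u~w with u Fin.<? w | T? (adj G u w)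
  ... | yes _  | yes _  = refl
  ... | yes _  | no u≁w = Data.Empty.Irrelevant.⊥-elim (u≁w u~w)
  ... | no u≮w | _      = Data.Empty.Irrelevant.⊥-elim (u≮w u<w)

  colour-< : ∀ u w → u Fin.< w → colour u w ≡ upper u w
  colour-< u w u<w = cong (if_then upper u w else upper w u) (dec-true (u Fin.<? w) u<w)

  colour-≮ : ∀ u w → ¬ (u Fin.< w) → colour u w ≡ upper w u
  colour-≮ u w u≮w = cong (if_then upper u w else upper w u) (dec-false (u Fin.<? w) u≮w)

  colour-sym : ∀ u w → colour u w ≡ colour w u
  colour-sym u w with Fin.<-cmp u w
  ... | tri< u<w _ w≮u = trans (colour-< u w u<w) (sym (colour-≮ w u w≮u))
  ... | tri≈ _ refl _  = refl
  ... | tri> u≮w _ w<u = trans (colour-≮ u w u≮w) (sym (colour-< w u w<u))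

  coloured : Fin r → Fin n → Fin n → Bool
  coloured i u w = adj G u w ∧ does (colour u w Fin.≟ i)

  coloured-sym : ∀ i u w → coloured i u w ≡ coloured i w u
  coloured-sym i u w = cong₂ (λ b k → b ∧ does (k Fin.≟ i)) (symmetric G u w) (colour-sym u w)

  coloured⊆adj : ∀ i u w → coloured i u w ≡ true → adj G u w ≡ true
  coloured⊆adj i u w = Bool.∧-conicalˡ (adj G u w) (does (colour u w Fin.≟ i))

  module _ (S : SpanningTree G) (i : Fin r) where
    open SpanningTree S

    [tree-edge] : Fin n → Fin n → ℕ
    [tree-edge] u w = [ does (u Fin.<? w) ] * ([ adj tree u w ] * [ does (upper u w Fin.≟ i) ])

    colourCount≡ : colourCount f S i ≡ Σℕ.sum λ u → Σℕ.sum λ w → [tree-edge] u w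
    colourCount≡ = trans (hitCount-cartesianProduct P? (toEdge tree) id id)
      (Σℕ.sum-cong-≗ λ u → Σℕ.sum-cong-≗ λ w → pointwise u w)
      where
      P? : Decidable (λ e → f (inclusion e) ≡ i)
      P? e = f (inclusion e) Fin.≟ i
      pointwise : ∀ u w → hits P? (toEdge tree (u , w)) ≡ [tree-edge] u w
      pointwise u w = by-cases (u Fin.<? w ×-dec T? (adj tree u w))
        where
        vanishes : (u<?w : Dec (u Fin.< w)) → ¬ (u Fin.< w × Adj tree u w) →
                   [ does u<?w ] * ([ adj tree u w ] * [ does (upper u w Fin.≟ i) ]) ≡ 0
        vanishes (no _)    _ = refl
        vanishes (yes u<w) ∄ = cong (λ b → 1 * ([ b ] * [ does (upper u w Fin.≟ i) ]))
                (Bool.¬-not λ eq → ∄ (u<w , ≡true⇒T eq))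
        open ≡-Reasoning
        by-cases : Dec (u Fin.< w × Adj tree u w) → hits P? (toEdge tree (u , w)) ≡ [tree-edge] u w
        by-cases (no ∄) = trans (cong (hits P?) (toEdge-nothing tree u w ∄)) (sym (vanishes (u Fin.<? w) ∄))
        by-cases (yes (u<w , u~w)) = begin
          hits P? (toEdge tree (u , w))
            ≡⟨ cong (hits P?) (toEdge-just tree u w u<w u~w) ⟩
          [ does (f (edge u w u<w (subgraph u w u~w)) Fin.≟ i) ]
            ≡⟨ cong (λ k → [ does (k Fin.≟ i) ]) (upper-edge u w u<w (subgraph u w u~w)) ⟨
          [ does (upper u w Fin.≟ i) ]
            ≡⟨ trans (ℕ.*-identityˡ _) (ℕ.*-identityˡ [ does (upper u w Fin.≟ i) ]) ⟨
          1 * (1 * [ does (upper u w Fin.≟ i) ])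
            ≡⟨ cong₂ (λ a b → [ a ] * ([ b ] * [ does (upper u w Fin.≟ i) ])) (dec-true (u Fin.<? w) u<w)
                    (T⇒≡true u~w) ⟨
          [tree-edge] u w                                                     ∎

  module _ (S : SpanningTree G) (i : Fin r) where
    open SpanningTree S

    -- Comparing the edges of the tree with all ordered pairs of adjacent vertices is crude, but
    -- linear in n as the upper bound requires.
    colourCount≤ : ∀ {d} → Regular d G → colourCount f S i ≤ n * d
    colourCount≤ {d} regular = begin
      colourCount f S i                              ≡⟨ colourCount≡ S i ⟩
      Σℕ.sum (λ u → Σℕ.sum λ w → [tree-edge] S i u w)  ≤⟨ Σℕ-mono (λ u → Σℕ-mono λ w → pointwise u w) ⟩
      Σℕ.sum (λ u → ∣ adj G u ∣)                     ≡⟨ Σℕ.sum-cong-≗ (λ u → trans (sym (degree≡sum G u)) (regular u)) ⟩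
      Σℕ.sum {n} (λ _ → d)                           ≡⟨ sum-const n d ⟩
      n * d                                          ∎
      where
      open ℕ.≤-Reasoning
      [b]≤1 : ∀ b → [ b ] ≤ 1
      [b]≤1 true  = ℕ.≤-refl
      [b]≤1 false = z≤n
      subgraph′ : ∀ u w → [ adj tree u w ] ≤ [ adj G u w ]
      subgraph′ u w with adj tree u w in eq
      ... | false = z≤n
      ... | true  = ℕ.≤-reflexive (cong [_] (sym (T⇒≡true (subgraph u w (≡true⇒T eq)))))
      pointwise : ∀ u w → [tree-edge] S i u w ≤ [ adj G u w ]
      pointwise u w = ℕ.≤-trans (ℕ.*-mono-≤ ([b]≤1 (does (u Fin.<? w)))
              (ℕ.*-mono-≤ (subgraph′ u w) ([b]≤1 (does (upper u w Fin.≟ i)))))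
        (ℕ.≤-reflexive (trans (ℕ.*-identityˡ _) (ℕ.*-identityʳ [ adj G u w ])))

  colourCount-cong : ∀ (S S′ : SpanningTree G)
          → (∀ u w → adj (SpanningTree.tree S) u w ≡ adj (SpanningTree.tree S′) u w) →
                     ∀ i → colourCount f S i ≡ colourCount f S′ i
  colourCount-cong S S′ S≡S′ i = trans (colourCount≡ S i) (trans
    (Σℕ.sum-cong-≗ λ u → Σℕ.sum-cong-≗ λ w → cong (λ b → [ does (u Fin.<? w) ] * ([ b ] * [ does (upper u w Fin.≟ i) ]))
            (S≡S′ u w))
    (sym (colourCount≡ S′ i)))

  -- Each vertex other than the root is counted at the edge joining it to its parent.
  module _ (R : Rooted G) (i : Fin r) where
    open Rooted R
    open RootedTree R using (isParent; Up⇒isParent; isParent⇒Up; Up⇒earlier; ¬isParent-refl)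

    S : SpanningTree G
    S = record { tree = RootedTree.tree R ; isTree = RootedTree.isTree R ; subgraph = RootedTree.tree⊆H R }

    private
      κ : Fin n → Fin n → Bool
      κ = coloured i

      p : Fin n → Fin n → ℕ
      p u w = [ isParent u w ] * [ κ u w ]

      l : Fin n → Fin n → ℕ
      l u w = [ does (u Fin.<? w) ]

      κ-parent≤ : ∀ v → [ κ v (parent v) ] ≤ Σℕ.sum (p v)
      κ-parent≤ v = by-cases v (v Fin.≟ root)
        where
        κ-loopless : κ root root ≡ false
        κ-loopless = cong (_∧ does (colour root root Fin.≟ i)) (loopless G root)
        by-cases : ∀ v → Dec (v ≡ root) → [ κ v (parent v) ] ≤ Σℕ.sum (p v)
        by-cases v (yes refl)   = ℕ.≤-trans (ℕ.≤-reflexive (cong [_] (trans (cong (κ v) parent-root) κ-loopless))) z≤n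
        by-cases v (no v≢root) = ℕ.≤-trans
          (ℕ.≤-reflexive (sym (trans (cong (λ b → [ b ] * [ κ v (parent v) ]) (Up⇒isParent (v≢root , refl)))
                  (ℕ.*-identityˡ _))))
          (term≤sum (p v) (parent v))

      split : ∀ u w → p u w ≤ l u w * p u w + l w u * p u w
      split u w = by-cases (Fin.<-cmp u w)
        where
        p≡l*p : ∀ {b} → b ≡ true → p u w ≡ [ b ] * p u w
        p≡l*p refl = sym (ℕ.*-identityˡ (p u w))
        by-cases : Tri (u Fin.< w) (u ≡ w) (w Fin.< u) → p u w ≤ l u w * p u w + l w u * p u w
        by-cases (tri< u<w _ _) = ℕ.≤-trans (ℕ.≤-reflexive (p≡l*p (dec-true (u Fin.<? w) u<w))) (ℕ.m≤m+n _ _)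
        by-cases (tri> _ _ w<u) = ℕ.≤-trans (ℕ.≤-reflexive (p≡l*p (dec-true (w Fin.<? u) w<u))) (ℕ.m≤n+m _ _)
        by-cases (tri≈ _ u≡w _) = ℕ.≤-trans (ℕ.≤-reflexive (cong (λ b → [ b ] * [ κ u w ])
          (trans (cong (isParent u) (sym u≡w)) (¬isParent-refl u)))) z≤n

      exclusive : ∀ u w → [ isParent u w ] + [ isParent w u ] ≤ [ isParent u w ∨ isParent w u ]
      exclusive u w with isParent u w in uw | isParent w u in wu
      ... | true  | true  = ⊥-elim (ℕ.<-asym (Up⇒earlier (isParent⇒Up u w uw)) (Up⇒earlier (isParent⇒Up w u wu)))
      ... | true  | false = ℕ.≤-refl
      ... | false | true  = ℕ.≤-refl
      ... | false | false = z≤n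

      join : ∀ u w b → (b ≡ true → u Fin.< w) →
             [ b ] * p u w + [ b ] * p w u ≤ [ b ] * ([ isParent u w ∨ isParent w u ] * [ does (upper u w Fin.≟ i) ])
      join u w false _   = z≤n
      join u w true  u<w = begin
        1 * ([ isParent u w ] * [ κ u w ]) + 1 * ([ isParent w u ] * [ κ w u ])
          ≡⟨ cong (λ b → 1 * ([ isParent u w ] * [ κ u w ]) + 1 * ([ isParent w u ] * [ b ])) (coloured-sym i w u) ⟩
        1 * ([ isParent u w ] * [ κ u w ]) + 1 * ([ isParent w u ] * [ κ u w ])
          ≡⟨ cong₂ _+_ (ℕ.*-identityˡ (p u w)) (ℕ.*-identityˡ ([ isParent w u ] * [ κ u w ])) ⟩
        [ isParent u w ] * [ κ u w ] + [ isParent w u ] * [ κ u w ]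
          ≡⟨ ℕ.*-distribʳ-+ [ κ u w ] [ isParent u w ] [ isParent w u ] ⟨
        ([ isParent u w ] + [ isParent w u ]) * [ κ u w ]
          ≤⟨ ℕ.*-mono-≤ (exclusive u w) κ≤upper ⟩
        [ isParent u w ∨ isParent w u ] * [ does (upper u w Fin.≟ i) ]
          ≡⟨ ℕ.*-identityˡ _ ⟨
        1 * ([ isParent u w ∨ isParent w u ] * [ does (upper u w Fin.≟ i) ]) ∎
        where
        open ℕ.≤-Reasoning
        κ≤upper : [ κ u w ] ≤ [ does (upper u w Fin.≟ i) ]
        κ≤upper = subst (λ k → [ adj G u w ∧ does (k Fin.≟ i) ] ≤ [ does (upper u w Fin.≟ i) ])
                (sym (colour-< u w (u<w refl))) (drop (adj G u w))
          where
          drop : ∀ b {c} → [ b ∧ c ] ≤ [ c ]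
          drop true  = ℕ.≤-refl
          drop false = z≤n

    -- A parent may be larger or smaller than its child in `Fin n`, whereas edges are listed with
    -- the smaller end first. The sum over ordered pairs is therefore split by order, and the half
    -- with w < u is transposed. Nothing is counted twice, since u and w cannot be parents of each
    -- other.
    count≤colourCount : count κ ≤ colourCount f S i
    count≤colourCount = begin
      count κ                                                              ≤⟨ Σℕ-mono κ-parent≤ ⟩
      Σℕ.sum (λ u → Σℕ.sum λ w → p u w)                                    ≤⟨ Σℕ-mono (λ u → Σℕ-mono λ w → split u w) ⟩
      Σℕ.sum (λ u → Σℕ.sum λ w → l u w * p u w + l w u * p u w)
        ≡⟨ ΣΣ-distrib (λ u w → l u w * p u w) (λ u w → l w u * p u w) ⟩
      ΣΣ (λ u w → l u w * p u w) + ΣΣ (λ u w → l w u * p u w)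
        ≡⟨ cong (ΣΣ (λ u w → l u w * p u w) ℕ.+_) (Σℕ.∑-comm (λ u w → l w u * p u w)) ⟩
      ΣΣ (λ u w → l u w * p u w) + ΣΣ (λ u w → l u w * p w u)
        ≡⟨ ΣΣ-distrib (λ u w → l u w * p u w) (λ u w → l u w * p w u) ⟨
      Σℕ.sum (λ u → Σℕ.sum λ w → l u w * p u w + l u w * p w u)
        ≤⟨ Σℕ-mono (λ u → Σℕ-mono λ w → join u w (does (u Fin.<? w)) (does⇒ (u Fin.<? w))) ⟩
      Σℕ.sum (λ u → Σℕ.sum λ w → [tree-edge] S i u w)                      ≡⟨ colourCount≡ S i ⟨
      colourCount f S i                                                    ∎
      where
      open ℕ.≤-Reasoning
      ΣΣ : (Fin n → Fin n → ℕ) → ℕ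
      ΣΣ g = Σℕ.sum λ u → Σℕ.sum λ w → g u w
      ΣΣ-distrib : ∀ g h → ΣΣ (λ u w → g u w + h u w) ≡ ΣΣ g + ΣΣ h
      ΣΣ-distrib g h = trans (Σℕ.sum-cong-≗ λ u → Σℕ.∑-distrib-+ (g u) (h u))
              (Σℕ.∑-distrib-+ (λ u → Σℕ.sum (g u)) (λ u → Σℕ.sum (h u)))

module _ {n r₀ : ℕ} {G : Graph n} (f f′ : Colouring G (suc r₀)) (f≗f′ : ∀ e → f e ≡ f′ e) where

  upper-cong : ∀ u w → Colour.upper f u w ≡ Colour.upper f′ u w
  upper-cong u w with u Fin.<? w | T? (adj G u w)
  ... | yes u<w | yes u~w = f≗f′ (edge u w u<w u~w)
  ... | yes _   | no _    = refl
  ... | no _    | _       = refl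

  colourCount-ext : ∀ S i → colourCount f S i ≡ colourCount f′ S i
  colourCount-ext S i = trans (Colour.colourCount≡ f S i) (trans
    (Σℕ.sum-cong-≗ λ u → Σℕ.sum-cong-≗ λ w →
      cong (λ k → [ does (u Fin.<? w) ] * ([ adj (SpanningTree.tree S) u w ] * [ does (k Fin.≟ i) ])) (upper-cong u w))
    (sym (Colour.colourCount≡ f′ S i)))

-- Discrepancy

module _ {A : Set} {_≲_ : A → A → Set}
         (≲-trans : ∀ {a b c} → a ≲ b → b ≲ c → a ≲ c) (≲-total : ∀ a b → a ≲ b ⊎ b ≲ a) where

  private
    ≲-refl : ∀ a → a ≲ a
    ≲-refl a with ≲-total a a
    ... | inj₁ a≲a = a≲a
    ... | inj₂ a≲a = a≲a

  extremum : ∀ {N} → Fin N → (F : Fin N → A) → ∃[ i ] ∀ j → F j ≲ F i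
  extremum {suc zero}    _ F = zero , λ { zero → ≲-refl (F zero) }
  extremum {suc (suc N)} _ F with extremum zero (F ∘ suc)
  ... | i , max with ≲-total (F zero) (F (suc i))
  ... | inj₁ F₀≲Fᵢ = suc i , λ { zero → F₀≲Fᵢ ; (suc j) → max j }
  ... | inj₂ Fᵢ≲F₀ = zero , λ { zero → ≲-refl (F zero) ; (suc j) → ≲-trans (max j) Fᵢ≲F₀ }

-- The types A and B need not be finite up to `_≡_`. It is enough that finitely many representatives
-- realise all the values of `F`.
module Minimax {A B : Set} {K L : ℕ} (F : A → B → ℚ)
  (b₀ : B) (decodeB : Fin K → B) (encodeB : B → Fin K) (F-encodeB : ∀ a b → F a (decodeB (encodeB b)) ≡ F a b)
  (a₀ : A) (decodeA : Fin L → A) (encodeA : A → Fin L) (F-encodeA : ∀ a b → F (decodeA (encodeA a)) b ≡ F a b) where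

  best : ∀ a → ∃[ i ] ∀ j → F a (decodeB j) ℚ.≤ F a (decodeB i)
  best a = extremum ℚ.≤-trans ℚ.≤-total (encodeB b₀) λ j → F a (decodeB j)

  maximum : A → ℚ
  maximum a = F a (decodeB (proj₁ (best a)))

  ≤maximum : ∀ a b → F a b ℚ.≤ maximum a
  ≤maximum a b = subst (ℚ._≤ maximum a) (F-encodeB a b) (proj₂ (best a) (encodeB b))

  isMaximum : ∀ a → IsMaximum (F a) (maximum a)
  isMaximum a = (decodeB (proj₁ (best a)) , refl) , ≤maximum a

  worst : ∃[ i ] ∀ j → maximum (decodeA i) ℚ.≤ maximum (decodeA j)
  worst = extremum {_≲_ = λ p q → q ℚ.≤ p} (λ p q → ℚ.≤-trans q p) (λ p q → ℚ.≤-total q p) (encodeA a₀)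
          (maximum ∘ decodeA)

  minimiser : A
  minimiser = decodeA (proj₁ worst)

  minimax : ℚ
  minimax = maximum minimiser

  minimax≤ : ∀ {c} → (∀ a b → F a b ℚ.≤ c) → minimax ℚ.≤ c
  minimax≤ F≤c = F≤c minimiser (decodeB (proj₁ (best minimiser)))

  -- The maximum at the representative of `a` is attained at some b, and there `F` has the same
  -- value for `a`; so the maximum at `a` is no smaller.
  isMinimum : IsMinimum maximum minimax
  isMinimum = (minimiser , refl) , λ a → ℚ.≤-trans (proj₂ worst (encodeA a))
    (subst (ℚ._≤ maximum a) (sym (F-encodeA a _)) (≤maximum a (decodeB (proj₁ (best (decodeA (encodeA a)))))))

-- Binary functions on Fin n, coded by numbers: no function extensionality is available.
decode : ∀ {m n} → Fin ((m ℕ.^ n) ℕ.^ n) → Fin n → Fin n → Fin m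
decode c u = finToFun (finToFun c u)

encode : ∀ {m n} → (Fin n → Fin n → Fin m) → Fin ((m ℕ.^ n) ℕ.^ n)
encode g = funToFin λ u → funToFin (g u)

decode-encode : ∀ {m n} (g : Fin n → Fin n → Fin m) u w → decode (encode g) u w ≡ g u w
decode-encode g u w = trans (cong (λ c → finToFun c w) (Fin.finToFun-funToFin (λ u → funToFin (g u)) u))
        (Fin.finToFun-funToFin (g u) w)

r*z/r : ∀ r .{{_ : NonZero r}} z → fromℕ r ℚ.* (z ℚ./ r) ≡ fromℤ z
r*z/r (suc r) z = ℚ.toℚᵘ-injective (begin
  ℚ.toℚᵘ (fromℕ (suc r) ℚ.* (z ℚ./ suc r))             ≈⟨ ℚ.toℚᵘ-homo-* (fromℕ (suc r)) (z ℚ./ suc r) ⟩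
  ℚ.toℚᵘ (fromℕ (suc r)) ℚᵘ.* ℚ.toℚᵘ (z ℚ./ suc r)
    ≈⟨ ℚᵘ.*-cong (toℚᵘ-fromℤ (+ suc r)) (ℚ.toℚᵘ-fromℚᵘ (ℚᵘ.mkℚᵘ z r)) ⟩
  ℚᵘ.mkℚᵘ (+ suc r) 0 ℚᵘ.* ℚᵘ.mkℚᵘ z r                 ≈⟨ ℚᵘ.*≡* lemma ⟩
  ℚᵘ.mkℚᵘ z 0                                          ≈⟨ toℚᵘ-fromℤ z ⟨
  ℚ.toℚᵘ (fromℤ z)                                     ∎)
  where
  open ℚᵘ.≃-Reasoning
  lemma : + suc r ℤ.* z ℤ.* + 1 ≡ z ℤ.* + suc (r + 0)
  lemma = trans (ℤ.*-identityʳ (+ suc r ℤ.* z))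
          (trans (ℤ.*-comm (+ suc r) z) (cong (λ k → z ℤ.* + suc k) (sym (ℕ.+-identityʳ r))))

closed-walk : ∀ {n} (G : Graph n) (X : Fin n → Bool) → Closed (adj G) X → ∀ {u w} → X u ≡ true → Star (Adj G) u w → X w
        ≡ true
closed-walk G X closed u∈X Star.ε = u∈X
closed-walk G X closed {u} u∈X (_◅_ {j = v} u~v walk) = closed-walk G X closed (closed u v u∈X (T⇒≡true u~v)) walk

-- With an empty `κ` every block is a single vertex, and the constant weight 6 meets the block
-- condition trivially. The growth procedure then is a plain search for a spanning tree.
separated-or-rooted : ∀ {n} (H : Graph n) → Fin n → Separated H ⊎ Rooted H
separated-or-rooted H root with Blind.span
  where
  module Blind = Growth H (λ _ _ → false) (λ _ _ ()) (λ _ _ → refl) (λ _ → 6)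
    (λ C _ v v∈C _ → ℕ.≤-trans (ℕ.≤-reflexive (cong (λ b → [ b ] * 6) (sym v∈C))) (term≤sum (λ u → [ C u ] * 6) v)) root
... | inj₁ separated = inj₁ separated
... | inj₂ grown     = inj₂ (Growth.Grown.tree grown)

connected⇒not-separated : ∀ {n} (H : Graph n) → Connected H → ¬ Separated H
connected⇒not-separated H connected s =
  true≢false (trans (sym (closed-walk H X closed inside∈X (connected inside outside))) outside∉X)
  where open Separated s

expanding⇒not-separated : ∀ {n} {G : Graph n} → Expanding G → ¬ Separated G
expanding⇒not-separated {n} {G} expanding s = ℕ.<⇒≱ (s≤s z≤n) (begin
  2                                    ≤⟨ ℕ.*-monoʳ-≤ 2 (ℕ.*-mono-≤ 1≤∣X∣ 1≤∣∁X∣) ⟩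
  2 * (∣ X ∣ * ∣ not ∘ X ∣)        ≤⟨ expanding X ⟩
  n * boundary G X                   ≡⟨ cong (n ℕ.*_) boundary≡0 ⟩
  n * 0                              ≡⟨ ℕ.*-zeroʳ n ⟩
  0                                    ∎)
  where
  open ℕ.≤-Reasoning
  open Separated s
  1≤∣X∣ : 1 ≤ ∣ X ∣
  1≤∣X∣ = ℕ.≤-trans (ℕ.≤-reflexive (cong [_] (sym inside∈X))) (term≤sum (λ v → [ X v ]) inside)
  1≤∣∁X∣ : 1 ≤ ∣ not ∘ X ∣
  1≤∣∁X∣ = ℕ.≤-trans (ℕ.≤-reflexive (cong (λ b → [ not b ]) (sym outside∉X))) (term≤sum (λ v → [ not (X v) ]) outside)
  boundary≡0 : boundary G X ≡ 0
  boundary≡0 = trans (Σℕ.sum-cong-≗ λ u → trans (Σℕ.*-distribˡ-sum [ X u ] (λ w → [ adj G u w ] * [ not (X w) ]))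
      (trans (Σℕ.sum-cong-≗ (pointwise u)) (Σℕ.sum-replicate-zero n))) (Σℕ.sum-replicate-zero n)
    where
    pointwise : ∀ u w → [ X u ] * ([ adj G u w ] * [ not (X w) ]) ≡ 0
    pointwise u w with X u in Xu | adj G u w in uw
    ... | false | _     = refl
    ... | true  | false = refl
    ... | true  | true rewrite closed u w Xu uw = refl

module _ {n r₀ : ℕ} {G : Graph n} where

  private
    r : ℕ
    r = suc r₀

  colourCount≤max : ∀ (f : Colouring G r) S i → colourCount f S i ≤ maxColourCount f S
  colourCount≤max f S i = All.lookup (xs≤max 0 (map (colourCount f S) (allFin r)))
          (∈-map⁺ (colourCount f S) (∈-allFin i))

  max≤ : ∀ (f : Colouring G r) S {k} → (∀ i → colourCount f S i ≤ k) → maxColourCount f S ≤ k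
  max≤ f S bound = max≤v⁺ {xs = map (colourCount f S) (allFin r)} z≤n (All.map⁺ (All.tabulate λ {i} _ → bound i))

  treeDiscrepancy≡ : ∀ (f : Colouring G r) S →
    treeDiscrepancy f S ≡ fromℕ r ℚ.* fromℕ (maxColourCount f S) ℚ.- (fromℕ n ℚ.- 1ℚ)
  treeDiscrepancy≡ f S = trans (lemma (fromℕ r) (fromℕ (maxColourCount f S)) ((+ n ℤ.- + 1) ℚ./ r))
    (cong (λ z → fromℕ r ℚ.* fromℕ (maxColourCount f S) ℚ.- z) (trans (r*z/r r (+ n ℤ.- + 1))
      (trans (fromℤ-+ (+ n) (ℤ.- (+ 1))) (cong (fromℕ n ℚ.+_) (fromℤ-neg (+ 1))))))
    where
    lemma : ∀ R m z → R ℚ.* (m ℚ.- z) ≡ R ℚ.* m ℚ.- R ℚ.* z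
    lemma = solve 3 (λ R m z → R :* (m :- z) := R :* m :- R :* z) refl
      where open +-*-Solver

  treeDiscrepancy-cong : ∀ (f f′ : Colouring G r) S S′ → (∀ i → colourCount f S i ≡ colourCount f′ S′ i) →
                         treeDiscrepancy f S ≡ treeDiscrepancy f′ S′
  treeDiscrepancy-cong f f′ S S′ eq = trans (treeDiscrepancy≡ f S) (trans
    (cong (λ k → fromℕ r ℚ.* fromℕ k ℚ.- (fromℕ n ℚ.- 1ℚ)) max≡)
    (sym (treeDiscrepancy≡ f′ S′)))
    where
    max≡ : maxColourCount f S ≡ maxColourCount f′ S′
    max≡ = cong (max 0) (List.map-cong eq (allFin r))

  abundant⇒discrepancy≥ : ∀ (f : Colouring G r) S q .{{_ : NonZero q}} →
    q * n + n ≤ q * (r * maxColourCount f S) → (+ 1 ℚ./ q) ℚ.* fromℕ n ℚ.≤ treeDiscrepancy f S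
  abundant⇒discrepancy≥ f S q abundant = subst ((+ 1 ℚ./ q) ℚ.* N ℚ.≤_) (sym (treeDiscrepancy≡ f S))
    (ℚ.*-cancelˡ-≤-pos Q {{ℚ.positive 0<Q}} (≤-witness gap
      (0≤+ (p≤q⇒0≤q-p abundantℚ) (ℚ.<⇒≤ 0<Q))
      (trans (cong (ℚ._+ gap) (trans (sym (ℚ.*-assoc Q (+ 1 ℚ./ q) N)) (cong (ℚ._* N) (r*z/r q (+ 1)))))
        (lemma Q N (fromℕ r ℚ.* fromℕ k)))))
    where
    k : ℕ
    k = maxColourCount f S
    N Q gap : ℚ
    N = fromℕ n
    Q = fromℕ q
    -- The last `Q` comes from the 1 in n - 1: a tree has one edge less than vertices, which leaves
    -- this much to spare.
    gap = Q ℚ.* (fromℕ r ℚ.* fromℕ k) ℚ.- (Q ℚ.* N ℚ.+ N) ℚ.+ Q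
    0<Q : 0ℚ ℚ.< Q
    0<Q = ℚ.<-≤-trans (ℚ.positive⁻¹ 1ℚ) (fromℕ-mono-≤ {1} {q} (ℕ.>-nonZero⁻¹ q))
    abundantℚ : Q ℚ.* N ℚ.+ N ℚ.≤ Q ℚ.* (fromℕ r ℚ.* fromℕ k)
    abundantℚ = subst₂ ℚ._≤_ (trans (fromℕ-+ (q * n) n) (cong (ℚ._+ N) (fromℕ-* q n)))
      (trans (fromℕ-* q (r * k)) (cong (Q ℚ.*_) (fromℕ-* r k))) (fromℕ-mono-≤ abundant)
    lemma : ∀ Q N m → 1ℚ ℚ.* N ℚ.+ (Q ℚ.* m ℚ.- (Q ℚ.* N ℚ.+ N) ℚ.+ Q) ≡ Q ℚ.* (m ℚ.- (N ℚ.- 1ℚ))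
    lemma = solve 3 (λ Q N m → con 1ℚ :* N :+ (Q :* m :- (Q :* N :+ N) :+ Q) := Q :* (m :- (N :- con 1ℚ))) refl
      where open +-*-Solver

  discrepancy≤ : ∀ {d} → 1 ≤ n → Regular d G → ∀ (f : Colouring G r) S →
                 treeDiscrepancy f S ℚ.≤ fromℕ (r * d) ℚ.* fromℕ n
  discrepancy≤ {d} 1≤n regular f S = subst (ℚ._≤ fromℕ (r * d) ℚ.* fromℕ n) (sym (treeDiscrepancy≡ f S)) (≤-witness
    ((fromℕ n ℚ.- 1ℚ) ℚ.+ (fromℕ (r * d) ℚ.* fromℕ n ℚ.- fromℕ r ℚ.* fromℕ k))
    (0≤+ (p≤q⇒0≤q-p (fromℕ-mono-≤ {1} {n} 1≤n))
      (p≤q⇒0≤q-p (subst₂ ℚ._≤_ (fromℕ-* r k) (fromℕ-* (r * d) n) (fromℕ-mono-≤ rk≤rdn))))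
    (lemma (fromℕ r ℚ.* fromℕ k) (fromℕ n ℚ.- 1ℚ) (fromℕ (r * d) ℚ.* fromℕ n)))
    where
    k : ℕ
    k = maxColourCount f S
    rearrange : ∀ r n d → r * (n * d) ≡ r * d * n
    rearrange = solve-∀
    rk≤rdn : r * k ≤ r * d * n
    rk≤rdn = ℕ.≤-trans (ℕ.*-monoʳ-≤ r (max≤ f S λ i → Colour.colourCount≤ f S i regular))
            (ℕ.≤-reflexive (rearrange r n d))
    lemma : ∀ a b c → a ℚ.- b ℚ.+ (b ℚ.+ (c ℚ.- a)) ≡ c
    lemma = solve 3 (λ a b c → a :- b :+ (b :+ (c :- a)) := c) refl
      where open +-*-Solver

  colouringOf : Fin ((r ℕ.^ n) ℕ.^ n) → Colouring G r
  colouringOf c (edge u w _ _) = decode c u w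

  colouringOf-encode : ∀ f e → colouringOf (encode (Colour.upper f)) e ≡ f e
  colouringOf-encode f (edge u w u<w u~w) = trans (decode-encode (Colour.upper f) u w) (Colour.upper-edge f u w u<w u~w)

-- The constant `q` of `Counting`, available before a graph is given; its inverse is the lower
-- constant of the theorem.
rate : ℕ → ℕ → ℕ
rate r d = 6 * (1 + 2 * (d * r))

-- The summand `2 * (d * d)` is the size that `few-boundary-edges` asks for, and 8 the one that
-- `large⇒abundant` asks for.
module Discrepancy {n d r₀ : ℕ} (G : Graph n) (regular : Regular d G) (expanding : Expanding G)
  (3≤d : 3 ≤ d) (2≤r : 2 ≤ suc r₀) (large : 2 * (d * d) + 8 ≤ n) where

  private
    r : ℕ
    r = suc r₀

  8≤n : 8 ≤ n
  8≤n = ℕ.≤-trans (ℕ.m≤n+m 8 _) large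

  root : Fin n
  root = Fin.fromℕ< (ℕ.<-≤-trans (s≤s z≤n) 8≤n)

  asSpanningTree : Rooted G → SpanningTree G
  asSpanningTree R = record { tree = RootedTree.tree R ; isTree = RootedTree.isTree R ; subgraph = RootedTree.tree⊆H R }

  -- Codes of disconnected graphs must decode to some spanning tree; expansion guarantees that there
  -- is one.
  default : SpanningTree G
  default with separated-or-rooted G root
  ... | inj₂ R = asSpanningTree R
  ... | inj₁ s = ⊥-elim (expanding⇒not-separated expanding s)

  -- Every spanning tree arises, up to its edge set, from growing a tree in one of finitely many subgraphs.
  TreeCode : Set
  TreeCode = Fin ((2 ℕ.^ n) ℕ.^ n)

  bit : Fin 2 → Bool
  bit zero    = false
  bit (suc _) = true

  unbit : Bool → Fin 2
  unbit b = if b then suc zero else zero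

  bit-unbit : ∀ b → bit (unbit b) ≡ b
  bit-unbit true  = refl
  bit-unbit false = refl

  coded : TreeCode → Graph n
  coded c = record
    { adj = λ u w → adj G u w ∧ (bit (decode c u w) ∧ bit (decode c w u))
    ; symmetric = λ u w → cong₂ _∧_ (symmetric G u w) (Bool.∧-comm (bit (decode c u w)) (bit (decode c w u)))
    ; loopless = λ u → cong (_∧ (bit (decode c u u) ∧ bit (decode c u u))) (loopless G u) }

  treeOf : TreeCode → SpanningTree G
  treeOf c with separated-or-rooted (coded c) root
  ... | inj₁ _ = default
  ... | inj₂ R = record
    { tree = RootedTree.tree R
    ; isTree = RootedTree.isTree R
    ; subgraph = λ u w u~w → ≡true⇒T (Bool.∧-conicalˡ (adj G u w) _ (T⇒≡true (RootedTree.tree⊆H R u w u~w))) }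

  codeOf : SpanningTree G → TreeCode
  codeOf S = encode λ u w → unbit (adj (SpanningTree.tree S) u w)

  module _ (S : SpanningTree G) where
    open SpanningTree S

    coded-codeOf : ∀ u w → adj (coded (codeOf S)) u w ≡ adj tree u w
    coded-codeOf u w = trans (cong₂ (λ a b → adj G u w ∧ (a ∧ b)) (bit-code u w)
            (trans (bit-code w u) (symmetric tree w u)))
      (trans (cong (adj G u w ∧_) (Bool.∧-idem (adj tree u w))) absorb)
      where
      bit-code : ∀ u w → bit (decode (codeOf S) u w) ≡ adj tree u w
      bit-code u w = trans (cong bit (decode-encode (λ u w → unbit (adj tree u w)) u w)) (bit-unbit (adj tree u w))
      absorb : adj G u w ∧ adj tree u w ≡ adj tree u w
      absorb with adj tree u w in eq
      ... | true  = trans (Bool.∧-identityʳ (adj G u w)) (T⇒≡true (subgraph u w (≡true⇒T eq)))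
      ... | false = Bool.∧-zeroʳ (adj G u w)

    -- The graph coded by a tree is the tree itself. Whatever spanning tree is grown in it has the
    -- same edges, as an acyclic graph has no proper connected spanning subgraph.
    treeOf-codeOf : ∀ u w → adj (SpanningTree.tree (treeOf (codeOf S))) u w ≡ adj tree u w
    treeOf-codeOf with separated-or-rooted (coded (codeOf S)) root
    ... | inj₂ R = acyclic⇒minimal tree (RootedTree.tree R) (IsTree.acyclic isTree)
          (λ u w u~w → subst T (coded-codeOf u w) (RootedTree.tree⊆H R u w u~w))
                  (IsTree.connected (RootedTree.isTree R))
    ... | inj₁ s = ⊥-elim (connected⇒not-separated tree (IsTree.connected isTree) (record
          { Separated s hiding (closed) ; closed = λ u w u∈X u~w → Separated.closed s u w u∈X
                  (trans (coded-codeOf u w) u~w) }))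

  module Optimum = Minimax (λ f S → treeDiscrepancy {r = r} {G = G} f S)
    default treeOf codeOf
    (λ f S → treeDiscrepancy-cong f f (treeOf (codeOf S)) S
            (Colour.colourCount-cong f (treeOf (codeOf S)) S (treeOf-codeOf S)))
    (λ _ → zero) colouringOf (encode ∘ Colour.upper)
    (λ f S → treeDiscrepancy-cong (colouringOf (encode (Colour.upper f))) f S S
      (colourCount-ext (colouringOf (encode (Colour.upper f))) f (colouringOf-encode f) S))

  D : ℚ
  D = Optimum.minimax

  isDiscrepancy : IsDiscrepancy G r D
  isDiscrepancy = Optimum.maximum , Optimum.isMaximum , Optimum.isMinimum

  abundant-tree : ∀ f → ∃[ S ] rate (suc r₀) d * n + n ≤ rate (suc r₀) d * (r * maxColourCount f S)
  abundant-tree f = asSpanningTree R , ℕ.≤-trans (proj₂ some) (ℕ.*-monoʳ-≤ (rate (suc r₀) d) (ℕ.*-monoʳ-≤ r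
    (ℕ.≤-trans (count≤colourCount R i) (colourCount≤max f (asSpanningTree R) i))))
    where
    open Colour f
    open Counting G regular expanding 3≤d 2≤r 8≤n colour colour-sym using (deg; Adequate; Abundant; some-abundant)
    module ColourGrowth (i : Fin r) = Growth G (coloured i) (coloured⊆adj i) (coloured-sym i) (λ u → weight d (deg i u))
      (λ C closed → Subgraph.6≤total G regular (coloured i) (coloured⊆adj i) C closed expanding 3≤d
        (ℕ.≤-trans (ℕ.m≤m+n (2 * (d * d)) 8) large))
      root
    grown : ∀ i → Σ[ R ∈ Rooted G ] Adequate i (Rooted.count R (coloured i))
    grown i with ColourGrowth.span i
    ... | inj₂ g = Growth.Grown.tree g , Growth.Grown.adequate g
    ... | inj₁ s = ⊥-elim (expanding⇒not-separated expanding s)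
    some : ∃[ i ] Abundant (Rooted.count (proj₁ (grown i)) (coloured i))
    some = some-abundant (λ i → Rooted.count (proj₁ (grown i)) (coloured i)) (λ i → proj₂ (grown i))
    i : Fin r
    i = proj₁ some
    R : Rooted G
    R = proj₁ (grown i)

  lower-bound : (+ 1 ℚ./ rate (suc r₀) d) ℚ.* fromℕ n ℚ.≤ D
  lower-bound = ℚ.≤-trans
    (abundant⇒discrepancy≥ Optimum.minimiser (proj₁ (abundant-tree Optimum.minimiser)) (rate (suc r₀) d)
            (proj₂ (abundant-tree Optimum.minimiser)))
    (Optimum.≤maximum Optimum.minimiser (proj₁ (abundant-tree Optimum.minimiser)))

  upper-bound : D ℚ.≤ fromℕ (suc r₀ * d) ℚ.* fromℕ n
  upper-bound = Optimum.minimax≤ (discrepancy≤ (ℕ.≤-trans (s≤s z≤n) 8≤n) regular)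

  bounds : Σ[ D ∈ ℚ ] IsDiscrepancy G (suc r₀) D ×
           (+ 1 ℚ./ rate (suc r₀) d) ℚ.* fromℕ n ℚ.≤ D × D ℚ.≤ fromℕ (suc r₀ * d) ℚ.* fromℕ n
  bounds = D , isDiscrepancy , lower-bound , upper-bound

0<fromℕ : ∀ {k} → 1 ≤ k → 0ℚ ℚ.< fromℕ k
0<fromℕ {k} 1≤k = ℚ.<-≤-trans (ℚ.positive⁻¹ 1ℚ) (fromℕ-mono-≤ {1} {k} 1≤k)

0<1/ : ∀ q .{{_ : NonZero q}} → 0ℚ ℚ.< + 1 ℚ./ q
0<1/ q = ℚ.positive⁻¹ (+ 1 ℚ./ q) {{ℚ.normalize-pos 1 q}}

discrepancy-bounds : ∀ r₀ d → 2 ≤ suc r₀ → 3 ≤ d → ∀ n → 2 * (d * d) + 8 ≤ n → (G : Graph n) → Regular d G → (lam : ℝ) →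
  IsSecondLargestEigenvalue (adjacencyMatrix G) lam → lam ≤ᵣ fromℚ ((+ d ℤ.- + 2) ℚ./ 1) →
  Σ[ D ∈ ℚ ] IsDiscrepancy G (suc r₀) D × (+ 1 ℚ./ rate (suc r₀) d) ℚ.* fromℕ n ℚ.≤ D ×
  D ℚ.≤ fromℕ (suc r₀ * d) ℚ.* fromℕ n
discrepancy-bounds r₀ d 2≤r 3≤d zero    n₀≤0 = ⊥-elim (ℕ.n≮0 (ℕ.≤-trans (ℕ.m≤n+m 8 (2 * (d * d))) n₀≤0))
discrepancy-bounds r₀ d 2≤r 3≤d (suc m) n₀≤n G regular lam second lam≤ =
  Discrepancy.bounds G regular (Expansion.expanding G regular lam second lam≤) 3≤d 2≤r n₀≤n

corollary1p7 : ∀ (r d : ℕ) .{{_ : NonZero r}} → 2 ≤ r → 3 ≤ d →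
    Σ[ c₁ ∈ ℚ ] Σ[ c₂ ∈ ℚ ] Σ[ n₀ ∈ ℕ ] 0ℚ ℚ.< c₁ × 0ℚ ℚ.< c₂ ×
    (∀ (n : ℕ) → n₀ ≤ n → (G : Graph n) → Regular d G →
    (lam : ℝ) → IsSecondLargestEigenvalue (adjacencyMatrix G) lam →
    lam ≤ᵣ fromℚ ((+ d ℤ.- + 2) ℚ./ 1) →
    Σ[ D ∈ ℚ ] IsDiscrepancy G r D ×
    c₁ ℚ.* fromℕ n ℚ.≤ D × D ℚ.≤ c₂ ℚ.* fromℕ n)
corollary1p7 (suc r₀) d 2≤r 3≤d =
  (+ 1 ℚ./ rate (suc r₀) d) , fromℕ (suc r₀ * d) , 2 * (d * d) + 8 ,
  0<1/ (rate (suc r₀) d) , 0<fromℕ (ℕ.*-mono-≤ {1} {suc r₀} (s≤s z≤n) (ℕ.≤-trans (s≤s z≤n) 3≤d)) ,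
  discrepancy-bounds r₀ d 2≤r 3≤d
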